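{- Let $E(x,y,q;1)=\sum_{\nu\in\mathcal{CP}}x^{v(\nu)}y^{h(\nu)}q^{d_2(\nu)}$ and put $\Delta=(1+y-x-(q-1)^2xy)^2-4y(1+(q-1)x)^2$. Then $$\begin{aligned}E(x,y,q;1)&=-\frac{q^4x^2y^2\bigl(2+(x+y+1)(q-1)-xy(q-1)^3\bigr)^2}{\sqrt{\Delta}^{\,3}}\\&\quad+\frac{q^4xy(-x^3y+2x^2y^2-xy^3-x^3-x^2y-xy^2-y^3+3x^2+5xy+3y^2-3x-3y+1)}{\Delta^2}\\&\quad-\frac{8q^4x^2y^2(q-1)(x^2-xy+y^2-2x-2y+1)}{\Delta^2}\\&\quad-\frac{q^4x^2y^2(q-1)^2(x^3+x^2y+xy^2+y^3+x^2-44xy+y^2-5x-5y+3)}{\Delta^2}\\&\quad+\frac{q^4x^3y^3(q-1)^3\bigl(8(2y+2x+3)+(3x^2+5xy+3y^2+5x+5y+4)(q-1)\bigr)}{\Delta^2}\\&\quad-\frac{q^4x^4y^4(q-1)^5\bigl(8+3(x+y+1)(q-1)-xy(q-1)^3\bigr)}{\Delta^2}.\end{aligned}$$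
   Context: A cell is a unit square in the plane with sides parallel to the axes and center at an integer point. A polyomino is a finite edge-connected set of cells, considered up to translation; it is convex if each of its columns (cells with a common center $x$-coordinate) and each of its rows (cells with a common center $y$-coordinate) is a contiguous block. $\mathcal{CP}$ is the set of nonempty convex polyominoes up to translation; $v(\nu)$, $h(\nu)$ are the numbers of columns and rows. The degree of a vertex (corner point of a cell) of $\nu$ is the number of distinct unit edges of cells of $\nu$ incident to it; a vertex is interior if it is a vertex of four distinct cells of $\nu$, and a boundary vertex otherwise. $d_2(\nu)$ is the number of boundary vertices of $\nu$ of degree $2$. -}

module Defs where

open import Data.Nat as ℕ using (ℕ; zero; suc; _∸_; _≡ᵇ_)
open import Data.Integer as ℤ using (ℤ; +_; 0ℤ; 1ℤ)
open import Data.Bool using (Bool; true; false; _∧_; _∨_; not; if_then_else_)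
open import Data.List using (List; []; _∷_; map; concatMap; upTo)
open import Data.Product using (_×_; _,_)
open import Relation.Binary.PropositionalEquality using (_≡_)

-- Formal power series in three variables x, y, q with integer
-- coefficients:  f i j k  is the coefficient of  x^i y^j q^k.
-- (ℤ[q][[x,y]] embeds into ℤ[[x,y,q]] as a subring.)

PS : Set
PS = ℕ → ℕ → ℕ → ℤ

infix 4 _≈_
_≈_ : PS → PS → Set
f ≈ g = ∀ i j k → f i j k ≡ g i j k

mono : ℤ → ℕ → ℕ → ℕ → PS
mono n a b c i j k = if (i ≡ᵇ a) ∧ (j ≡ᵇ b) ∧ (k ≡ᵇ c) then n else 0ℤ

#_ : ℕ → PS
# n = mono (+ n) 0 0 0

X Y Q : PS
X = mono 1ℤ 1 0 0
Y = mono 1ℤ 0 1 0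
Q = mono 1ℤ 0 0 1

infixl 6 _+ₛ_ _-ₛ_
infixl 7 _*ₛ_
infixr 8 _^ₛ_

_+ₛ_ : PS → PS → PS
(f +ₛ g) i j k = f i j k ℤ.+ g i j k

-ₛ_ : PS → PS
(-ₛ f) i j k = ℤ.- f i j k

_-ₛ_ : PS → PS → PS
f -ₛ g = f +ₛ (-ₛ g)

sumZ : ℕ → (ℕ → ℤ) → ℤ
sumZ zero f = f 0
sumZ (suc n) f = sumZ n f ℤ.+ f (suc n)

_*ₛ_ : PS → PS → PS
(f *ₛ g) a b c =
  sumZ a λ i → sumZ b λ j → sumZ c λ k →
    f i j k ℤ.* g (a ∸ i) (b ∸ j) (c ∸ k)

_^ₛ_ : PS → ℕ → PS
f ^ₛ zero = # 1
f ^ₛ suc n = f *ₛ (f ^ₛ n)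

-- Convex polyominoes.
-- A polyomino with v columns and h rows is, up to translation, placed
-- in the box of cells with centres (x,y), 1 ≤ x ≤ v, 1 ≤ y ≤ h, using
-- every column and every row of the box (this fixes the translation).
-- A grid is a list of h rows, each a list of v booleans.

Grid : Set
Grid = List (List Bool)

allRows : ℕ → List (List Bool)
allRows zero = [] ∷ []
allRows (suc n) = concatMap (λ r → (false ∷ r) ∷ (true ∷ r) ∷ []) (allRows n)

allGrids : ℕ → ℕ → List Grid
allGrids v zero = [] ∷ []
allGrids v (suc h) = concatMap (λ g → map (λ r → r ∷ g) (allRows v)) (allGrids v h)

nthB : List Bool → ℕ → Bool
nthB [] _ = false
nthB (b ∷ _) zero = b
nthB (_ ∷ bs) (suc n) = nthB bs n

nthRow : Grid → ℕ → List Bool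
nthRow [] _ = []
nthRow (r ∷ _) zero = r
nthRow (_ ∷ rs) (suc n) = nthRow rs n

-- membership of the cell with centre (x,y) (1-indexed; anything outside
-- the box, in particular index 0, is not a cell of the polyomino)
mem : Grid → ℕ → ℕ → Bool
mem g zero y = false
mem g (suc x) zero = false
mem g (suc x) (suc y) = nthB (nthRow g y) x

range1 : ℕ → List ℕ
range1 n = map suc (upTo n)

range0 : ℕ → List ℕ
range0 n = upTo (suc n)

allB : {A : Set} → (A → Bool) → List A → Bool
allB p [] = true
allB p (a ∷ as) = p a ∧ allB p as

anyB : {A : Set} → (A → Bool) → List A → Bool
anyB p [] = false
anyB p (a ∷ as) = p a ∨ anyB p as

countB : {A : Set} → (A → Bool) → List A → ℕ
countB p [] = 0
countB p (a ∷ as) = (if p a then 1 else 0) ℕ.+ countB p as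

contig₀ contig₁ contig₂ : List Bool → Bool
contig₀ [] = true
contig₀ (false ∷ r) = contig₀ r
contig₀ (true ∷ r) = contig₁ r
contig₁ [] = true
contig₁ (true ∷ r) = contig₁ r
contig₁ (false ∷ r) = contig₂ r
contig₂ [] = true
contig₂ (false ∷ r) = contig₂ r
contig₂ (true ∷ _) = false

rowOf : ℕ → Grid → ℕ → List Bool
rowOf v g y = map (λ x → mem g x y) (range1 v)

colOf : ℕ → Grid → ℕ → List Bool
colOf h g x = map (λ y → mem g x y) (range1 h)

rowsColsOK : ℕ → ℕ → Grid → Bool
rowsColsOK v h g =
  allB (λ y → anyB (λ b → b) (rowOf v g y) ∧ contig₀ (rowOf v g y)) (range1 h) ∧
  allB (λ x → anyB (λ b → b) (colOf h g x) ∧ contig₀ (colOf h g x)) (range1 v)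

cells : ℕ → ℕ → Grid → List (ℕ × ℕ)
cells v h g =
  concatMap (λ y → concatMap (λ x → if mem g x y then (x , y) ∷ [] else [])
                             (range1 v))
            (range1 h)

reach : Grid → ℕ → ℕ → ℕ → ℕ → ℕ → Bool
reach g x₀ y₀ zero x y = (x ≡ᵇ x₀) ∧ (y ≡ᵇ y₀)
reach g x₀ y₀ (suc n) x y =
  reach g x₀ y₀ n x y ∨
  (mem g x y ∧ (reach g x₀ y₀ n (x ∸ 1) y ∨ reach g x₀ y₀ n (suc x) y ∨
                reach g x₀ y₀ n x (y ∸ 1) ∨ reach g x₀ y₀ n x (suc y)))

-- nonempty and edge-connected (a path needs at most v*h steps)
nonemptyConnected : ℕ → ℕ → Grid → Bool
nonemptyConnected v h g with cells v h g
... | [] = false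
... | (x₀ , y₀) ∷ cs =
  allB (λ { (x , y) → reach g x₀ y₀ (v ℕ.* h) x y }) ((x₀ , y₀) ∷ cs)

isCP : ℕ → ℕ → Grid → Bool
isCP v h g = nonemptyConnected v h g ∧ rowsColsOK v h g

bcount : Bool → ℕ
bcount true = 1
bcount false = 0

-- The vertex (i,j), 0 ≤ i ≤ v, 0 ≤ j ≤ h, is the common corner of the
-- cells (i,j) [lower-left], (i+1,j) [lower-right], (i,j+1) [upper-left],
-- (i+1,j+1) [upper-right].  Its four possible incident unit edges are
-- the left, right, lower and upper segments, each present iff one of
-- the two cells bordering it belongs to the polyomino.
-- Vertices outside this range are not vertices of the polyomino.
isD2Vertex : Grid → ℕ → ℕ → Bool
isD2Vertex g i j =
  let c₁ = mem g i j
      c₂ = mem g (suc i) j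
      c₃ = mem g i (suc j)
      c₄ = mem g (suc i) (suc j)
      degree = bcount (c₁ ∨ c₃) ℕ.+ bcount (c₂ ∨ c₄)
               ℕ.+ bcount (c₁ ∨ c₂) ℕ.+ bcount (c₃ ∨ c₄)
      isVertex = c₁ ∨ c₂ ∨ c₃ ∨ c₄
      interior = c₁ ∧ c₂ ∧ c₃ ∧ c₄
  in isVertex ∧ not interior ∧ (degree ≡ᵇ 2)

sumN : List ℕ → ℕ
sumN [] = 0
sumN (n ∷ ns) = n ℕ.+ sumN ns

d₂ : ℕ → ℕ → Grid → ℕ
d₂ v h g = sumN (map (λ i → countB (λ j → isD2Vertex g i j) (range0 h)) (range0 v))

cpCount : ℕ → ℕ → ℕ → ℕ
cpCount v h k = countB (λ g → isCP v h g ∧ (d₂ v h g ≡ᵇ k)) (allGrids v h)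

E : PS
E v h k = + cpCount v h k

q-1 : PS
q-1 = Q -ₛ # 1

Δ : PS
Δ = (# 1 +ₛ Y -ₛ X -ₛ (q-1 ^ₛ 2) *ₛ X *ₛ Y) ^ₛ 2
    -ₛ # 4 *ₛ Y *ₛ (# 1 +ₛ q-1 *ₛ X) ^ₛ 2

N₀ : PS
N₀ = Q ^ₛ 4 *ₛ X ^ₛ 2 *ₛ Y ^ₛ 2
     *ₛ (# 2 +ₛ (X +ₛ Y +ₛ # 1) *ₛ q-1 -ₛ X *ₛ Y *ₛ q-1 ^ₛ 3) ^ₛ 2

N₁ N₂ N₃ N₄ N₅ : PS
N₁ = Q ^ₛ 4 *ₛ X *ₛ Y
     *ₛ (-ₛ (X ^ₛ 3 *ₛ Y) +ₛ # 2 *ₛ X ^ₛ 2 *ₛ Y ^ₛ 2 -ₛ X *ₛ Y ^ₛ 3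
         -ₛ X ^ₛ 3 -ₛ X ^ₛ 2 *ₛ Y -ₛ X *ₛ Y ^ₛ 2 -ₛ Y ^ₛ 3
         +ₛ # 3 *ₛ X ^ₛ 2 +ₛ # 5 *ₛ X *ₛ Y +ₛ # 3 *ₛ Y ^ₛ 2
         -ₛ # 3 *ₛ X -ₛ # 3 *ₛ Y +ₛ # 1)
N₂ = # 8 *ₛ Q ^ₛ 4 *ₛ X ^ₛ 2 *ₛ Y ^ₛ 2 *ₛ q-1
     *ₛ (X ^ₛ 2 -ₛ X *ₛ Y +ₛ Y ^ₛ 2 -ₛ # 2 *ₛ X -ₛ # 2 *ₛ Y +ₛ # 1)
N₃ = Q ^ₛ 4 *ₛ X ^ₛ 2 *ₛ Y ^ₛ 2 *ₛ q-1 ^ₛ 2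
     *ₛ (X ^ₛ 3 +ₛ X ^ₛ 2 *ₛ Y +ₛ X *ₛ Y ^ₛ 2 +ₛ Y ^ₛ 3 +ₛ X ^ₛ 2
         -ₛ # 44 *ₛ X *ₛ Y +ₛ Y ^ₛ 2 -ₛ # 5 *ₛ X -ₛ # 5 *ₛ Y +ₛ # 3)
N₄ = Q ^ₛ 4 *ₛ X ^ₛ 3 *ₛ Y ^ₛ 3 *ₛ q-1 ^ₛ 3
     *ₛ (# 8 *ₛ (# 2 *ₛ Y +ₛ # 2 *ₛ X +ₛ # 3)
         +ₛ (# 3 *ₛ X ^ₛ 2 +ₛ # 5 *ₛ X *ₛ Y +ₛ # 3 *ₛ Y ^ₛ 2
             +ₛ # 5 *ₛ X +ₛ # 5 *ₛ Y +ₛ # 4) *ₛ q-1)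
N₅ = Q ^ₛ 4 *ₛ X ^ₛ 4 *ₛ Y ^ₛ 4 *ₛ q-1 ^ₛ 5
     *ₛ (# 8 +ₛ # 3 *ₛ (X +ₛ Y +ₛ # 1) *ₛ q-1 -ₛ X *ₛ Y *ₛ q-1 ^ₛ 3)

N : PS
N = N₁ -ₛ N₂ -ₛ N₃ +ₛ N₄ -ₛ N₅

{-# OPTIONS --safe #-}
module Submission where

-- A convex polyomino is a chain of overlapping intervals (its rows, from bottom to top) whose
-- ends first move outwards and then inwards; besides the four corners of the lowest and highest
-- rows, each move of an end creates one vertex of degree 2.  With x marking the columns gained,
-- staying or moving outwards is the operator R, moving inwards M, staying or moving inwards
-- T = 1 + M, and the completion series by stage satisfy
--   V₂ = 1 + yTTV₂,  V₁ = 1 + y(TRV₁ + TMV₂),  V₀ = 1 + y(RRV₀ + 2MRV₁ + MMV₂).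
-- After y = z² the first equation is solved by two geometric sequences φ, conjugate under
-- z ↦ −z, as V₂ = (φ(z) + φ(−z))/2.  They are eigenvectors of R and, up to a constant, of zT.
-- The kernel method gives a third geometric sequence ψ that absorbs this constant, and its
-- ratio s is where the square root of Δ enters.  Hence V₁ and V₀ are explicit combinations of
-- φ(z), φ(−z) and ψ, and summing V₀ over the first row gives the formula.

-- Why a state of the row-by-row construction is so small: the number of columns is fixed
-- beforehand, every column must be reached, and a column behind an abandoned one can no longer be
-- reached. Hence an end may move inwards only if no column on its side is unreached, and a state is
-- the row length with the two numbers of unreached columns; summing over these two with given total
-- leaves a single x. The variable z is forced by V₂ = 1 + z²TTV₂: φ(z) = (1 + zT)V₂ solves φ = 1 +
-- zTφ, and a difference in n turns this into a first-order recurrence. The obstacle is the 1, which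
-- survives in Tφ, so that φ(z) and φ(-z) alone cannot solve the equation for V₁. On φ(z) the
-- operator 1 - zR acts as k(z)/m(z), and Δ = k(z)k(-z): this is the origin of Δ² in the
-- denominators. Division is avoided throughout: ratios are cross-multiplied, identities are
-- certified by explicit cofactors, and only series with nonzero constant coefficient are cancelled.

open import Defs
open import Algebra.Bundles using (CommutativeRing)
open import Algebra.Structures using (IsAbelianGroup; IsCommutativeRing)
import Algebra.Consequences.Setoid as Consequences
import Algebra.Construct.Pointwise as Pointwise
import Algebra.Properties.Ring as RingProperties
open import Data.Bool using (Bool; true; false; _∧_; _∨_; not; if_then_else_; T)
import Data.Bool.Properties as BoolP
open import Data.Empty using (⊥-elim)
open import Data.Fin as Fin using (Fin)
open import Data.Integer as ℤ using (ℤ; +_; 0ℤ; 1ℤ)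
import Data.Integer.Properties as ℤP
open import Data.List using (List; []; _∷_; _++_; length; map; drop; concatMap; applyUpTo; upTo)
open import Data.Nat as ℕ using (ℕ; zero; suc; _∸_; _≤_; _<_; z≤n; s≤s; _≡ᵇ_)
import Data.Nat.Properties as ℕP
open import Data.Product using (_×_; _,_; proj₁; proj₂; ∃; ∃₂)
open import Data.Sum using (_⊎_; inj₁; inj₂)
open import Data.Unit using (⊤; tt)
open import Data.Vec using (Vec; []; _∷_; lookup)
open import Function using (_∘_; id; case_of_)
open import Level using (0ℓ)
import Relation.Binary.Reasoning.Setoid as SetoidReasoning
open import Relation.Binary.PropositionalEquality as ≡ using (_≡_; _≢_; refl; cong; cong₂)
open import Relation.Nullary.Decidable using (True)

-- Power series in one variable

module Series {c ℓ} (R : CommutativeRing c ℓ) where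

  open CommutativeRing R renaming (Carrier to A; _≈_ to _≃_; refl to ≃-refl; sym to ≃-sym; trans to ≃-trans)
  open SetoidReasoning setoid

  sumTo : ℕ → (ℕ → A) → A
  sumTo zero f = f 0
  sumTo (suc n) f = sumTo n f + f (suc n)

  sumTo-cong : ∀ n {f g} → (∀ i → i ≤ n → f i ≃ g i) → sumTo n f ≃ sumTo n g
  sumTo-cong zero eq = eq 0 z≤n
  sumTo-cong (suc n) eq =
    +-cong (sumTo-cong n λ i i≤n → eq i (ℕP.m≤n⇒m≤1+n i≤n)) (eq (suc n) ℕP.≤-refl)

  sumTo-front : ∀ n f → sumTo (suc n) f ≃ f 0 + sumTo n (f ∘ suc)
  sumTo-front zero f = ≃-refl
  sumTo-front (suc n) f = ≃-trans (+-congʳ (sumTo-front n f)) (+-assoc _ _ _)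

  infixl 7 _⊛_
  _⊛_ : (ℕ → A) → (ℕ → A) → ℕ → A
  (f ⊛ g) n = sumTo n λ i → f i * g (n ∸ i)

  ⊛-front : ∀ f g n → (f ⊛ g) (suc n) ≃ f 0 * g (suc n) + (f ∘ suc ⊛ g) n
  ⊛-front f g n = sumTo-front n _

  ⊛-back : ∀ f g n → (f ⊛ g) (suc n) ≃ (f ⊛ g ∘ suc) n + f (suc n) * g 0
  ⊛-back f g n = +-cong
    (sumTo-cong n λ i i≤n → *-congˡ (reflexive (≡.cong g (ℕP.+-∸-assoc 1 i≤n))))
    (*-congˡ (reflexive (≡.cong g (ℕP.n∸n≡0 n))))

  infix 4 _≋_
  _≋_ : (ℕ → A) → (ℕ → A) → Set ℓ
  f ≋ g = ∀ n → f n ≃ g n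

  infixl 6 _⊕_
  _⊕_ : (ℕ → A) → (ℕ → A) → ℕ → A
  (f ⊕ g) n = f n + g n

  one : ℕ → A
  one zero = 1#
  one (suc _) = 0#

  ⊛-cong : ∀ {f f′ g g′} → f ≋ f′ → g ≋ g′ → f ⊛ g ≋ f′ ⊛ g′
  ⊛-cong p q n = sumTo-cong n λ i _ → *-cong (p i) (q (n ∸ i))

  ⊛-comm : ∀ f g → f ⊛ g ≋ g ⊛ f
  ⊛-comm f g zero = *-comm _ _
  ⊛-comm f g (suc n) = begin
    (f ⊛ g) (suc n)                       ≈⟨ ⊛-front f g n ⟩
    f 0 * g (suc n) + (f ∘ suc ⊛ g) n     ≈⟨ +-cong (*-comm _ _) (⊛-comm (f ∘ suc) g n) ⟩
    g (suc n) * f 0 + (g ⊛ f ∘ suc) n     ≈⟨ +-comm _ _ ⟩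
    (g ⊛ f ∘ suc) n + g (suc n) * f 0     ≈⟨ ⊛-back g f n ⟨
    (g ⊛ f) (suc n)                       ∎

  interchange : ∀ a b c d → (a + b) + (c + d) ≃ (a + c) + (b + d)
  interchange a b c d = begin
    (a + b) + (c + d)  ≈⟨ +-assoc a b (c + d) ⟩
    a + (b + (c + d))  ≈⟨ +-congˡ (≃-trans (≃-sym (+-assoc b c d)) (≃-trans (+-congʳ (+-comm b c)) (+-assoc c b d))) ⟩
    a + (c + (b + d))  ≈⟨ +-assoc a c (b + d) ⟨
    (a + c) + (b + d)  ∎

  ⊛-distribʳ : ∀ h f g → (f ⊕ g) ⊛ h ≋ (f ⊛ h) ⊕ (g ⊛ h)
  ⊛-distribʳ h f g zero = distribʳ _ _ _
  ⊛-distribʳ h f g (suc n) = begin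
    ((f ⊕ g) ⊛ h) (suc n)
      ≈⟨ ⊛-front (f ⊕ g) h n ⟩
    (f 0 + g 0) * h (suc n) + ((f ∘ suc ⊕ g ∘ suc) ⊛ h) n
      ≈⟨ +-cong (distribʳ _ _ _) (⊛-distribʳ h (f ∘ suc) (g ∘ suc) n) ⟩
    (f 0 * h (suc n) + g 0 * h (suc n)) + ((f ∘ suc ⊛ h) n + (g ∘ suc ⊛ h) n)
      ≈⟨ interchange _ _ _ _ ⟩
    (f 0 * h (suc n) + (f ∘ suc ⊛ h) n) + (g 0 * h (suc n) + (g ∘ suc ⊛ h) n)
      ≈⟨ +-cong (⊛-front f h n) (⊛-front g h n) ⟨
    (f ⊛ h) (suc n) + (g ⊛ h) (suc n) ∎

  ⊛-scale : ∀ a f g → (λ i → a * f i) ⊛ g ≋ (λ n → a * (f ⊛ g) n)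
  ⊛-scale a f g zero = *-assoc _ _ _
  ⊛-scale a f g (suc n) = begin
    ((λ i → a * f i) ⊛ g) (suc n)                        ≈⟨ ⊛-front _ g n ⟩
    a * f 0 * g (suc n) + ((λ i → a * f (suc i)) ⊛ g) n  ≈⟨ +-cong (*-assoc _ _ _) (⊛-scale a (f ∘ suc) g n) ⟩
    a * (f 0 * g (suc n)) + a * (f ∘ suc ⊛ g) n          ≈⟨ distribˡ _ _ _ ⟨
    a * (f 0 * g (suc n) + (f ∘ suc ⊛ g) n)              ≈⟨ *-congˡ (⊛-front f g n) ⟨
    a * (f ⊛ g) (suc n)                                  ∎

  ⊛-assoc : ∀ f g h → (f ⊛ g) ⊛ h ≋ f ⊛ (g ⊛ h)
  ⊛-assoc f g h zero = *-assoc _ _ _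
  ⊛-assoc f g h (suc n) = begin
    ((f ⊛ g) ⊛ h) (suc n)
      ≈⟨ ⊛-front (f ⊛ g) h n ⟩
    f 0 * g 0 * h (suc n) + ((f ⊛ g) ∘ suc ⊛ h) n
      ≈⟨ +-cong (*-assoc _ _ _) (⊛-cong {g = h} (⊛-front f g) (λ _ → ≃-refl) n) ⟩
    f 0 * (g 0 * h (suc n)) + (((λ i → f 0 * g (suc i)) ⊕ (f ∘ suc ⊛ g)) ⊛ h) n
      ≈⟨ +-congˡ (⊛-distribʳ h _ _ n) ⟩
    f 0 * (g 0 * h (suc n)) + (((λ i → f 0 * g (suc i)) ⊛ h) n + ((f ∘ suc ⊛ g) ⊛ h) n)
      ≈⟨ +-congˡ (+-cong (⊛-scale (f 0) (g ∘ suc) h n) (⊛-assoc (f ∘ suc) g h n)) ⟩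
    f 0 * (g 0 * h (suc n)) + (f 0 * (g ∘ suc ⊛ h) n + (f ∘ suc ⊛ (g ⊛ h)) n)
      ≈⟨ +-assoc _ _ _ ⟨
    f 0 * (g 0 * h (suc n)) + f 0 * (g ∘ suc ⊛ h) n + (f ∘ suc ⊛ (g ⊛ h)) n
      ≈⟨ +-congʳ (≃-trans (≃-sym (distribˡ _ _ _)) (*-congˡ (≃-sym (⊛-front g h n)))) ⟩
    f 0 * (g ⊛ h) (suc n) + (f ∘ suc ⊛ (g ⊛ h)) n
      ≈⟨ ⊛-front f (g ⊛ h) n ⟨
    (f ⊛ (g ⊛ h)) (suc n) ∎

  ⊛-zeroˡ : ∀ g → (λ _ → 0#) ⊛ g ≋ (λ _ → 0#)
  ⊛-zeroˡ g zero = zeroˡ _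
  ⊛-zeroˡ g (suc n) =
    ≃-trans (⊛-front _ g n) (≃-trans (+-cong (zeroˡ _) (⊛-zeroˡ g n)) (+-identityˡ _))

  ⊛-identityˡ : ∀ g → one ⊛ g ≋ g
  ⊛-identityˡ g zero = *-identityˡ _
  ⊛-identityˡ g (suc n) =
    ≃-trans (⊛-front one g n) (≃-trans (+-cong (*-identityˡ _) (⊛-zeroˡ g n)) (+-identityʳ _))

  ⊛-const : ∀ f g → (∀ n → f (suc n) ≃ 0#) → f ⊛ g ≋ (λ n → f 0 * g n)
  ⊛-const f g f≃0 zero = ≃-refl
  ⊛-const f g f≃0 (suc n) = ≃-trans (⊛-front f g n) (≃-trans
    (+-congˡ (≃-trans (⊛-cong {g = g} f≃0 (λ _ → ≃-refl) n) (⊛-zeroˡ g n))) (+-identityʳ _))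

  ⊛-shift : ∀ f g n → f 0 ≃ 0# → (f ⊛ g) (suc n) ≃ (f ∘ suc ⊛ g) n
  ⊛-shift f g n f≃0 = ≃-trans (⊛-front f g n)
    (≃-trans (+-congʳ (≃-trans (*-congʳ f≃0) (zeroˡ _))) (+-identityˡ _))

  -- The operations are arguments so that a product which agrees with _⊛_ only
  -- propositionally can be used as the ring multiplication.
  seriesRing : (_∙_ : (ℕ → A) → (ℕ → A) → ℕ → A) (e : ℕ → A) →
               (∀ f g → f ∙ g ≋ f ⊛ g) → e ≋ one → CommutativeRing c ℓ
  seriesRing _∙_ e ∙≋⊛ e≋one = record { isCommutativeRing = isCR }
    where
    ab = Pointwise.isAbelianGroup ℕ +-isAbelianGroup
    open IsAbelianGroup ab using () renaming
      (setoid to S; sym to ≋-sym; trans to ≋-trans; refl to ≋-refl; ∙-cong to ⊕-cong)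
    cong∙ : ∀ {f f′ g g′} → f ≋ f′ → g ≋ g′ → (f ∙ g) ≋ (f′ ∙ g′)
    cong∙ {f} {f′} {g} {g′} p q =
      ≋-trans (∙≋⊛ f g) (≋-trans (⊛-cong p q) (≋-sym (∙≋⊛ f′ g′)))
    comm : ∀ f g → (f ∙ g) ≋ (g ∙ f)
    comm f g = ≋-trans (∙≋⊛ f g) (≋-trans (⊛-comm f g) (≋-sym (∙≋⊛ g f)))
    idˡ : ∀ f → (e ∙ f) ≋ f
    idˡ f = ≋-trans (∙≋⊛ e f) (≋-trans (⊛-cong {g = f} e≋one ≋-refl) (⊛-identityˡ f))
    assoc : ∀ f g h → ((f ∙ g) ∙ h) ≋ (f ∙ (g ∙ h))
    assoc f g h = ≋-trans (∙≋⊛ (f ∙ g) h) (≋-trans (⊛-cong {g = h} (∙≋⊛ f g) ≋-refl)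
      (≋-trans (⊛-assoc f g h) (≋-trans (⊛-cong {f = f} ≋-refl (≋-sym (∙≋⊛ g h))) (≋-sym (∙≋⊛ f (g ∙ h))))))
    distʳ : ∀ h f g → ((f ⊕ g) ∙ h) ≋ ((f ∙ h) ⊕ (g ∙ h))
    distʳ h f g = ≋-trans (∙≋⊛ (f ⊕ g) h) (≋-trans (⊛-distribʳ h f g)
      (⊕-cong (≋-sym (∙≋⊛ f h)) (≋-sym (∙≋⊛ g h))))
    isCR : IsCommutativeRing _≋_ _⊕_ _∙_ (λ f n → - f n) (λ _ → 0#) e
    isCR = record
      { isRing = record
        { +-isAbelianGroup = ab
        ; *-cong = cong∙
        ; *-assoc = assoc
        ; *-identity = idˡ , λ f → ≋-trans (comm f e) (idˡ f)
        ; distrib = Consequences.comm∧distrʳ⇒distr S ⊕-cong comm distʳ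
        }
      ; *-comm = comm
      }

-- The ring of power series in x, y and q

ℤ⟦q⟧ ℤ⟦y,q⟧ : CommutativeRing 0ℓ 0ℓ
ℤ⟦q⟧ = Series.seriesRing ℤP.+-*-commutativeRing _ _ (λ _ _ _ → refl) (λ _ → refl)
ℤ⟦y,q⟧ = Series.seriesRing ℤ⟦q⟧ _ _ (λ _ _ _ _ → refl) (λ _ _ → refl)

module S₁ = Series ℤP.+-*-commutativeRing
module S₂ = Series ℤ⟦q⟧
module S₃ = Series ℤ⟦y,q⟧

sumTo₁ : ∀ n f → S₁.sumTo n f ≡ sumZ n f
sumTo₁ zero f = refl
sumTo₁ (suc n) f = ≡.cong (ℤ._+ f (suc n)) (sumTo₁ n f)

sumTo₂ : ∀ n f k → S₂.sumTo n f k ≡ sumZ n (λ i → f i k)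
sumTo₂ zero f k = refl
sumTo₂ (suc n) f k = ≡.cong (ℤ._+ f (suc n) k) (sumTo₂ n f k)

sumTo₃ : ∀ n f j k → S₃.sumTo n f j k ≡ sumZ n (λ i → f i j k)
sumTo₃ zero f j k = refl
sumTo₃ (suc n) f j k = ≡.cong (ℤ._+ f (suc n) j k) (sumTo₃ n f j k)

sumZ-cong : ∀ n {f g} → (∀ i → i ≤ n → f i ≡ g i) → sumZ n f ≡ sumZ n g
sumZ-cong n {f} {g} eq =
  ≡.trans (≡.sym (sumTo₁ n f)) (≡.trans (S₁.sumTo-cong n eq) (sumTo₁ n g))

*ₛ-⊛ : ∀ f g i → (∀ j k → (f *ₛ g) i j k ≡ (f S₃.⊛ g) i j k)
*ₛ-⊛ f g a b c = ≡.sym (≡.trans (sumTo₃ a _ b c) (sumZ-cong a λ i _ →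
  ≡.trans (sumTo₂ b _ c) (sumZ-cong b λ j _ → sumTo₁ c _)))

#1-one : ∀ i j k → (# 1) i j k ≡ S₃.one i j k
#1-one zero zero zero = refl
#1-one zero zero (suc k) = refl
#1-one zero (suc j) k = refl
#1-one (suc i) j k = refl

PS-ring : CommutativeRing 0ℓ 0ℓ
PS-ring = S₃.seriesRing _*ₛ_ (# 1) *ₛ-⊛ #1-one

module ≈ = CommutativeRing PS-ring
open ≈ public using () renaming (0# to 0ₛ)

const : ℤ → PS
const n = mono n 0 0 0

const-* : ∀ n f i j k → (const n *ₛ f) i j k ≡ n ℤ.* f i j k
const-* n f i j k =
  ≡.trans (*ₛ-⊛ (const n) f i j k)
  (≡.trans (S₃.⊛-const (const n) f (λ _ _ _ → refl) i j k)
  (≡.trans (S₂.⊛-const (const n 0) (f i) (λ _ _ → refl) j k)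
  (S₁.⊛-const (const n 0 0) (f i j) (λ _ → refl) k)))

X-*-zero : ∀ f j k → (X *ₛ f) 0 j k ≡ 0ℤ
X-*-zero f j k = ≡.trans (*ₛ-⊛ X f 0 j k) (S₂.⊛-zeroˡ (f 0) j k)

X-*-suc : ∀ f i j k → (X *ₛ f) (suc i) j k ≡ f i j k
X-*-suc f i j k =
  ≡.trans (*ₛ-⊛ X f (suc i) j k)
  (≡.trans (S₃.⊛-shift X f i (λ _ _ → refl) j k)
  (≡.trans (≡.sym (*ₛ-⊛ (# 1) f i j k)) (≈.*-identityˡ f i j k)))

Y-*-zero : ∀ f i k → (Y *ₛ f) i 0 k ≡ 0ℤ
Y-*-zero f i k =
  ≡.trans (*ₛ-⊛ Y f i 0 k)
  (≡.trans (S₃.⊛-const Y f (λ _ _ _ → refl) i 0 k)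
  (S₁.⊛-zeroˡ (f i 0) k))

Y-*-suc : ∀ f i j k → (Y *ₛ f) i (suc j) k ≡ f i j k
Y-*-suc f i j k =
  ≡.trans (*ₛ-⊛ Y f i (suc j) k)
  (≡.trans (S₃.⊛-const Y f (λ _ _ _ → refl) i (suc j) k)
  (≡.trans (S₂.⊛-shift (Y 0) (f i) j (λ _ → refl) k)
  (≡.trans (S₂.⊛-const (Y 0 ∘ suc) (f i) (λ _ _ → refl) j k)
  (≡.trans (S₁.⊛-const (Y 0 1) (f i j) (λ _ → refl) k) (ℤP.*-identityˡ _)))))

Q-* : ∀ f i j k → (Q *ₛ f) i j k ≡ (Q 0 0 S₁.⊛ f i j) k
Q-* f i j k =
  ≡.trans (*ₛ-⊛ Q f i j k)
  (≡.trans (S₃.⊛-const Q f (λ _ _ _ → refl) i j k)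
  (S₂.⊛-const (Q 0) (f i) (λ _ _ → refl) j k))

Q-*-zero : ∀ f i j → (Q *ₛ f) i j 0 ≡ 0ℤ
Q-*-zero f i j = ≡.trans (Q-* f i j 0) refl

Q-*-suc : ∀ f i j k → (Q *ₛ f) i j (suc k) ≡ f i j k
Q-*-suc f i j k =
  ≡.trans (Q-* f i j (suc k))
  (≡.trans (S₁.⊛-shift (Q 0 0) (f i j) k refl)
  (≡.trans (S₁.⊛-const (Q 0 0 ∘ suc) (f i j) (λ _ → refl) k) (ℤP.*-identityˡ _)))

module ≈P = RingProperties ≈.ring

const-+ : ∀ a b → const (a ℤ.+ b) ≈ const a +ₛ const b
const-+ a b zero zero zero = refl
const-+ a b zero zero (suc k) = refl
const-+ a b zero (suc j) k = refl
const-+ a b (suc i) j k = refl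

const-neg : ∀ a → const (ℤ.- a) ≈ -ₛ const a
const-neg a zero zero zero = refl
const-neg a zero zero (suc k) = refl
const-neg a zero (suc j) k = refl
const-neg a (suc i) j k = refl

const-0 : const 0ℤ ≈ 0ₛ
const-0 zero zero zero = refl
const-0 zero zero (suc k) = refl
const-0 zero (suc j) k = refl
const-0 (suc i) j k = refl

const-mul : ∀ a b → const (a ℤ.* b) ≈ const a *ₛ const b
const-mul a b i j k = ≡.trans (lemma i j k) (≡.sym (const-* a (const b) i j k))
  where
  lemma : ∀ i j k → const (a ℤ.* b) i j k ≡ a ℤ.* const b i j k
  lemma zero zero zero = refl
  lemma zero zero (suc k) = ≡.sym (ℤP.*-zeroʳ a)
  lemma zero (suc j) k = ≡.sym (ℤP.*-zeroʳ a)
  lemma (suc i) j k = ≡.sym (ℤP.*-zeroʳ a)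

-- Deciding polynomial identities

Pol : ℕ → Set
Pol zero = ℤ
Pol (suc n) = List (Pol n)

0ᵖ : ∀ n → Pol n
0ᵖ zero = 0ℤ
0ᵖ (suc n) = []

cᵖ : ∀ n → ℤ → Pol n
cᵖ zero c = c
cᵖ (suc n) c = cᵖ n c ∷ []

xᵖ : ∀ {n} → Fin n → Pol n
xᵖ {suc n} Fin.zero = 0ᵖ n ∷ cᵖ n 1ℤ ∷ []
xᵖ (Fin.suc i) = xᵖ i ∷ []

addᵖ mulᵖ : ∀ n → Pol n → Pol n → Pol n
addᵖ zero a b = a ℤ.+ b
addᵖ (suc n) [] q = q
addᵖ (suc n) (a ∷ p) [] = a ∷ p
addᵖ (suc n) (a ∷ p) (b ∷ q) = addᵖ n a b ∷ addᵖ (suc n) p q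

mulᵖ zero a b = a ℤ.* b
mulᵖ (suc n) [] q = []
mulᵖ (suc n) (a ∷ p) q = addᵖ (suc n) (map (mulᵖ n a) q) (0ᵖ n ∷ mulᵖ (suc n) p q)

negᵖ : ∀ n → Pol n → Pol n
negᵖ zero a = ℤ.- a
negᵖ (suc n) p = map (negᵖ n) p

isZero : ∀ n → Pol n → Bool
isZero zero (+ zero) = true
isZero zero _ = false
isZero (suc n) [] = true
isZero (suc n) (a ∷ p) = isZero n a ∧ isZero (suc n) p

ev : ∀ n → Pol n → Vec PS n → PS
ev zero c ρ = const c
ev (suc n) [] ρ = 0ₛ
ev (suc n) (a ∷ p) (x ∷ ρ) = ev n a ρ +ₛ x *ₛ ev (suc n) p (x ∷ ρ)

module ≈-Reasoning = SetoidReasoning ≈.setoid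

+-swap : ∀ a b c d → (a +ₛ b) +ₛ (c +ₛ d) ≈ (a +ₛ c) +ₛ (b +ₛ d)
+-swap a b c d i = S₃.interchange (a i) (b i) (c i) (d i)

ev-0 : ∀ n ρ → ev n (0ᵖ n) ρ ≈ 0ₛ
ev-0 zero ρ = const-0
ev-0 (suc n) ρ = ≈.refl

ev-c : ∀ n c ρ → ev n (cᵖ n c) ρ ≈ const c
ev-c zero c ρ = ≈.refl
ev-c (suc n) c (x ∷ ρ) =
  ≈.trans (≈.+-cong (ev-c n c ρ) (≈.zeroʳ x)) (≈.+-identityʳ (const c))

ev-x : ∀ {n} (i : Fin n) ρ → ev n (xᵖ i) ρ ≈ lookup ρ i
ev-x {suc n} Fin.zero (x ∷ ρ) = begin
  ev n (0ᵖ n) ρ +ₛ x *ₛ (ev n (cᵖ n 1ℤ) ρ +ₛ x *ₛ 0ₛ)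
    ≈⟨ ≈.+-cong (ev-0 n ρ) (≈.*-congˡ {x} (≈.+-cong (ev-c n 1ℤ ρ) (≈.zeroʳ x))) ⟩
  0ₛ +ₛ x *ₛ (# 1 +ₛ 0ₛ)
    ≈⟨ ≈.+-identityˡ _ ⟩
  x *ₛ (# 1 +ₛ 0ₛ)
    ≈⟨ ≈.*-congˡ {x} (≈.+-identityʳ (# 1)) ⟩
  x *ₛ # 1
    ≈⟨ ≈.*-identityʳ x ⟩
  x ∎
  where open ≈-Reasoning
ev-x (Fin.suc i) (x ∷ ρ) =
  ≈.trans (≈.+-cong (ev-x i ρ) (≈.zeroʳ x)) (≈.+-identityʳ (lookup ρ i))

ev-add : ∀ n p q ρ → ev n (addᵖ n p q) ρ ≈ ev n p ρ +ₛ ev n q ρ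
ev-add zero a b ρ = const-+ a b
ev-add (suc n) [] q ρ = ≈.sym (≈.+-identityˡ _)
ev-add (suc n) (a ∷ p) [] ρ = ≈.sym (≈.+-identityʳ _)
ev-add (suc n) (a ∷ p) (b ∷ q) (x ∷ ρ) = begin
  ev n (addᵖ n a b) ρ +ₛ x *ₛ ev (suc n) (addᵖ (suc n) p q) (x ∷ ρ)
    ≈⟨ ≈.+-cong (ev-add n a b ρ) (≈.*-congˡ {x} (ev-add (suc n) p q (x ∷ ρ))) ⟩
  (A +ₛ B) +ₛ x *ₛ (P +ₛ Q′)
    ≈⟨ ≈.+-congˡ {A +ₛ B} (≈.distribˡ x P Q′) ⟩
  (A +ₛ B) +ₛ (x *ₛ P +ₛ x *ₛ Q′)
    ≈⟨ +-swap A B (x *ₛ P) (x *ₛ Q′) ⟩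
  (A +ₛ x *ₛ P) +ₛ (B +ₛ x *ₛ Q′) ∎
  where
  open ≈-Reasoning
  A = ev n a ρ
  B = ev n b ρ
  P = ev (suc n) p (x ∷ ρ)
  Q′ = ev (suc n) q (x ∷ ρ)

ev-neg : ∀ n p ρ → ev n (negᵖ n p) ρ ≈ -ₛ ev n p ρ
ev-neg zero a ρ = const-neg a
ev-neg (suc n) [] ρ = λ _ _ _ → refl
ev-neg (suc n) (a ∷ p) (x ∷ ρ) = begin
  ev n (negᵖ n a) ρ +ₛ x *ₛ ev (suc n) (map (negᵖ n) p) (x ∷ ρ)
    ≈⟨ ≈.+-cong (ev-neg n a ρ) (≈.*-congˡ {x} (ev-neg (suc n) p (x ∷ ρ))) ⟩
  -ₛ A +ₛ x *ₛ (-ₛ P)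
    ≈⟨ ≈.+-congˡ { -ₛ A} (≈.sym (≈P.-‿distribʳ-* x P)) ⟩
  -ₛ A +ₛ -ₛ (x *ₛ P)
    ≈⟨ ≈P.-‿+-comm A (x *ₛ P) ⟩
  -ₛ (A +ₛ x *ₛ P) ∎
  where
  open ≈-Reasoning
  A = ev n a ρ
  P = ev (suc n) p (x ∷ ρ)

ev-mul : ∀ n p q ρ → ev n (mulᵖ n p q) ρ ≈ ev n p ρ *ₛ ev n q ρ
ev-scale : ∀ n a q x ρ → ev (suc n) (map (mulᵖ n a) q) (x ∷ ρ) ≈ ev n a ρ *ₛ ev (suc n) q (x ∷ ρ)

ev-scale n a [] x ρ = ≈.sym (≈.zeroʳ (ev n a ρ))
ev-scale n a (b ∷ q) x ρ = begin
  ev n (mulᵖ n a b) ρ +ₛ x *ₛ ev (suc n) (map (mulᵖ n a) q) (x ∷ ρ)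
    ≈⟨ ≈.+-cong (ev-mul n a b ρ) (≈.*-congˡ {x} (ev-scale n a q x ρ)) ⟩
  A *ₛ B +ₛ x *ₛ (A *ₛ Q′)
    ≈⟨ ≈.+-congˡ {A *ₛ B} (≈.trans (≈.sym (≈.*-assoc x A Q′))
         (≈.trans (≈.*-congʳ {Q′} (≈.*-comm x A)) (≈.*-assoc A x Q′))) ⟩
  A *ₛ B +ₛ A *ₛ (x *ₛ Q′)
    ≈⟨ ≈.distribˡ A B (x *ₛ Q′) ⟨
  A *ₛ (B +ₛ x *ₛ Q′) ∎
  where
  open ≈-Reasoning
  A = ev n a ρ
  B = ev n b ρ
  Q′ = ev (suc n) q (x ∷ ρ)

ev-mul zero a b ρ = const-mul a b
ev-mul (suc n) [] q ρ = ≈.sym (≈.zeroˡ (ev (suc n) q ρ))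
ev-mul (suc n) (a ∷ p) q (x ∷ ρ) = begin
  ev (suc n) (addᵖ (suc n) (map (mulᵖ n a) q) (0ᵖ n ∷ mulᵖ (suc n) p q)) (x ∷ ρ)
    ≈⟨ ev-add (suc n) (map (mulᵖ n a) q) (0ᵖ n ∷ mulᵖ (suc n) p q) (x ∷ ρ) ⟩
  ev (suc n) (map (mulᵖ n a) q) (x ∷ ρ) +ₛ (ev n (0ᵖ n) ρ +ₛ x *ₛ ev (suc n) (mulᵖ (suc n) p q) (x ∷ ρ))
    ≈⟨ ≈.+-cong (ev-scale n a q x ρ)
         (≈.trans (≈.+-congʳ {x *ₛ ev (suc n) (mulᵖ (suc n) p q) (x ∷ ρ)} (ev-0 n ρ))
         (≈.trans (≈.+-identityˡ _) (≈.*-congˡ {x} (ev-mul (suc n) p q (x ∷ ρ))))) ⟩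
  A *ₛ Q′ +ₛ x *ₛ (P *ₛ Q′)
    ≈⟨ ≈.+-congˡ {A *ₛ Q′} (≈.sym (≈.*-assoc x P Q′)) ⟩
  A *ₛ Q′ +ₛ x *ₛ P *ₛ Q′
    ≈⟨ ≈.distribʳ Q′ A (x *ₛ P) ⟨
  (A +ₛ x *ₛ P) *ₛ Q′ ∎
  where
  open ≈-Reasoning
  A = ev n a ρ
  P = ev (suc n) p (x ∷ ρ)
  Q′ = ev (suc n) q (x ∷ ρ)

ev-isZero : ∀ n p ρ → isZero n p ≡ true → ev n p ρ ≈ 0ₛ
ev-isZero zero (+ zero) ρ _ = const-0
ev-isZero (suc n) [] ρ _ = ≈.refl
ev-isZero (suc n) (a ∷ p) (x ∷ ρ) eq with isZero n a in eqa
... | true = ≈.trans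
  (≈.+-cong (ev-isZero n a ρ eqa)
    (≈.trans (≈.*-congˡ {x} (ev-isZero (suc n) p (x ∷ ρ) eq)) (≈.zeroʳ x)))
  (≈.+-identityˡ 0ₛ)

infixl 6 _:+_ _:-_
infixl 7 _:*_
infixr 8 _:^_
infix 9 :-_

data Expr (n : ℕ) : Set where
  con : ℤ → Expr n
  var : Fin n → Expr n
  _:+_ _:*_ _:-_ : Expr n → Expr n → Expr n
  :-_ : Expr n → Expr n
  _:^_ : Expr n → ℕ → Expr n

⟦_⟧ : ∀ {n} → Expr n → Vec PS n → PS
⟦ con c ⟧ ρ = const c
⟦ var i ⟧ ρ = lookup ρ i
⟦ e :+ f ⟧ ρ = ⟦ e ⟧ ρ +ₛ ⟦ f ⟧ ρ
⟦ e :* f ⟧ ρ = ⟦ e ⟧ ρ *ₛ ⟦ f ⟧ ρ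
⟦ e :- f ⟧ ρ = ⟦ e ⟧ ρ -ₛ ⟦ f ⟧ ρ
⟦ :- e ⟧ ρ = -ₛ ⟦ e ⟧ ρ
⟦ e :^ n ⟧ ρ = ⟦ e ⟧ ρ ^ₛ n

ν : ∀ m {n} {m<n : True (m ℕ.<? n)} → Expr n
ν m {n} {m<n} = var (Fin.#_ m {n} {m<n})

powᵖ : ∀ n → Pol n → ℕ → Pol n
powᵖ n p zero = cᵖ n 1ℤ
powᵖ n p (suc m) = mulᵖ n p (powᵖ n p m)

norm : ∀ {n} → Expr n → Pol n
norm (con c) = cᵖ _ c
norm (var i) = xᵖ i
norm (e :+ f) = addᵖ _ (norm e) (norm f)
norm (e :* f) = mulᵖ _ (norm e) (norm f)
norm (e :- f) = addᵖ _ (norm e) (negᵖ _ (norm f))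
norm (:- e) = negᵖ _ (norm e)
norm (e :^ m) = powᵖ _ (norm e) m

norm-correct : ∀ {n} (e : Expr n) ρ → ⟦ e ⟧ ρ ≈ ev n (norm e) ρ
norm-correct (con c) ρ = ≈.sym (ev-c _ c ρ)
norm-correct (var i) ρ = ≈.sym (ev-x i ρ)
norm-correct (e :+ f) ρ = ≈.trans (≈.+-cong (norm-correct e ρ) (norm-correct f ρ))
  (≈.sym (ev-add _ (norm e) (norm f) ρ))
norm-correct (e :* f) ρ = ≈.trans (≈.*-cong (norm-correct e ρ) (norm-correct f ρ))
  (≈.sym (ev-mul _ (norm e) (norm f) ρ))
norm-correct (e :- f) ρ = ≈.trans
  (≈.+-cong (norm-correct e ρ)
    (≈.trans (≈.-‿cong (norm-correct f ρ)) (≈.sym (ev-neg _ (norm f) ρ))))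
  (≈.sym (ev-add _ (norm e) (negᵖ _ (norm f)) ρ))
norm-correct (:- e) ρ = ≈.trans (≈.-‿cong (norm-correct e ρ)) (≈.sym (ev-neg _ (norm e) ρ))
norm-correct (e :^ zero) ρ = ≈.sym (ev-c _ 1ℤ ρ)
norm-correct (e :^ suc m) ρ = ≈.trans (≈.*-cong (norm-correct e ρ) (norm-correct (e :^ m) ρ))
  (≈.sym (ev-mul _ (norm e) (powᵖ _ (norm e) m) ρ))

x-x≈0 : ∀ {f g} → f ≈ g → f -ₛ g ≈ 0ₛ
x-x≈0 {f} {g} eq = ≈.trans (≈.+-congʳ { -ₛ g} eq) (≈.-‿inverseʳ g)

x-y≈0⇒x≈y : ∀ {f g} → f -ₛ g ≈ 0ₛ → f ≈ g
x-y≈0⇒x≈y {f} {g} = ≈P.x∙y⁻¹≈ε⇒x≈y f g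

infix 3 _×[_≐_]
data Hyp (n : ℕ) : Set where
  _×[_≐_] : Expr n → Expr n → Expr n → Hyp n

defect : ∀ {n} → List (Hyp n) → Expr n
defect [] = con 0ℤ
defect ((c ×[ l ≐ r ]) ∷ hs) = c :* (l :- r) :+ defect hs

Hold : ∀ {n} → Vec PS n → List (Hyp n) → Set
Hold ρ [] = ⊤
Hold ρ ((c ×[ l ≐ r ]) ∷ hs) = (⟦ l ⟧ ρ ≈ ⟦ r ⟧ ρ) × Hold ρ hs

defect≈0 : ∀ {n} ρ (hs : List (Hyp n)) → Hold ρ hs → ⟦ defect hs ⟧ ρ ≈ 0ₛ
defect≈0 ρ [] _ = const-0
defect≈0 ρ ((c ×[ l ≐ r ]) ∷ hs) (eq , eqs) = ≈.trans
  (≈.+-cong (≈.trans (≈.*-congˡ {⟦ c ⟧ ρ} (x-x≈0 eq)) (≈.zeroʳ (⟦ c ⟧ ρ))) (defect≈0 ρ hs eqs))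
  (≈.+-identityˡ 0ₛ)

-- Certified ideal membership: the cofactors in `hs` exhibit `e :- f` as a combination of the
-- differences of the hypotheses, and `refl` checks this by normalising polynomials. Terms such as
-- `Tᵒ (Rᵒ V₁) n` enter as opaque variables through `ρ`.
by-combination : ∀ {n} (ρ : Vec PS n) (hs : List (Hyp n)) (e f : Expr n) → Hold ρ hs →
                 isZero n (norm (e :- f :- defect hs)) ≡ true → ⟦ e ⟧ ρ ≈ ⟦ f ⟧ ρ
by-combination {n} ρ hs e f hold eq = x-y≈0⇒x≈y (begin
  ⟦ e ⟧ ρ -ₛ ⟦ f ⟧ ρ
    ≈⟨ x-y≈0⇒x≈y (≈.trans (norm-correct (e :- f :- defect hs) ρ)
         (ev-isZero n (norm (e :- f :- defect hs)) ρ eq)) ⟩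
  ⟦ defect hs ⟧ ρ
    ≈⟨ defect≈0 ρ hs hold ⟩
  0ₛ ∎)
  where open ≈-Reasoning

identity : ∀ {n} (ρ : Vec PS n) (e f : Expr n) → isZero n (norm (e :- f)) ≡ true → ⟦ e ⟧ ρ ≈ ⟦ f ⟧ ρ
identity {n} ρ e f eq =
  x-y≈0⇒x≈y (≈.trans (norm-correct (e :- f) ρ) (ev-isZero n (norm (e :- f)) ρ eq))

-- Cancellation of series with nonzero constant coefficient

module _ {c ℓ} (R : CommutativeRing c ℓ) where
  open CommutativeRing R renaming (Carrier to A; _≈_ to _≃_; refl to ≃-refl; sym to ≃-sym; trans to ≃-trans)
  open Series R

  -- If `f 0` is cancellable, the coefficients of `g` vanish one after the other. Iterated over q, y
  -- and x, this reduces cancellability to the constant coefficient.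
  ⊛-regular : ∀ f → (∀ a → f 0 * a ≃ 0# → a ≃ 0#) →
              ∀ g → f ⊛ g ≋ (λ _ → 0#) → g ≋ (λ _ → 0#)
  ⊛-regular f reg g eq n = below n n ℕP.≤-refl
    where
    -- Strong induction: the coefficient at `suc i` uses all earlier ones, and the bound `n` makes
    -- the recursion structural.
    below : ∀ n i → i ≤ n → g i ≃ 0#
    below n zero _ = reg (g 0) (eq 0)
    below (suc n) (suc i) (s≤s i≤n) = reg (g (suc i)) (≃-trans (≃-sym (+-identityʳ _)) (≃-trans
      (+-congˡ (≃-sym tail≃0)) (≃-trans (≃-sym (⊛-front f g i)) (eq (suc i)))))
      where
      tail≃0 : (f ∘ suc ⊛ g) i ≃ 0#
      tail≃0 = ≃-trans (sumTo-cong i λ j j≤i → ≃-trans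
        (*-congˡ (below n (i ℕ.∸ j) (ℕP.≤-trans (ℕP.m∸n≤m i j) i≤n))) (≃-trans (zeroʳ _) (≃-sym (zeroˡ 0#))))
        (⊛-zeroˡ (λ _ → 0#) i)

ℤ-regular : ∀ a → a ≢ 0ℤ → ∀ b → a ℤ.* b ≡ 0ℤ → b ≡ 0ℤ
ℤ-regular a a≢0 b eq with ℤP.i*j≡0⇒i≡0∨j≡0 a eq
... | inj₁ a≡0 = ⊥-elim (a≢0 a≡0)
... | inj₂ b≡0 = b≡0

*ₛ-regular : ∀ f → f 0 0 0 ≢ 0ℤ → ∀ g → f *ₛ g ≈ 0ₛ → g ≈ 0ₛ
*ₛ-regular f f≢0 g eq =
  ⊛-regular ℤ⟦y,q⟧ f
    (⊛-regular ℤ⟦q⟧ (f 0) (⊛-regular ℤP.+-*-commutativeRing (f 0 0) (ℤ-regular (f 0 0 0) f≢0)))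
    g (λ i j k → ≡.trans (≡.sym (*ₛ-⊛ f g i j k)) (eq i j k))

*ₛ-cancel : ∀ f → f 0 0 0 ≢ 0ℤ → ∀ g h → f *ₛ g ≈ f *ₛ h → g ≈ h
*ₛ-cancel f f≢0 g h eq = x-y≈0⇒x≈y (*ₛ-regular f f≢0 (g -ₛ h) (≈.trans
  (by-combination (f ∷ g ∷ h ∷ []) ((con 1ℤ ×[ ν 0 :* ν 1 ≐ ν 0 :* ν 2 ]) ∷ [])
    (ν 0 :* (ν 1 :- ν 2)) (con 0ℤ) (eq , tt) refl)
  const-0))

-- Row-transfer operators

-- n, i, k: a sequence in n of series in x (index i) and q (index k), i.e. the
-- part of fixed y-degree of a sequence of elements of PS.
Layer : Set
Layer = ℕ → ℕ → ℕ → ℤ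

Seq : Set
Seq = ℕ → PS

layer : ℕ → Seq → Layer
layer j V n i k = V n i j k

lift : (Layer → Layer) → Seq → Seq
lift F V n i j k = F (layer j V) n i k

qs : (ℕ → ℤ) → ℕ → ℤ
qs f zero = 0ℤ
qs f (suc k) = f k

-- The moves of one end of a row of n + 1 cells, x marking the columns gained.  With
-- σ V n = V (n + 1):  N = 1/(1 − xσ)  and  R = (1 + (q − 1)xσ)/(1 − xσ) (stay or move
-- outwards);  M moves inwards, keeping at least one cell, and  T = 1 + M.
msum : (ℕ → ℕ → ℤ) → ℕ → ℕ → ℤ
msum g zero k = 0ℤ
msum g (suc n) k = msum g n k ℤ.+ qs (g n) k

Nˡ Rˡ Mˡ Tˡ : Layer → Layer
Nˡ V n zero k = V n zero k
Nˡ V n (suc i) k = V n (suc i) k ℤ.+ Nˡ V (suc n) i k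

Rˡ V n zero k = V n zero k
Rˡ V n (suc i) k = V n (suc i) k ℤ.+ qs (Nˡ V (suc n) i) k

Mˡ V n i = msum (λ m → V m i) n

Tˡ V n i k = V n i k ℤ.+ Mˡ V n i k

infix 4 _≗_
_≗_ : Layer → Layer → Set
V ≗ W = ∀ n i k → V n i k ≡ W n i k

Congruentˡ : (Layer → Layer) → Set
Congruentˡ F = ∀ {V W} → V ≗ W → F V ≗ F W

qs-cong : ∀ {f g} → (∀ k → f k ≡ g k) → ∀ k → qs f k ≡ qs g k
qs-cong eq zero = refl
qs-cong eq (suc k) = eq k

Nˡ-cong : Congruentˡ Nˡ
Nˡ-cong eq n zero k = eq n zero k
Nˡ-cong eq n (suc i) k = ≡.cong₂ ℤ._+_ (eq n (suc i) k) (Nˡ-cong eq (suc n) i k)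

Rˡ-cong : Congruentˡ Rˡ
Rˡ-cong eq n zero k = eq n zero k
Rˡ-cong eq n (suc i) k = ≡.cong₂ ℤ._+_ (eq n (suc i) k) (qs-cong (Nˡ-cong eq (suc n) i) k)

msum-cong : ∀ {f g} → (∀ n k → f n k ≡ g n k) → ∀ n k → msum f n k ≡ msum g n k
msum-cong eq zero k = refl
msum-cong eq (suc n) k = ≡.cong₂ ℤ._+_ (msum-cong eq n k) (qs-cong (eq n) k)

Mˡ-cong : Congruentˡ Mˡ
Mˡ-cong eq n i k = msum-cong (λ n → eq n i) n k

Tˡ-cong : Congruentˡ Tˡ
Tˡ-cong eq n i k = ≡.cong₂ ℤ._+_ (eq n i k) (Mˡ-cong eq n i k)

Nᵒ Rᵒ Mᵒ Tᵒ : Seq → Seq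
Nᵒ = lift Nˡ
Rᵒ = lift Rˡ
Mᵒ = lift Mˡ
Tᵒ = lift Tˡ

infix 4 _≈ˢ_
_≈ˢ_ : Seq → Seq → Set
V ≈ˢ W = ∀ n → V n ≈ W n

lift-cong : ∀ {F} → Congruentˡ F → ∀ {V W} → V ≈ˢ W → lift F V ≈ˢ lift F W
lift-cong F-cong eq n i j k = F-cong (λ n i k → eq n i j k) n i k

N-eq : ∀ V n → Nᵒ V n ≈ V n +ₛ X *ₛ Nᵒ V (suc n)
N-eq V n zero j k = ≡.sym (≡.trans (≡.cong (ℤ._+_ (V n 0 j k)) (X-*-zero (Nᵒ V (suc n)) j k)) (ℤP.+-identityʳ _))
N-eq V n (suc i) j k = ≡.cong (ℤ._+_ (V n (suc i) j k)) (≡.sym (X-*-suc (Nᵒ V (suc n)) i j k))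

-- The factor `X` lowers the x-degree at which `U` is consulted, so the recursion is on that degree
-- while `n` is free to grow.
N-unique : ∀ D U → (∀ n → U n ≈ D n +ₛ X *ₛ U (suc n)) → U ≈ˢ Nᵒ D
N-unique D U eq n zero j k = ≡.trans (eq n 0 j k)
  (≡.trans (≡.cong (ℤ._+_ (D n 0 j k)) (X-*-zero (U (suc n)) j k)) (ℤP.+-identityʳ _))
N-unique D U eq n (suc i) j k = ≡.trans (eq n (suc i) j k)
  (≡.cong (ℤ._+_ (D n (suc i) j k)) (≡.trans (X-*-suc (U (suc n)) i j k) (N-unique D U eq (suc n) i j k)))

Q-*-qs : ∀ f i j k → (Q *ₛ f) i j k ≡ qs (f i j) k
Q-*-qs f i j zero = Q-*-zero f i j
Q-*-qs f i j (suc k) = Q-*-suc f i j k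

R-eq : ∀ V n → Rᵒ V n ≈ V n +ₛ Q *ₛ (X *ₛ Nᵒ V (suc n))
R-eq V n zero j k = ≡.sym (≡.trans (≡.cong (ℤ._+_ (V n 0 j k)) (≡.trans (Q-*-qs (X *ₛ Nᵒ V (suc n)) 0 j k)
  (≡.trans (qs-cong (X-*-zero (Nᵒ V (suc n)) j) k) (qs-0 k)))) (ℤP.+-identityʳ _))
  where
  qs-0 : ∀ k → qs (λ _ → 0ℤ) k ≡ 0ℤ
  qs-0 zero = refl
  qs-0 (suc k) = refl
R-eq V n (suc i) j k = ≡.cong (ℤ._+_ (V n (suc i) j k)) (≡.sym (≡.trans (Q-*-qs (X *ₛ Nᵒ V (suc n)) (suc i) j k)
  (qs-cong (X-*-suc (Nᵒ V (suc n)) i j) k)))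

M-suc : ∀ V n → Mᵒ V (suc n) ≈ Mᵒ V n +ₛ Q *ₛ V n
M-suc V n i j k = ≡.cong (ℤ._+_ (Mᵒ V n i j k)) (≡.sym (Q-*-qs (V n) i j k))

M-unique : ∀ D U → U 0 ≈ 0ₛ → (∀ n → U (suc n) ≈ U n +ₛ Q *ₛ D n) → U ≈ˢ Mᵒ D
M-unique D U eq0 eq zero = eq0
M-unique D U eq0 eq (suc n) i j k = ≡.trans (eq n i j k)
  (≡.cong₂ ℤ._+_ (M-unique D U eq0 eq n i j k) (Q-*-qs (D n) i j k))

T-zero : ∀ V → Tᵒ V 0 ≈ V 0
T-zero V i j k = ℤP.+-identityʳ _

infixr 6 _∔_
infixr 8 _·_
_∔_ : Seq → Seq → Seq
(V ∔ W) n = V n +ₛ W n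

_·_ : PS → Seq → Seq
(c · V) n = c *ₛ V n

record Linear (F : Seq → Seq) : Set where
  field
    congˢ : ∀ {V W} → V ≈ˢ W → F V ≈ˢ F W
    add : ∀ V W → F (V ∔ W) ≈ˢ F V ∔ F W
    scale : ∀ c V → F (c · V) ≈ˢ c · F V

open Linear

N-linear : Linear Nᵒ
N-linear .congˢ = lift-cong Nˡ-cong
N-linear .add V W n = ≈.sym (N-unique (V ∔ W) (Nᵒ V ∔ Nᵒ W) (λ n → by-combination
  (Nᵒ V n ∷ Nᵒ W n ∷ V n ∷ W n ∷ Nᵒ V (suc n) ∷ Nᵒ W (suc n) ∷ X ∷ [])
  ((con 1ℤ ×[ ν 0 ≐ ν 2 :+ ν 6 :* ν 4 ]) ∷
   (con 1ℤ ×[ ν 1 ≐ ν 3 :+ ν 6 :* ν 5 ]) ∷ [])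
  (ν 0 :+ ν 1) ((ν 2 :+ ν 3) :+ ν 6 :* (ν 4 :+ ν 5))
  (N-eq V n , N-eq W n , tt) refl) n)
N-linear .scale c V n = ≈.sym (N-unique (c · V) (c · Nᵒ V) (λ n → by-combination
  (Nᵒ V n ∷ V n ∷ Nᵒ V (suc n) ∷ X ∷ c ∷ [])
  ((ν 4 ×[ ν 0 ≐ ν 1 :+ ν 3 :* ν 2 ]) ∷ [])
  (ν 4 :* ν 0) (ν 4 :* ν 1 :+ ν 3 :* (ν 4 :* ν 2))
  (N-eq V n , tt) refl) n)

R-linear : Linear Rᵒ
R-linear .congˢ = lift-cong Rˡ-cong
R-linear .add V W n = by-combination
  (Rᵒ V n ∷ Rᵒ W n ∷ Rᵒ (V ∔ W) n ∷ V n ∷ W n ∷ Nᵒ V (suc n) ∷ Nᵒ W (suc n) ∷ Nᵒ (V ∔ W) (suc n) ∷ X ∷ Q ∷ [])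
  ((con 1ℤ ×[ ν 2 ≐ (ν 3 :+ ν 4) :+ ν 9 :* (ν 8 :* ν 7) ]) ∷
   (ν 8 :* ν 9 ×[ ν 7 ≐ ν 5 :+ ν 6 ]) ∷
   (con (ℤ.- 1ℤ) ×[ ν 0 ≐ ν 3 :+ ν 9 :* (ν 8 :* ν 5) ]) ∷
   (con (ℤ.- 1ℤ) ×[ ν 1 ≐ ν 4 :+ ν 9 :* (ν 8 :* ν 6) ]) ∷ [])
  (ν 2) (ν 0 :+ ν 1)
  (R-eq (V ∔ W) n , N-linear .add V W (suc n) , R-eq V n , R-eq W n , tt) refl
R-linear .scale c V n = by-combination
  (Rᵒ V n ∷ Rᵒ (c · V) n ∷ V n ∷ Nᵒ V (suc n) ∷ Nᵒ (c · V) (suc n) ∷ c ∷ X ∷ Q ∷ [])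
  ((con 1ℤ ×[ ν 1 ≐ ν 5 :* ν 2 :+ ν 7 :* (ν 6 :* ν 4) ]) ∷
   (ν 6 :* ν 7 ×[ ν 4 ≐ ν 5 :* ν 3 ]) ∷
   (:- ν 5 ×[ ν 0 ≐ ν 2 :+ ν 7 :* (ν 6 :* ν 3) ]) ∷ [])
  (ν 1) (ν 5 :* ν 0)
  (R-eq (c · V) n , N-linear .scale c V (suc n) , R-eq V n , tt) refl

M-linear : Linear Mᵒ
M-linear .congˢ = lift-cong Mˡ-cong
M-linear .add V W n = ≈.sym (M-unique (V ∔ W) (Mᵒ V ∔ Mᵒ W) (≈.+-identityˡ 0ₛ) (λ n → by-combination
  (Mᵒ V (suc n) ∷ Mᵒ W (suc n) ∷ Mᵒ V n ∷ Mᵒ W n ∷ V n ∷ W n ∷ Q ∷ [])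
  ((con 1ℤ ×[ ν 0 ≐ ν 2 :+ ν 6 :* ν 4 ]) ∷
   (con 1ℤ ×[ ν 1 ≐ ν 3 :+ ν 6 :* ν 5 ]) ∷ [])
  (ν 0 :+ ν 1) ((ν 2 :+ ν 3) :+ ν 6 :* (ν 4 :+ ν 5))
  (M-suc V n , M-suc W n , tt) refl) n)
M-linear .scale c V n = ≈.sym (M-unique (c · V) (c · Mᵒ V) (≈.zeroʳ c) (λ n → by-combination
  (Mᵒ V (suc n) ∷ Mᵒ V n ∷ V n ∷ Q ∷ c ∷ [])
  ((ν 4 ×[ ν 0 ≐ ν 1 :+ ν 3 :* ν 2 ]) ∷ [])
  (ν 4 :* ν 0) (ν 4 :* ν 1 :+ ν 3 :* (ν 4 :* ν 2))
  (M-suc V n , tt) refl) n)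

T-linear : Linear Tᵒ
T-linear .congˢ = lift-cong Tˡ-cong
T-linear .add V W n = ≈.trans (≈.+-congˡ {(V ∔ W) n} (M-linear .add V W n))
  (+-swap (V n) (W n) (Mᵒ V n) (Mᵒ W n))
T-linear .scale c V n = ≈.trans (≈.+-congˡ {(c · V) n} (M-linear .scale c V n))
  (≈.sym (≈.distribˡ c (V n) (Mᵒ V n)))

∘-linear : ∀ {F G} → Linear F → Linear G → Linear (F ∘ G)
∘-linear F-lin G-lin .congˢ eq = F-lin .congˢ (G-lin .congˢ eq)
∘-linear {F} {G} F-lin G-lin .add V W n =
  ≈.trans (F-lin .congˢ (G-lin .add V W) n) (F-lin .add (G V) (G W) n)
∘-linear {F} {G} F-lin G-lin .scale c V n =
  ≈.trans (F-lin .congˢ (G-lin .scale c V) n) (F-lin .scale c (G V) n)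

linear₂ : ∀ {F} → Linear F → ∀ a b U V → F (a · U ∔ b · V) ≈ˢ a · F U ∔ b · F V
linear₂ F-lin a b U V n = ≈.trans (F-lin .add (a · U) (b · V) n)
  (≈.+-cong (F-lin .scale a U n) (F-lin .scale b V n))

linear₃ : ∀ {F} → Linear F → ∀ a b c U V W →
          F (a · U ∔ b · V ∔ c · W) ≈ˢ a · F U ∔ b · F V ∔ c · F W
linear₃ F-lin a b c U V W n = ≈.trans (F-lin .add (a · U) (b · V ∔ c · W) n)
  (≈.+-cong (F-lin .scale a U n) (linear₂ F-lin b c V W n))

-- Fixed-point equations in powers of y

Y²-zero : ∀ f i k → (Y *ₛ (Y *ₛ f)) i 0 k ≡ 0ℤ
Y²-zero f i k = Y-*-zero (Y *ₛ f) i k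

Y²-one : ∀ f i k → (Y *ₛ (Y *ₛ f)) i 1 k ≡ 0ℤ
Y²-one f i k = ≡.trans (Y-*-suc (Y *ₛ f) i 0 k) (Y-*-zero f i k)

Y²-suc : ∀ f i j k → (Y *ₛ (Y *ₛ f)) i (suc (suc j)) k ≡ f i j k
Y²-suc f i j k = ≡.trans (Y-*-suc (Y *ₛ f) i (suc j) k) (Y-*-suc f i j k)

-- `Y *ₛ Y` is the weight of one row, in view of the substitution y = z².
Solves : (Layer → Layer) → Seq → Seq → Set
Solves F D V = ∀ n → V n ≈ D n +ₛ Y *ₛ (Y *ₛ lift F V n)

-- `lift F` preserves the y-degree and `Y *ₛ Y` raises it by two, so layers 0 and 1 come from `D`
-- and every later layer from the one two below. The explicit solutions are all obtained in this
-- way, as second solutions of the same equation.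
solution-unique : ∀ {F} → Congruentˡ F → ∀ {D V W} → Solves F D V → Solves F D W → V ≈ˢ W
solution-unique {F} F-cong {D} {V} {W} eqV eqW n i j k = go j n i k
  where
  go : ∀ j → layer j V ≗ layer j W
  go 0 n i k = ≡.trans (eqV n i 0 k) (≡.trans (≡.cong (ℤ._+_ (D n i 0 k))
    (≡.trans (Y²-zero (lift F V n) i k) (≡.sym (Y²-zero (lift F W n) i k)))) (≡.sym (eqW n i 0 k)))
  go 1 n i k = ≡.trans (eqV n i 1 k) (≡.trans (≡.cong (ℤ._+_ (D n i 1 k))
    (≡.trans (Y²-one (lift F V n) i k) (≡.sym (Y²-one (lift F W n) i k)))) (≡.sym (eqW n i 1 k)))
  go (suc (suc j)) n i k = ≡.trans (eqV n i _ k) (≡.trans (≡.cong (ℤ._+_ (D n i (suc (suc j)) k))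
    (≡.trans (Y²-suc (lift F V n) i j k) (≡.trans (F-cong (go j) n i k)
      (≡.sym (Y²-suc (lift F W n) i j k))))) (≡.sym (eqW n i _ k)))

solutionˡ : (Layer → Layer) → Seq → ℕ → Layer
solutionˡ F D 0 = layer 0 D
solutionˡ F D 1 = layer 1 D
solutionˡ F D (suc (suc j)) n i k = D n i (suc (suc j)) k ℤ.+ F (solutionˡ F D j) n i k

solution : (Layer → Layer) → Seq → Seq
solution F D n i j k = solutionˡ F D j n i k

solution-solves : ∀ F D → Solves F D (solution F D)
solution-solves F D n i 0 k =
  ≡.sym (≡.trans (≡.cong (ℤ._+_ (D n i 0 k)) (Y²-zero (lift F (solution F D) n) i k)) (ℤP.+-identityʳ _))
solution-solves F D n i 1 k =
  ≡.sym (≡.trans (≡.cong (ℤ._+_ (D n i 1 k)) (Y²-one (lift F (solution F D) n) i k)) (ℤP.+-identityʳ _))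
solution-solves F D n i (suc (suc j)) k =
  ≡.cong (ℤ._+_ (D n i (suc (suc j)) k)) (≡.sym (Y²-suc (lift F (solution F D) n) i j k))

-- Difference and shift relations, and the three stages

one′ : ∀ {n} → Expr n
one′ = con 1ℤ

-- Differencing removes the sum in M. Eigenvalue equations for T thereby become first-order
-- recurrences in `n`.
T-suc : ∀ V n → Tᵒ V (suc n) ≈ Tᵒ V n +ₛ V (suc n) -ₛ V n +ₛ Q *ₛ V n
T-suc V n = by-combination (V (suc n) ∷ Mᵒ V (suc n) ∷ V n ∷ Mᵒ V n ∷ Q ∷ [])
  ((one′ ×[ ν 1 ≐ ν 3 :+ ν 4 :* ν 2 ]) ∷ [])
  (ν 0 :+ ν 1) ((ν 2 :+ ν 3) :+ ν 0 :- ν 2 :+ ν 4 :* ν 2)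
  (M-suc V n , tt) refl

M-T : ∀ V → Mᵒ V ≈ˢ Tᵒ V ∔ (-ₛ # 1) · V
M-T V n = identity (V n ∷ Mᵒ V n ∷ []) (ν 1) ((ν 0 :+ ν 1) :+ (:- one′) :* ν 0) refl

Nˡ-shift : ∀ V → Nˡ (V ∘ suc) ≗ Nˡ V ∘ suc
Nˡ-shift V n zero k = refl
Nˡ-shift V n (suc i) k = ≡.cong (ℤ._+_ (V (suc n) (suc i) k)) (Nˡ-shift V (suc n) i k)

Rˡ-shift : ∀ V → Rˡ (V ∘ suc) ≗ Rˡ V ∘ suc
Rˡ-shift V n zero k = refl
Rˡ-shift V n (suc i) k = ≡.cong (ℤ._+_ (V (suc n) (suc i) k)) (qs-cong (Nˡ-shift V (suc n) i) k)

R-shift : ∀ V n → Rᵒ (V ∘ suc) n ≈ Rᵒ V (suc n)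
R-shift V n i j k = Rˡ-shift (layer j V) n i k

-- The shift drops only the summand of M with index 0, the move inwards to a single cell. R, being a
-- series in the shift, commutes with it exactly.
T-shift : ∀ V n → Tᵒ V (suc n) ≈ Tᵒ (V ∘ suc) n +ₛ Q *ₛ V 0
T-shift V zero = by-combination (Tᵒ V 1 ∷ Tᵒ (V ∘ suc) 0 ∷ V 1 ∷ Tᵒ V 0 ∷ V 0 ∷ Q ∷ [])
  ((one′ ×[ ν 0 ≐ ν 3 :+ ν 2 :- ν 4 :+ ν 5 :* ν 4 ]) ∷ (one′ ×[ ν 3 ≐ ν 4 ]) ∷
   (:- one′ ×[ ν 1 ≐ ν 2 ]) ∷ [])
  (ν 0) (ν 1 :+ ν 5 :* ν 4)
  (T-suc V 0 , T-zero V , T-zero (V ∘ suc) , tt) refl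
T-shift V (suc n) = by-combination
  (Tᵒ V (suc (suc n)) ∷ Tᵒ (V ∘ suc) (suc n) ∷ Tᵒ V (suc n) ∷ Tᵒ (V ∘ suc) n ∷ V (suc (suc n)) ∷ V (suc n) ∷ V 0 ∷ Q ∷ [])
  ((one′ ×[ ν 0 ≐ ν 2 :+ ν 4 :- ν 5 :+ ν 7 :* ν 5 ]) ∷
   (:- one′ ×[ ν 1 ≐ ν 3 :+ ν 4 :- ν 5 :+ ν 7 :* ν 5 ]) ∷
   (one′ ×[ ν 2 ≐ ν 3 :+ ν 7 :* ν 6 ]) ∷ [])
  (ν 0) (ν 1 :+ ν 7 :* ν 6)
  (T-suc V (suc n) , T-suc (V ∘ suc) n , T-shift V n , tt) refl

-- Sequences with a g(n+1) = b g(n) are eigenvectors of N and R.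

Geometric : PS → PS → Seq → Set
Geometric a b g = ∀ n → a *ₛ g (suc n) ≈ b *ₛ g n

N-geometric : ∀ a b g → Geometric a b g → ∀ n → (a -ₛ X *ₛ b) *ₛ Nᵒ g n ≈ a *ₛ g n
N-geometric a b g geo n = by-combination
  (Nᵒ g n ∷ Nᵒ g (suc n) ∷ g n ∷ a ∷ b ∷ X ∷ [])
  ((ν 3 ×[ ν 0 ≐ ν 2 :+ ν 5 :* ν 1 ]) ∷ (ν 5 ×[ ν 3 :* ν 1 ≐ ν 4 :* ν 0 ]) ∷ [])
  ((ν 3 :- ν 5 :* ν 4) :* ν 0) (ν 3 :* ν 2)
  (N-eq g n , Ng-geometric n , tt) refl
  where
  -- `a *ₛ Nᵒ g (suc n)` satisfies the equation that defines N of `b · g`, so N keeps the ratio.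
  Ng-geometric : Geometric a b (Nᵒ g)
  Ng-geometric n = ≈.trans
    (N-unique (b · g) (λ n → a *ₛ Nᵒ g (suc n)) (λ n → by-combination
      (Nᵒ g (suc n) ∷ g (suc n) ∷ g n ∷ Nᵒ g (suc (suc n)) ∷ a ∷ b ∷ X ∷ [])
      ((ν 4 ×[ ν 0 ≐ ν 1 :+ ν 6 :* ν 3 ]) ∷ (one′ ×[ ν 4 :* ν 1 ≐ ν 5 :* ν 2 ]) ∷ [])
      (ν 4 :* ν 0) (ν 5 :* ν 2 :+ ν 6 :* (ν 4 :* ν 3))
      (N-eq g (suc n) , geo n , tt) refl) n)
    (N-linear .scale b g n)

R-geometric : ∀ a b g → Geometric a b g → ∀ n →
              (a -ₛ X *ₛ b) *ₛ Rᵒ g n ≈ (a +ₛ q-1 *ₛ X *ₛ b) *ₛ g n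
R-geometric a b g geo n = by-combination
  (Rᵒ g n ∷ Nᵒ g (suc n) ∷ g n ∷ g (suc n) ∷ a ∷ b ∷ X ∷ Q ∷ [])
  ((ν 4 :- ν 6 :* ν 5 ×[ ν 0 ≐ ν 2 :+ ν 7 :* (ν 6 :* ν 1) ]) ∷
   (ν 7 :* ν 6 ×[ (ν 4 :- ν 6 :* ν 5) :* ν 1 ≐ ν 4 :* ν 3 ]) ∷
   (ν 7 :* ν 6 ×[ ν 4 :* ν 3 ≐ ν 5 :* ν 2 ]) ∷ [])
  ((ν 4 :- ν 6 :* ν 5) :* ν 0) ((ν 4 :+ (ν 7 :- one′) :* ν 6 :* ν 5) :* ν 2)
  (R-eq g n , N-geometric a b g geo (suc n) , geo n , tt) refl

-- From here on Y stands for z, where z² = y.  V₂, V₁ and V₀ are the completion series of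
-- the three stages of the row-by-row construction (both ends, one end, no end of the rows
-- committed to moving inwards), as functions of the row length minus one.

V₂ V₁ V₀ D₁ D₀ : Seq
V₂ = solution (Tˡ ∘ Tˡ) (λ _ → # 1)
D₁ n = # 1 +ₛ Y *ₛ (Y *ₛ Tᵒ (Mᵒ V₂) n)
V₁ = solution (Tˡ ∘ Rˡ) D₁
D₀ n = # 1 +ₛ Y *ₛ (Y *ₛ (Mᵒ (Rᵒ V₁) n +ₛ Mᵒ (Rᵒ V₁) n +ₛ Mᵒ (Mᵒ V₂) n))
V₀ = solution (Rˡ ∘ Rˡ) D₀

V₂-eq : Solves (Tˡ ∘ Tˡ) (λ _ → # 1) V₂
V₂-eq = solution-solves (Tˡ ∘ Tˡ) (λ _ → # 1)

TM : ∀ V → Tᵒ (Mᵒ V) ≈ˢ Tᵒ (Tᵒ V) ∔ (-ₛ # 1) · Tᵒ V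
TM V n = ≈.trans (T-linear .congˢ (M-T V) n)
  (≈.trans (T-linear .add (Tᵒ V) ((-ₛ # 1) · V) n)
  (≈.+-congˡ {Tᵒ (Tᵒ V) n} (T-linear .scale (-ₛ # 1) V n)))

-- M = T - 1 is eliminated: TMV₂ = TTV₂ - TV₂, and 1 + yTTV₂ is V₂ itself.
V₁-eq : Solves (Tˡ ∘ Rˡ) (λ n → V₂ n -ₛ Y *ₛ (Y *ₛ Tᵒ V₂ n)) V₁
V₁-eq n = by-combination
  (V₁ n ∷ Tᵒ (Rᵒ V₁) n ∷ Tᵒ (Mᵒ V₂) n ∷ Tᵒ (Tᵒ V₂) n ∷ Tᵒ V₂ n ∷ V₂ n ∷ Y ∷ [])
  ((one′ ×[ ν 0 ≐ one′ :+ ν 6 :* (ν 6 :* ν 2) :+ ν 6 :* (ν 6 :* ν 1) ]) ∷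
   (ν 6 :* ν 6 ×[ ν 2 ≐ ν 3 :+ (:- one′) :* ν 4 ]) ∷
   (:- one′ ×[ ν 5 ≐ one′ :+ ν 6 :* (ν 6 :* ν 3) ]) ∷ [])
  (ν 0) (ν 5 :- ν 6 :* (ν 6 :* ν 4) :+ ν 6 :* (ν 6 :* ν 1))
  (solution-solves (Tˡ ∘ Rˡ) D₁ n , TM V₂ n , V₂-eq n , tt) refl

-- The same elimination: yTRV₁ is read off from `V₁-eq` and yTTV₂ from `V₂-eq`, whereupon all terms
-- TV₂ cancel.
V₀-eq : Solves (Rˡ ∘ Rˡ)
  (λ n → # 2 *ₛ (V₁ n -ₛ Y *ₛ (Y *ₛ Rᵒ V₁ n)) -ₛ (# 1 -ₛ Y *ₛ Y) *ₛ V₂ n) V₀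
V₀-eq n = by-combination
  (V₀ n ∷ Rᵒ (Rᵒ V₀) n ∷ Mᵒ (Rᵒ V₁) n ∷ Mᵒ (Mᵒ V₂) n ∷ Tᵒ (Rᵒ V₁) n ∷ Rᵒ V₁ n ∷ V₁ n ∷
   Tᵒ (Mᵒ V₂) n ∷ Mᵒ V₂ n ∷ Tᵒ (Tᵒ V₂) n ∷ Tᵒ V₂ n ∷ V₂ n ∷ Y ∷ [])
  ((one′ ×[ ν 0 ≐ one′ :+ y (ν 2 :+ ν 2 :+ ν 3) :+ y (ν 1) ]) ∷
   (y (con (+ 2)) ×[ ν 2 ≐ ν 4 :+ (:- one′) :* ν 5 ]) ∷
   (y one′ ×[ ν 3 ≐ ν 7 :+ (:- one′) :* ν 8 ]) ∷
   (y one′ ×[ ν 7 ≐ ν 9 :+ (:- one′) :* ν 10 ]) ∷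
   (:- y one′ ×[ ν 8 ≐ ν 10 :+ (:- one′) :* ν 11 ]) ∷
   (:- con (+ 2) ×[ ν 6 ≐ ν 11 :- y (ν 10) :+ y (ν 4) ]) ∷
   (:- one′ ×[ ν 11 ≐ one′ :+ y (ν 9) ]) ∷ [])
  (ν 0) (con (+ 2) :* (ν 6 :- y (ν 5)) :- (one′ :- ν 12 :* ν 12) :* ν 11 :+ y (ν 1))
  (solution-solves (Rˡ ∘ Rˡ) D₀ n , M-T (Rᵒ V₁) n , M-T (Mᵒ V₂) n , TM V₂ n , M-T V₂ n ,
   V₁-eq n , V₂-eq n , tt) refl
  where
  y : Expr 13 → Expr 13
  y e = ν 12 :* (ν 12 :* e)

-- The conjugate eigenvectors φ(z) and φ(-z)

module Poly {n} (x q : Expr n) where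
  r : Expr n
  r = q :- one′
  module _ (z : Expr n) where
    -- b/a is the ratio of φ(z) and n/m its eigenvalue under R; k = m - zn = a² - xb² is the
    -- numerator of 1 - zn/m, and Δ at y = z² equals k(z)k(-z). δ and ε are the coefficients of the
    -- kernel equation δts - εs + δ = 0, and c = 2δ + (q - 1)ε.
    aᵉ bᵉ mᵉ nᵉ kᵉ δᵉ εᵉ cᵉ Δᵉ : Expr n
    aᵉ = one′ :- z
    bᵉ = one′ :+ r :* z
    mᵉ = aᵉ :- x :* bᵉ
    nᵉ = aᵉ :+ r :* x :* bᵉ
    kᵉ = mᵉ :- z :* nᵉ
    δᵉ = one′ :+ r :* (z :* z)
    εᵉ = one′ :+ x :- z :* z :- r :^ 2 :* x :* (z :* z)
    cᵉ = con (+ 2) :+ (x :+ z :* z :+ one′) :* r :- x :* (z :* z) :* r :^ 3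
    Δᵉ = (one′ :+ z :* z :- x :- r :^ 2 :* x :* (z :* z)) :^ 2
         :- con (+ 4) :* (z :* z) :* (one′ :+ r :* x) :^ 2

ρ₀ : PS → Vec PS 3
ρ₀ ζ = X ∷ ζ ∷ Q ∷ []

module _ where
  open Poly {3} (ν 0) (ν 2)
  aₚ bₚ mₚ nₚ kₚ : PS → PS
  aₚ ζ = ⟦ aᵉ (ν 1) ⟧ (ρ₀ ζ)
  bₚ ζ = ⟦ bᵉ (ν 1) ⟧ (ρ₀ ζ)
  mₚ ζ = ⟦ mᵉ (ν 1) ⟧ (ρ₀ ζ)
  nₚ ζ = ⟦ nᵉ (ν 1) ⟧ (ρ₀ ζ)
  kₚ ζ = ⟦ kᵉ (ν 1) ⟧ (ρ₀ ζ)

  δ ε cₚ Δ′ : PS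
  δ = ⟦ δᵉ (ν 1) ⟧ (ρ₀ Y)
  ε = ⟦ εᵉ (ν 1) ⟧ (ρ₀ Y)
  cₚ = ⟦ cᵉ (ν 1) ⟧ (ρ₀ Y)
  Δ′ = ⟦ Δᵉ (ν 1) ⟧ (ρ₀ Y)

-- Formally V₂ is 1/(1 - z²TT) applied to the constant 1, so (1 + zT)V₂ is 1/(1 - zT) applied to it.
φ : PS → Seq
φ ζ = V₂ ∔ ζ · Tᵒ V₂

module Half (ζ : PS) (ζ² : ζ *ₛ ζ ≈ Y *ₛ Y) where

  T-φ : ∀ n → ζ *ₛ Tᵒ (φ ζ) n ≈ φ ζ n -ₛ # 1
  T-φ n = by-combination
    (Tᵒ (φ ζ) n ∷ Tᵒ (Tᵒ V₂) n ∷ Tᵒ V₂ n ∷ V₂ n ∷ Tᵒ (ζ · Tᵒ V₂) n ∷ ζ ∷ Y ∷ [])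
    ((ν 5 ×[ ν 0 ≐ ν 2 :+ ν 4 ]) ∷ (ν 5 ×[ ν 4 ≐ ν 5 :* ν 1 ]) ∷
     (ν 1 ×[ ν 5 :* ν 5 ≐ ν 6 :* ν 6 ]) ∷
     (:- one′ ×[ ν 3 ≐ one′ :+ ν 6 :* (ν 6 :* ν 1) ]) ∷ [])
    (ν 5 :* ν 0) (ν 3 :+ ν 5 :* ν 2 :- one′)
    (T-linear .add V₂ (ζ · Tᵒ V₂) n , T-linear .scale ζ (Tᵒ V₂) n , ζ² , V₂-eq n , tt) refl

  φ-zero : aₚ ζ *ₛ φ ζ 0 ≈ # 1
  φ-zero = by-combination (φ ζ 0 ∷ Tᵒ (φ ζ) 0 ∷ X ∷ ζ ∷ Q ∷ [])
    ((:- one′ ×[ ν 3 :* ν 1 ≐ ν 0 :- one′ ]) ∷ (ν 3 ×[ ν 1 ≐ ν 0 ]) ∷ [])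
    (aᵉ (ν 3) :* ν 0) one′
    (T-φ 0 , T-zero (φ ζ) , tt) refl
    where open Poly {5} (ν 2) (ν 4)

  -- In the difference of `T-φ` at `suc n` and `n` the constant 1 cancels, and `T-suc` evaluates the
  -- left-hand side.
  φ-geometric : Geometric (aₚ ζ) (bₚ ζ) (φ ζ)
  φ-geometric n = by-combination
    (φ ζ (suc n) ∷ φ ζ n ∷ Tᵒ (φ ζ) (suc n) ∷ Tᵒ (φ ζ) n ∷ X ∷ ζ ∷ Q ∷ [])
    ((:- one′ ×[ ν 5 :* ν 2 ≐ ν 0 :- one′ ]) ∷ (one′ ×[ ν 5 :* ν 3 ≐ ν 1 :- one′ ]) ∷
     (ν 5 ×[ ν 2 ≐ ν 3 :+ ν 0 :- ν 1 :+ ν 6 :* ν 1 ]) ∷ [])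
    (aᵉ (ν 5) :* ν 0) (bᵉ (ν 5) :* ν 1)
    (T-φ (suc n) , T-φ n , T-suc (φ ζ) n , tt) refl
    where open Poly {7} (ν 4) (ν 6)

  N-φ : mₚ ζ *ₛ Nᵒ (φ ζ) 0 ≈ # 1
  N-φ = ≈.trans (N-geometric (aₚ ζ) (bₚ ζ) (φ ζ) φ-geometric 0) φ-zero

  R-φ : ∀ n → mₚ ζ *ₛ Rᵒ (φ ζ) n ≈ nₚ ζ *ₛ φ ζ n
  R-φ = R-geometric (aₚ ζ) (bₚ ζ) (φ ζ) φ-geometric

  R-image : ∀ {F} → Linear F → ∀ n → mₚ ζ *ₛ F (Rᵒ (φ ζ)) n ≈ nₚ ζ *ₛ F (φ ζ) n
  R-image F-lin n = ≈.trans (≈.sym (F-lin .scale (mₚ ζ) (Rᵒ (φ ζ)) n))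
    (≈.trans (F-lin .congˢ R-φ n) (F-lin .scale (nₚ ζ) (φ ζ) n))

  -- R multiplies φ by n/m, but zTφ = φ - 1, so 1 - yTR yields (k/m)φ and in addition the constant
  -- zn/m.
  TR-φ : ∀ n → mₚ ζ *ₛ (φ ζ n -ₛ Y *ₛ (Y *ₛ Tᵒ (Rᵒ (φ ζ)) n)) ≈ kₚ ζ *ₛ φ ζ n +ₛ ζ *ₛ nₚ ζ
  TR-φ n = by-combination
    (φ ζ n ∷ Tᵒ (φ ζ) n ∷ Tᵒ (Rᵒ (φ ζ)) n ∷ Y ∷ X ∷ ζ ∷ Q ∷ [])
    ((mᵉ (ν 5) :* ν 2 ×[ ν 5 :* ν 5 ≐ ν 3 :* ν 3 ]) ∷
     (:- ν 5 :* ν 5 ×[ mᵉ (ν 5) :* ν 2 ≐ nᵉ (ν 5) :* ν 1 ]) ∷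
     (:- ν 5 :* nᵉ (ν 5) ×[ ν 5 :* ν 1 ≐ ν 0 :- one′ ]) ∷ [])
    (mᵉ (ν 5) :* (ν 0 :- ν 3 :* (ν 3 :* ν 2))) (kᵉ (ν 5) :* ν 0 :+ ν 5 :* nᵉ (ν 5))
    (ζ² , R-image T-linear n , T-φ n , tt) refl
    where open Poly {7} (ν 4) (ν 6)

  RR-φ : ∀ n → mₚ ζ ^ₛ 2 *ₛ (φ ζ n -ₛ Y *ₛ (Y *ₛ Rᵒ (Rᵒ (φ ζ)) n))
              ≈ kₚ ζ *ₛ (mₚ ζ +ₛ ζ *ₛ nₚ ζ) *ₛ φ ζ n
  RR-φ n = by-combination
    (φ ζ n ∷ Rᵒ (φ ζ) n ∷ Rᵒ (Rᵒ (φ ζ)) n ∷ Y ∷ X ∷ ζ ∷ Q ∷ [])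
    ((mᵉ (ν 5) :^ 2 :* ν 2 ×[ ν 5 :* ν 5 ≐ ν 3 :* ν 3 ]) ∷
     (:- ν 5 :* ν 5 :* mᵉ (ν 5) ×[ mᵉ (ν 5) :* ν 2 ≐ nᵉ (ν 5) :* ν 1 ]) ∷
     (:- ν 5 :* ν 5 :* nᵉ (ν 5) ×[ mᵉ (ν 5) :* ν 1 ≐ nᵉ (ν 5) :* ν 0 ]) ∷ [])
    (mᵉ (ν 5) :^ 2 :* (ν 0 :- ν 3 :* (ν 3 :* ν 2)))
    (kᵉ (ν 5) :* (mᵉ (ν 5) :+ ν 5 :* nᵉ (ν 5)) :* ν 0)
    (ζ² , R-image R-linear n , R-φ n , tt) refl
    where open Poly {7} (ν 4) (ν 6)

module H₊ = Half Y ≈.refl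
module H₋ = Half (-ₛ Y) (identity (Y ∷ []) (:- ν 0 :* :- ν 0) (ν 0 :* ν 0) refl)

-- The kernel solution ψ and its ratio s

Tˡ∘Rˡ-cong : Congruentˡ (Tˡ ∘ Rˡ)
Tˡ∘Rˡ-cong eq = Tˡ-cong (Rˡ-cong eq)

Rˡ∘Rˡ-cong : Congruentˡ (Rˡ ∘ Rˡ)
Rˡ∘Rˡ-cong eq = Rˡ-cong (Rˡ-cong eq)

TR-linear : Linear (Tᵒ ∘ Rᵒ)
TR-linear = ∘-linear T-linear R-linear

RR-linear : Linear (Rᵒ ∘ Rᵒ)
RR-linear = ∘-linear R-linear R-linear

-- ψ absorbs the constant boundary term ζ n of TR-φ.
ψ : Seq
ψ = solution (Tˡ ∘ Rˡ) (λ _ → Q)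

ψ-eq : Solves (Tˡ ∘ Rˡ) (λ _ → Q) ψ
ψ-eq = solution-solves (Tˡ ∘ Rˡ) (λ _ → Q)

-- s is the root of the kernel equation (κ below) with constant term 1.
s t : PS
s = # 1 +ₛ Y *ₛ (Y *ₛ Rᵒ ψ 0)
t = X *ₛ s

ψ-zero : ψ 0 ≈ s -ₛ # 1 +ₛ Q
ψ-zero = by-combination (ψ 0 ∷ Tᵒ (Rᵒ ψ) 0 ∷ Rᵒ ψ 0 ∷ Y ∷ Q ∷ [])
  ((one′ ×[ ν 0 ≐ ν 4 :+ ν 3 :* (ν 3 :* ν 1) ]) ∷ (ν 3 :* ν 3 ×[ ν 1 ≐ ν 2 ]) ∷ [])
  (ν 0) (one′ :+ ν 3 :* (ν 3 :* ν 2) :- one′ :+ ν 4)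
  (ψ-eq 0 , T-zero (Rᵒ ψ) , tt) refl

-- The shifted sequence solves the equation of ψ with another constant source, and so does `s · ψ`.
-- By `T-shift` the new source is q + yq(Rψ)(0); the source q of ψ is chosen so that this is q·s
-- without a division.
ψ-geometric : Geometric (# 1) s ψ
ψ-geometric n = ≈.trans (≈.*-identityˡ (ψ (suc n)))
  (solution-unique Tˡ∘Rˡ-cong {λ _ → Q *ₛ s} {ψ ∘ suc} {s · ψ} shifted scaled n)
  where
  shifted : Solves (Tˡ ∘ Rˡ) (λ _ → Q *ₛ s) (ψ ∘ suc)
  shifted n = by-combination
    (ψ (suc n) ∷ Tᵒ (Rᵒ ψ) (suc n) ∷ Tᵒ (Rᵒ ψ ∘ suc) n ∷ Tᵒ (Rᵒ (ψ ∘ suc)) n ∷ Rᵒ ψ 0 ∷ Y ∷ Q ∷ [])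
    ((one′ ×[ ν 0 ≐ ν 6 :+ ν 5 :* (ν 5 :* ν 1) ]) ∷
     (ν 5 :* ν 5 ×[ ν 1 ≐ ν 2 :+ ν 6 :* ν 4 ]) ∷
     (:- ν 5 :* ν 5 ×[ ν 3 ≐ ν 2 ]) ∷ [])
    (ν 0) (ν 6 :* (one′ :+ ν 5 :* (ν 5 :* ν 4)) :+ ν 5 :* (ν 5 :* ν 3))
    (ψ-eq (suc n) , T-shift (Rᵒ ψ) n , T-linear .congˢ (R-shift ψ) n , tt) refl
  scaled : Solves (Tˡ ∘ Rˡ) (λ _ → Q *ₛ s) (s · ψ)
  scaled n = by-combination
    (ψ n ∷ Tᵒ (Rᵒ ψ) n ∷ Tᵒ (Rᵒ (s · ψ)) n ∷ s ∷ Y ∷ Q ∷ [])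
    ((ν 3 ×[ ν 0 ≐ ν 5 :+ ν 4 :* (ν 4 :* ν 1) ]) ∷
     (:- ν 4 :* ν 4 ×[ ν 2 ≐ ν 3 :* ν 1 ]) ∷ [])
    (ν 3 :* ν 0) (ν 5 :* ν 3 :+ ν 4 :* (ν 4 :* ν 2))
    (ψ-eq n , TR-linear .scale s ψ n , tt) refl

Nψ : Seq
Nψ = Nᵒ ψ

Nψ-ψ : ∀ n → (# 1 -ₛ t) *ₛ Nψ n ≈ # 1 *ₛ ψ n
Nψ-ψ = N-geometric (# 1) s ψ ψ-geometric

n₀ : PS
n₀ = # 1 +ₛ q-1 *ₛ t

R-ψ : ∀ n → Rᵒ ψ n ≈ n₀ *ₛ Nψ n
R-ψ n = by-combination
  (Rᵒ ψ n ∷ ψ n ∷ Nψ n ∷ Nψ (suc n) ∷ t ∷ X ∷ Q ∷ [])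
  ((one′ ×[ ν 0 ≐ ν 1 :+ ν 6 :* (ν 5 :* ν 3) ]) ∷
   (:- ν 6 ×[ ν 2 ≐ ν 1 :+ ν 5 :* ν 3 ]) ∷
   (ν 6 :- one′ ×[ (one′ :- ν 4) :* ν 2 ≐ one′ :* ν 1 ]) ∷ [])
  (ν 0) ((one′ :+ (ν 6 :- one′) :* ν 4) :* ν 2)
  (R-eq ψ n , N-eq ψ n , Nψ-ψ n , tt) refl

RR-ψ : ∀ n → (# 1 -ₛ t) *ₛ Rᵒ (Rᵒ ψ) n ≈ n₀ *ₛ (n₀ *ₛ Nψ n)
RR-ψ n = by-combination
  (Rᵒ (Rᵒ ψ) n ∷ Rᵒ Nψ n ∷ Rᵒ ((# 1 -ₛ t) · Nψ) n ∷ Rᵒ (# 1 · ψ) n ∷ Rᵒ ψ n ∷ Nψ n ∷ n₀ ∷ t ∷ [])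
  ((one′ :- ν 7 ×[ ν 0 ≐ ν 6 :* ν 1 ]) ∷
   (:- ν 6 ×[ ν 2 ≐ (one′ :- ν 7) :* ν 1 ]) ∷
   (ν 6 ×[ ν 2 ≐ ν 3 ]) ∷
   (ν 6 ×[ ν 3 ≐ one′ :* ν 4 ]) ∷
   (ν 6 ×[ ν 4 ≐ ν 6 :* ν 5 ]) ∷ [])
  ((one′ :- ν 7) :* ν 0) (ν 6 :* (ν 6 :* ν 5))
  (≈.trans (R-linear .congˢ R-ψ n) (R-linear .scale n₀ Nψ n) ,
   R-linear .scale (# 1 -ₛ t) Nψ n , R-linear .congˢ Nψ-ψ n , R-linear .scale (# 1) ψ n , R-ψ n , tt) refl

-- Evaluates s - 1 = y(Rψ)(0) by the eigenvalue `n₀`/(1 - t) of R on ψ and by `ψ-zero`. Expanded, it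
-- reads δts - εs + δ = 0.
κ : (# 1 -ₛ t) *ₛ (s -ₛ # 1) ≈ Y *ₛ (Y *ₛ (n₀ *ₛ (s -ₛ # 1 +ₛ Q)))
κ = by-combination
  (ψ 0 ∷ Rᵒ ψ 0 ∷ Nψ 0 ∷ n₀ ∷ t ∷ Y ∷ Q ∷ [])
  (((one′ :- ν 4) :* ν 5 :* ν 5 ×[ ν 1 ≐ ν 3 :* ν 2 ]) ∷
   (ν 5 :* ν 5 :* ν 3 ×[ (one′ :- ν 4) :* ν 2 ≐ one′ :* ν 0 ]) ∷
   (ν 5 :* ν 5 :* ν 3 ×[ ν 0 ≐ S :- one′ :+ ν 6 ]) ∷ [])
  ((one′ :- ν 4) :* (S :- one′)) (ν 5 :* (ν 5 :* (ν 3 :* (S :- one′ :+ ν 6))))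
  (R-ψ 0 , Nψ-ψ 0 , ψ-zero , tt) refl
  where
  S : Expr 7
  S = one′ :+ ν 5 :* (ν 5 :* ν 1)

-- The share of ψ in V₀: formally (1 - yRR)⁻¹(1 - yR)ψ.
W : Seq
W = solution (Rˡ ∘ Rˡ) (λ n → ψ n -ₛ Y *ₛ (Y *ₛ Rᵒ ψ n))

W-eq : Solves (Rˡ ∘ Rˡ) (λ n → ψ n -ₛ Y *ₛ (Y *ₛ Rᵒ ψ n)) W
W-eq = solution-solves (Rˡ ∘ Rˡ) (λ n → ψ n -ₛ Y *ₛ (Y *ₛ Rᵒ ψ n))

-- On ψ the operator defining W is the scalar (1 - t)(1 - t - y`n₀`)/((1 - t)² - y`n₀`²), and `κ`
-- reduces it to (1 - t)/(1 - ts).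
W-ψ : ∀ n → (# 1 -ₛ t *ₛ s) *ₛ W n ≈ (# 1 -ₛ t) *ₛ ψ n
W-ψ = solution-unique Rˡ∘Rˡ-cong {D} {(# 1 -ₛ t *ₛ s) · W} {(# 1 -ₛ t) · ψ} left right
  where
  D : Seq
  D n = (# 1 -ₛ t *ₛ s) *ₛ (ψ n -ₛ Y *ₛ (Y *ₛ Rᵒ ψ n))
  left : Solves (Rˡ ∘ Rˡ) D ((# 1 -ₛ t *ₛ s) · W)
  left n = by-combination
    (W n ∷ Rᵒ (Rᵒ W) n ∷ Rᵒ (Rᵒ ((# 1 -ₛ t *ₛ s) · W)) n ∷ ψ n ∷ Rᵒ ψ n ∷ t ∷ s ∷ Y ∷ [])
    ((one′ :- ν 5 :* ν 6 ×[ ν 0 ≐ (ν 3 :- ν 7 :* (ν 7 :* ν 4)) :+ ν 7 :* (ν 7 :* ν 1) ]) ∷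
     (:- ν 7 :* ν 7 ×[ ν 2 ≐ (one′ :- ν 5 :* ν 6) :* ν 1 ]) ∷ [])
    ((one′ :- ν 5 :* ν 6) :* ν 0)
    ((one′ :- ν 5 :* ν 6) :* (ν 3 :- ν 7 :* (ν 7 :* ν 4)) :+ ν 7 :* (ν 7 :* ν 2))
    (W-eq n , RR-linear .scale (# 1 -ₛ t *ₛ s) W n , tt) refl
  right : Solves (Rˡ ∘ Rˡ) D ((# 1 -ₛ t) · ψ)
  right n = by-combination
    (ψ n ∷ Rᵒ ψ n ∷ Rᵒ (Rᵒ ψ) n ∷ Rᵒ (Rᵒ ((# 1 -ₛ t) · ψ)) n ∷ Nψ n ∷ t ∷ s ∷ Y ∷ Q ∷ [])
    ((:- ν 7 :* ν 7 ×[ ν 3 ≐ (one′ :- ν 5) :* ν 2 ]) ∷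
     (:- ν 7 :* ν 7 ×[ (one′ :- ν 5) :* ν 2 ≐ n′ :* (n′ :* ν 4) ]) ∷
     ((one′ :- ν 5 :* ν 6) :* ν 7 :* ν 7 ×[ ν 1 ≐ n′ :* ν 4 ]) ∷
     (ν 5 :- ν 5 :* ν 6 ×[ (one′ :- ν 5) :* ν 4 ≐ one′ :* ν 0 ]) ∷
     (ν 5 :* ν 4 ×[ (one′ :- ν 5) :* (ν 6 :- one′) ≐ ν 7 :* (ν 7 :* (n′ :* (ν 6 :- one′ :+ ν 8))) ]) ∷ [])
    ((one′ :- ν 5) :* ν 0)
    ((one′ :- ν 5 :* ν 6) :* (ν 0 :- ν 7 :* (ν 7 :* ν 1)) :+ ν 7 :* (ν 7 :* ν 3))
    (RR-linear .scale (# 1 -ₛ t) ψ n , RR-ψ n , R-ψ n , Nψ-ψ n , κ , tt) refl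
    where
    n′ : Expr 9
    n′ = one′ :+ (ν 8 :- one′) :* ν 5

w : PS
w = Nᵒ W 0

w-eq : (# 1 -ₛ t *ₛ s) *ₛ w ≈ s -ₛ # 1 +ₛ Q
w-eq = by-combination
  (w ∷ Nᵒ ((# 1 -ₛ t *ₛ s) · W) 0 ∷ Nᵒ ((# 1 -ₛ t) · ψ) 0 ∷ Nψ 0 ∷ ψ 0 ∷ t ∷ s ∷ Q ∷ [])
  ((:- one′ ×[ ν 1 ≐ (one′ :- ν 5 :* ν 6) :* ν 0 ]) ∷ (one′ ×[ ν 1 ≐ ν 2 ]) ∷
   (one′ ×[ ν 2 ≐ (one′ :- ν 5) :* ν 3 ]) ∷ (one′ ×[ (one′ :- ν 5) :* ν 3 ≐ one′ :* ν 4 ]) ∷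
   (one′ ×[ ν 4 ≐ ν 6 :- one′ :+ ν 7 ]) ∷ [])
  ((one′ :- ν 5 :* ν 6) :* ν 0) (ν 6 :- one′ :+ ν 7)
  (N-linear .scale (# 1 -ₛ t *ₛ s) W 0 , N-linear .congˢ W-ψ 0 , N-linear .scale (# 1 -ₛ t) ψ 0 ,
   Nψ-ψ 0 , ψ-zero , tt) refl

-- Explicit solutions for V₁ and V₀

z₊ z₋ : PS
z₊ = Y
z₋ = -ₛ Y

-- V₂ - yTV₂ is half of a(z)φ(z) + a(-z)φ(-z), and 1 - yTR multiplies φ by k/m up to a constant, so
-- φ has coefficient am/k in 2V₁; extending by k(-z) makes the denominator Δ. The constants left
-- over, in total 2xyqc after multiplication by 2Δ, are removed by -2xycψ, because (1 - yTR)ψ = q.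
2Δ·V₁ : ∀ n → (# 2 *ₛ Δ′) *ₛ V₁ n ≈
  (aₚ z₊ *ₛ kₚ z₋ *ₛ mₚ z₊) *ₛ φ z₊ n +ₛ ((aₚ z₋ *ₛ kₚ z₊ *ₛ mₚ z₋) *ₛ φ z₋ n
    +ₛ (-ₛ (# 2 *ₛ X *ₛ (Y *ₛ Y) *ₛ cₚ)) *ₛ ψ n)
2Δ·V₁ = solution-unique Tˡ∘Rˡ-cong {D} {(# 2 *ₛ Δ′) · V₁} {α₊ · φ z₊ ∔ α₋ · φ z₋ ∔ β · ψ} left right
  where
  D : Seq
  D n = (# 2 *ₛ Δ′) *ₛ (V₂ n -ₛ Y *ₛ (Y *ₛ Tᵒ V₂ n))
  α₊ α₋ β : PS
  α₊ = aₚ z₊ *ₛ kₚ z₋ *ₛ mₚ z₊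
  α₋ = aₚ z₋ *ₛ kₚ z₊ *ₛ mₚ z₋
  β = -ₛ (# 2 *ₛ X *ₛ (Y *ₛ Y) *ₛ cₚ)
  left : Solves (Tˡ ∘ Rˡ) D ((# 2 *ₛ Δ′) · V₁)
  left n = by-combination
    (V₁ n ∷ Tᵒ (Rᵒ V₁) n ∷ Tᵒ (Rᵒ ((# 2 *ₛ Δ′) · V₁)) n ∷ V₂ n ∷ Tᵒ V₂ n ∷ Δ′ ∷ Y ∷ [])
    ((con (+ 2) :* ν 5 ×[ ν 0 ≐ ν 3 :- ν 6 :* (ν 6 :* ν 4) :+ ν 6 :* (ν 6 :* ν 1) ]) ∷
     (:- ν 6 :* ν 6 ×[ ν 2 ≐ (con (+ 2) :* ν 5) :* ν 1 ]) ∷ [])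
    ((con (+ 2) :* ν 5) :* ν 0)
    ((con (+ 2) :* ν 5) :* (ν 3 :- ν 6 :* (ν 6 :* ν 4)) :+ ν 6 :* (ν 6 :* ν 2))
    (V₁-eq n , TR-linear .scale (# 2 *ₛ Δ′) V₁ n , tt) refl
  right : Solves (Tˡ ∘ Rˡ) D (α₊ · φ z₊ ∔ α₋ · φ z₋ ∔ β · ψ)
  right n = by-combination
    (Tᵒ (Rᵒ (α₊ · φ z₊ ∔ α₋ · φ z₋ ∔ β · ψ)) n ∷ Tᵒ (Rᵒ (φ z₊)) n ∷ Tᵒ (Rᵒ (φ z₋)) n ∷
     Tᵒ (Rᵒ ψ) n ∷ ψ n ∷ V₂ n ∷ Tᵒ V₂ n ∷ X ∷ Y ∷ Q ∷ [])
    ((:- z :* z ×[ ν 0 ≐ e₊ :* ν 1 :+ (e₋ :* ν 2 :+ e :* ν 3) ]) ∷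
     (aᵉ z :* kᵉ (:- z) ×[ mᵉ z :* (f₊ :- z :* (z :* ν 1)) ≐ kᵉ z :* f₊ :+ z :* nᵉ z ]) ∷
     (aᵉ (:- z) :* kᵉ z ×[ mᵉ (:- z) :* (f₋ :- z :* (z :* ν 2)) ≐ kᵉ (:- z) :* f₋ :+ :- z :* nᵉ (:- z) ]) ∷
     (e ×[ ν 4 ≐ ν 9 :+ z :* (z :* ν 3) ]) ∷ [])
    (e₊ :* f₊ :+ (e₋ :* f₋ :+ e :* ν 4))
    ((con (+ 2) :* Δᵉ z) :* (ν 5 :- z :* (z :* ν 6)) :+ z :* (z :* ν 0))
    (linear₃ TR-linear α₊ α₋ β (φ z₊) (φ z₋) ψ n , H₊.TR-φ n , H₋.TR-φ n , ψ-eq n , tt) refl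
    where
    open Poly {10} (ν 7) (ν 9)
    z e₊ e₋ e f₊ f₋ : Expr 10
    z = ν 8
    e₊ = aᵉ z :* kᵉ (:- z) :* mᵉ z
    e₋ = aᵉ (:- z) :* kᵉ z :* mᵉ (:- z)
    e = :- (con (+ 2) :* ν 7 :* (z :* z) :* cᵉ z)
    f₊ = ν 5 :+ z :* ν 6
    f₋ = ν 5 :+ :- z :* ν 6

-- Inserting V₁, the φ-part of the source is a²(m + zn)/(2k)·φ, and by `RR-φ` the operator 1 - yRR
-- multiplies φ by k(m + zn)/m². The factor m + zn cancels, which leaves the perfect square
-- (am/k)²/2.
2Δ²·V₀ : ∀ n → (# 2 *ₛ Δ′ ^ₛ 2) *ₛ V₀ n ≈
  (kₚ z₋ *ₛ aₚ z₊ *ₛ mₚ z₊) ^ₛ 2 *ₛ φ z₊ n +ₛ ((kₚ z₊ *ₛ aₚ z₋ *ₛ mₚ z₋) ^ₛ 2 *ₛ φ z₋ n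
    +ₛ (-ₛ (# 4 *ₛ X *ₛ (Y *ₛ Y) *ₛ cₚ *ₛ Δ′)) *ₛ W n)
2Δ²·V₀ = solution-unique Rˡ∘Rˡ-cong {D} {(# 2 *ₛ Δ′ ^ₛ 2) · V₀} {α₊ · φ z₊ ∔ α₋ · φ z₋ ∔ β · W} left right
  where
  D : Seq
  D n = (# 2 *ₛ Δ′ ^ₛ 2) *ₛ
    (# 2 *ₛ (V₁ n -ₛ Y *ₛ (Y *ₛ Rᵒ V₁ n)) -ₛ (# 1 -ₛ Y *ₛ Y) *ₛ V₂ n)
  α₊ α₋ β a₊ a₋ b : PS
  α₊ = (kₚ z₋ *ₛ aₚ z₊ *ₛ mₚ z₊) ^ₛ 2
  α₋ = (kₚ z₊ *ₛ aₚ z₋ *ₛ mₚ z₋) ^ₛ 2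
  β = -ₛ (# 4 *ₛ X *ₛ (Y *ₛ Y) *ₛ cₚ *ₛ Δ′)
  a₊ = aₚ z₊ *ₛ kₚ z₋ *ₛ mₚ z₊
  a₋ = aₚ z₋ *ₛ kₚ z₊ *ₛ mₚ z₋
  b = -ₛ (# 2 *ₛ X *ₛ (Y *ₛ Y) *ₛ cₚ)
  left : Solves (Rˡ ∘ Rˡ) D ((# 2 *ₛ Δ′ ^ₛ 2) · V₀)
  left n = by-combination
    (V₀ n ∷ Rᵒ (Rᵒ V₀) n ∷ Rᵒ (Rᵒ ((# 2 *ₛ Δ′ ^ₛ 2) · V₀)) n ∷ V₁ n ∷ Rᵒ V₁ n ∷ V₂ n ∷ Δ′ ∷ Y ∷ [])
    ((c ×[ ν 0 ≐ d :+ ν 7 :* (ν 7 :* ν 1) ]) ∷ (:- ν 7 :* ν 7 ×[ ν 2 ≐ c :* ν 1 ]) ∷ [])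
    (c :* ν 0) (c :* d :+ ν 7 :* (ν 7 :* ν 2))
    (V₀-eq n , RR-linear .scale (# 2 *ₛ Δ′ ^ₛ 2) V₀ n , tt) refl
    where
    c d : Expr 8
    c = con (+ 2) :* ν 6 :^ 2
    d = con (+ 2) :* (ν 3 :- ν 7 :* (ν 7 :* ν 4)) :- (one′ :- ν 7 :* ν 7) :* ν 5
  R-2Δ·V₁ : ∀ n → (# 2 *ₛ Δ′) *ₛ Rᵒ V₁ n ≈
            a₊ *ₛ Rᵒ (φ z₊) n +ₛ (a₋ *ₛ Rᵒ (φ z₋) n +ₛ b *ₛ Rᵒ ψ n)
  R-2Δ·V₁ n = ≈.trans (≈.sym (R-linear .scale (# 2 *ₛ Δ′) V₁ n))
    (≈.trans (R-linear .congˢ 2Δ·V₁ n) (linear₃ R-linear a₊ a₋ b (φ z₊) (φ z₋) ψ n))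
  right : Solves (Rˡ ∘ Rˡ) D (α₊ · φ z₊ ∔ α₋ · φ z₋ ∔ β · W)
  right n = by-combination
    (Rᵒ (Rᵒ (α₊ · φ z₊ ∔ α₋ · φ z₋ ∔ β · W)) n ∷ Rᵒ (Rᵒ (φ z₊)) n ∷ Rᵒ (Rᵒ (φ z₋)) n ∷
     Rᵒ (Rᵒ W) n ∷ W n ∷ V₁ n ∷ Rᵒ V₁ n ∷ Rᵒ (φ z₊) n ∷ Rᵒ (φ z₋) n ∷ Rᵒ ψ n ∷ ψ n ∷
     V₂ n ∷ Tᵒ V₂ n ∷ X ∷ Y ∷ Q ∷ [])
    ((:- z :* z ×[ ν 0 ≐ α₊ᵉ :* ν 1 :+ (α₋ᵉ :* ν 2 :+ βᵉ :* ν 3) ]) ∷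
     ((kᵉ (:- z) :* aᵉ z) :^ 2 ×[ mᵉ z :^ 2 :* (f₊ :- z :* (z :* ν 1)) ≐ kᵉ z :* (mᵉ z :+ z :* nᵉ z) :* f₊ ]) ∷
     ((kᵉ z :* aᵉ (:- z)) :^ 2 ×[ mᵉ (:- z) :^ 2 :* (f₋ :- z :* (z :* ν 2)) 
       ≐ kᵉ (:- z) :* (mᵉ (:- z) :+ :- z :* nᵉ (:- z)) :* f₋ ]) ∷
     (βᵉ ×[ ν 4 ≐ ν 10 :- z :* (z :* ν 9) :+ z :* (z :* ν 3) ]) ∷
     (:- con (+ 2) :* Δᵉ z ×[ con (+ 2) :* Δᵉ z :* ν 5 ≐ a₊ᵉ :* f₊ :+ (a₋ᵉ :* f₋ :+ bᵉ′ :* ν 10) ]) ∷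
     (con (+ 2) :* Δᵉ z :* z :* z ×[ con (+ 2) :* Δᵉ z :* ν 6 ≐ a₊ᵉ :* ν 7 :+ (a₋ᵉ :* ν 8 :+ bᵉ′ :* ν 9) ]) ∷
     (con (+ 2) :* Δᵉ z :* z :* z :* aᵉ z :* kᵉ (:- z) ×[ mᵉ z :* ν 7 ≐ nᵉ z :* f₊ ]) ∷
     (con (+ 2) :* Δᵉ z :* z :* z :* aᵉ (:- z) :* kᵉ z ×[ mᵉ (:- z) :* ν 8 ≐ nᵉ (:- z) :* f₋ ]) ∷ [])
    (α₊ᵉ :* f₊ :+ (α₋ᵉ :* f₋ :+ βᵉ :* ν 4))
    ((con (+ 2) :* Δᵉ z :^ 2) :* (con (+ 2) :* (ν 5 :- z :* (z :* ν 6)) :- (one′ :- z :* z) :* ν 11)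
      :+ z :* (z :* ν 0))
    (linear₃ RR-linear α₊ α₋ β (φ z₊) (φ z₋) W n , H₊.RR-φ n , H₋.RR-φ n , W-eq n ,
     2Δ·V₁ n , R-2Δ·V₁ n , H₊.R-φ n , H₋.R-φ n , tt) refl
    where
    open Poly {16} (ν 13) (ν 15)
    z α₊ᵉ α₋ᵉ βᵉ a₊ᵉ a₋ᵉ bᵉ′ f₊ f₋ : Expr 16
    z = ν 14
    α₊ᵉ = (kᵉ (:- z) :* aᵉ z :* mᵉ z) :^ 2
    α₋ᵉ = (kᵉ z :* aᵉ (:- z) :* mᵉ (:- z)) :^ 2
    βᵉ = :- (con (+ 4) :* ν 13 :* (z :* z) :* cᵉ z :* Δᵉ z)
    a₊ᵉ = aᵉ z :* kᵉ (:- z) :* mᵉ z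
    a₋ᵉ = aᵉ (:- z) :* kᵉ z :* mᵉ (:- z)
    bᵉ′ = :- (con (+ 2) :* ν 13 :* (z :* z) :* cᵉ z)
    f₊ = ν 11 :+ z :* ν 12
    f₋ = ν 11 :+ :- z :* ν 12

-- The square root of Δ and the sum over the lowest row

S₀ : PS
S₀ = ε -ₛ # 2 *ₛ δ *ₛ t

-- t is a root of δt² - εt + xδ, which is `κ` times x, so ε - 2δt is a square root of the
-- discriminant ε² - 4xδ². This is Δ with x and y exchanged, and Δ is symmetric.
S₀² : S₀ *ₛ S₀ ≈ Δ′
S₀² = by-combination (s ∷ X ∷ Y ∷ Q ∷ [])
  ((:- con (+ 4) :* δᵉ z :* ν 1
     ×[ (one′ :- t′) :* (ν 0 :- one′) ≐ z :* (z :* ((one′ :+ (ν 3 :- one′) :* t′) :* (ν 0 :- one′ :+ ν 3))) ]) ∷ [])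
  (S′ :* S′) (Δᵉ z) (κ , tt) refl
  where
  open Poly {4} (ν 1) (ν 3)
  z t′ S′ : Expr 4
  z = ν 2
  t′ = ν 1 :* ν 0
  S′ = εᵉ z :- con (+ 2) :* δᵉ z :* t′

-- (S + S₀)(S - S₀) = 0, and the first factor has constant coefficient 2.
S₀-unique : ∀ S → S *ₛ S ≈ Δ′ → S 0 0 0 ≡ 1ℤ → S ≈ S₀
S₀-unique S S² S≡1 = x-y≈0⇒x≈y (*ₛ-regular (S +ₛ S₀)
  (λ eq → case ≡.trans (≡.cong (ℤ._+ 1ℤ) (≡.sym S≡1)) eq of λ ())
  (S -ₛ S₀) (≈.trans (by-combination (S ∷ S₀ ∷ Δ′ ∷ [])
    ((one′ ×[ ν 0 :* ν 0 ≐ ν 2 ]) ∷ (:- one′ ×[ ν 1 :* ν 1 ≐ ν 2 ]) ∷ [])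
    ((ν 0 :+ ν 1) :* (ν 0 :- ν 1)) (con 0ℤ) (S² , S₀² , tt) refl) const-0))

-- By `κ`, sε = δ(1 + ts) and hence s·S₀ = δ(1 - ts): the denominator of w is the square root of Δ
-- up to the factors s and δ. The identity is therefore checked after multiplication by s, whose
-- constant coefficient is 1.
2S₀w : # 2 *ₛ S₀ *ₛ w ≈ # 2 *ₛ δ +ₛ q-1 *ₛ (ε +ₛ S₀)
2S₀w = *ₛ-cancel s (λ ()) (# 2 *ₛ S₀ *ₛ w) (# 2 *ₛ δ +ₛ q-1 *ₛ (ε +ₛ S₀)) (by-combination
  (w ∷ s ∷ X ∷ Y ∷ Q ∷ [])
  ((con (+ 2) :* ν 0 :- con (+ 2) :* r
     ×[ (one′ :- t′) :* (ν 1 :- one′) ≐ z :* (z :* ((one′ :+ r :* t′) :* (ν 1 :- one′ :+ ν 4))) ]) ∷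
   (con (+ 2) :* δᵉ z ×[ (one′ :- t′ :* ν 1) :* ν 0 ≐ ν 1 :- one′ :+ ν 4 ]) ∷ [])
  (ν 1 :* (con (+ 2) :* S′ :* ν 0)) (ν 1 :* (con (+ 2) :* δᵉ z :+ r :* (εᵉ z :+ S′)))
  (κ , w-eq , tt) refl)
  where
  open Poly {5} (ν 2) (ν 4)
  z t′ S′ : Expr 5
  z = ν 3
  t′ = ν 2 :* ν 1
  S′ = εᵉ z :- con (+ 2) :* δᵉ z :* t′

-- The data of the theorem, to be evaluated both at y and at z².
module Frozen {n} (x y q : Expr n) where
  r Δᶠ N₀ᶠ Nᶠ : Expr n
  r = q :- one′
  Δᶠ = (one′ :+ y :- x :- (r :^ 2) :* x :* y) :^ 2 :- con (+ 4) :* y :* (one′ :+ r :* x) :^ 2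
  N₀ᶠ = q :^ 4 :* x :^ 2 :* y :^ 2
        :* (con (+ 2) :+ (x :+ y :+ one′) :* r :- x :* y :* r :^ 3) :^ 2
  Nᶠ = q :^ 4 :* x :* y
         :* (:- (x :^ 3 :* y) :+ con (+ 2) :* x :^ 2 :* y :^ 2 :- x :* y :^ 3
             :- x :^ 3 :- x :^ 2 :* y :- x :* y :^ 2 :- y :^ 3
             :+ con (+ 3) :* x :^ 2 :+ con (+ 5) :* x :* y :+ con (+ 3) :* y :^ 2
             :- con (+ 3) :* x :- con (+ 3) :* y :+ one′)
       :- con (+ 8) :* q :^ 4 :* x :^ 2 :* y :^ 2 :* r
         :* (x :^ 2 :- x :* y :+ y :^ 2 :- con (+ 2) :* x :- con (+ 2) :* y :+ one′)
       :- q :^ 4 :* x :^ 2 :* y :^ 2 :* r :^ 2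
         :* (x :^ 3 :+ x :^ 2 :* y :+ x :* y :^ 2 :+ y :^ 3 :+ x :^ 2
             :- con (+ 44) :* x :* y :+ y :^ 2 :- con (+ 5) :* x :- con (+ 5) :* y :+ con (+ 3))
       :+ q :^ 4 :* x :^ 3 :* y :^ 3 :* r :^ 3
         :* (con (+ 8) :* (con (+ 2) :* y :+ con (+ 2) :* x :+ con (+ 3))
             :+ (con (+ 3) :* x :^ 2 :+ con (+ 5) :* x :* y :+ con (+ 3) :* y :^ 2
                 :+ con (+ 5) :* x :+ con (+ 5) :* y :+ con (+ 4)) :* r)
       :- q :^ 4 :* x :^ 4 :* y :^ 4 :* r :^ 5
         :* (con (+ 8) :+ con (+ 3) :* (x :+ y :+ one′) :* r :- x :* y :* r :^ 3)

-- The lowest row contributes `X` for its first cell, N for its other cells and `Y *ₛ Y` for itself;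
-- `Q ^ₛ 4` stands for the corners of the lowest and the highest row.
E′ : PS
E′ = Q ^ₛ 4 *ₛ (X *ₛ (Y *ₛ (Y *ₛ Nᵒ V₀ 0)))

module _ where
  open Frozen {3} (ν 0) (ν 1 :* ν 1) (ν 2)
  N₀′ N′ : PS
  N₀′ = ⟦ N₀ᶠ ⟧ (ρ₀ Y)
  N′ = ⟦ Nᶠ ⟧ (ρ₀ Y)

-- N maps φ to 1/m at 0, so only w brings in S. Since c = 2δ + (q - 1)ε, `2Sw` gives 4xycΔw =
-- 2xyc((q - 1)Δ + cS), whence the square of c in N₀.
Δ²E′ : ∀ S → S *ₛ S ≈ Δ′ → S 0 0 0 ≡ 1ℤ → Δ′ ^ₛ 2 *ₛ E′ ≈ N′ -ₛ N₀′ *ₛ S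
Δ²E′ S S² S≡1 = *ₛ-cancel (# 2) (λ ()) (Δ′ ^ₛ 2 *ₛ E′) (N′ -ₛ N₀′ *ₛ S) (by-combination
  (Nᵒ V₀ 0 ∷ Nᵒ (φ z₊) 0 ∷ Nᵒ (φ z₋) 0 ∷ w ∷ S ∷ X ∷ Y ∷ Q ∷ [])
  ((g ×[ (con (+ 2) :* Δᵉ z :^ 2) :* ν 0 ≐ α₊ᵉ :* ν 1 :+ (α₋ᵉ :* ν 2 :+ βᵉ :* ν 3) ]) ∷
   (g :* (kᵉ (:- z) :* aᵉ z) :^ 2 :* mᵉ z ×[ mᵉ z :* ν 1 ≐ one′ ]) ∷
   (g :* (kᵉ z :* aᵉ (:- z)) :^ 2 :* mᵉ (:- z) ×[ mᵉ (:- z) :* ν 2 ≐ one′ ]) ∷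
   (h :* (con (+ 4) :* ν 3 :- con (+ 2) :* r) ×[ ν 4 :* ν 4 ≐ Δᵉ z ]) ∷
   (:- con (+ 2) :* h :* ν 4 ×[ con (+ 2) :* ν 4 :* ν 3 ≐ con (+ 2) :* δᵉ z :+ r :* (εᵉ z :+ ν 4) ]) ∷ [])
  (con (+ 2) :* (Δᵉ z :^ 2 :* (ν 7 :^ 4 :* (ν 5 :* (z :* (z :* ν 0))))))
  (con (+ 2) :* (Nᶠ :- N₀ᶠ :* ν 4))
  (N-2Δ²·V₀ , H₊.N-φ , H₋.N-φ , S² , 2Sw , tt) refl)
  where
  open Poly {8} (ν 5) (ν 7)
  open Frozen {8} (ν 5) (ν 6 :* ν 6) (ν 7) using (Nᶠ; N₀ᶠ)
  z α₊ᵉ α₋ᵉ βᵉ g h : Expr 8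
  z = ν 6
  α₊ᵉ = (kᵉ (:- z) :* aᵉ z :* mᵉ z) :^ 2
  α₋ᵉ = (kᵉ z :* aᵉ (:- z) :* mᵉ (:- z)) :^ 2
  βᵉ = :- (con (+ 4) :* ν 5 :* (z :* z) :* cᵉ z :* Δᵉ z)
  g = ν 7 :^ 4 :* ν 5 :* z :* z
  h = g :* ν 5 :* (z :* z) :* cᵉ z
  α₊ α₋ β : PS
  α₊ = (kₚ z₋ *ₛ aₚ z₊ *ₛ mₚ z₊) ^ₛ 2
  α₋ = (kₚ z₊ *ₛ aₚ z₋ *ₛ mₚ z₋) ^ₛ 2
  β = -ₛ (# 4 *ₛ X *ₛ (Y *ₛ Y) *ₛ cₚ *ₛ Δ′)
  N-2Δ²·V₀ : (# 2 *ₛ Δ′ ^ₛ 2) *ₛ Nᵒ V₀ 0 ≈ α₊ *ₛ Nᵒ (φ z₊) 0 +ₛ (α₋ *ₛ Nᵒ (φ z₋) 0 +ₛ β *ₛ w)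
  N-2Δ²·V₀ = ≈.trans (≈.sym (N-linear .scale (# 2 *ₛ Δ′ ^ₛ 2) V₀ 0))
    (≈.trans (N-linear .congˢ 2Δ²·V₀ 0) (linear₃ N-linear α₊ α₋ β (φ z₊) (φ z₋) W 0))
  2Sw : # 2 *ₛ S *ₛ w ≈ # 2 *ₛ δ +ₛ q-1 *ₛ (ε +ₛ S)
  2Sw = by-combination (w ∷ S ∷ S₀ ∷ δ ∷ ε ∷ Q ∷ [])
    ((con (+ 2) :* ν 0 :- (ν 5 :- one′) ×[ ν 1 ≐ ν 2 ]) ∷
     (one′ ×[ con (+ 2) :* ν 2 :* ν 0 ≐ con (+ 2) :* ν 3 :+ (ν 5 :- one′) :* (ν 4 :+ ν 2) ]) ∷ [])
    (con (+ 2) :* ν 1 :* ν 0) (con (+ 2) :* ν 3 :+ (ν 5 :- one′) :* (ν 4 :+ ν 1))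
    (S₀-unique S S² S≡1 , 2S₀w , tt) refl

-- Return from z to y

double : ℕ → ℕ
double zero = zero
double (suc n) = suc (suc (double n))

module Spread {c ℓ} (R : CommutativeRing c ℓ) where
  open CommutativeRing R renaming (Carrier to A; _≈_ to _≃_; refl to ≃-refl; sym to ≃-sym; trans to ≃-trans)
  open Series R

  spread : (ℕ → A) → ℕ → A
  spread f 0 = f 0
  spread f 1 = 0#
  spread f (suc (suc n)) = spread (f ∘ suc) n

  spread-cong : ∀ {f g} → f ≋ g → spread f ≋ spread g
  spread-cong eq 0 = eq 0
  spread-cong eq 1 = ≃-refl
  spread-cong eq (suc (suc n)) = spread-cong (eq ∘ suc) n

  spread-⊕ : ∀ f g → spread (f ⊕ g) ≋ spread f ⊕ spread g
  spread-⊕ f g 0 = ≃-refl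
  spread-⊕ f g 1 = ≃-sym (+-identityˡ 0#)
  spread-⊕ f g (suc (suc n)) = spread-⊕ (f ∘ suc) (g ∘ suc) n

  spread-scale : ∀ a f → spread (λ n → a * f n) ≋ (λ n → a * spread f n)
  spread-scale a f 0 = ≃-refl
  spread-scale a f 1 = ≃-sym (zeroʳ a)
  spread-scale a f (suc (suc n)) = spread-scale a (f ∘ suc) n

  spread-⊛ : ∀ f g → spread (f ⊛ g) ≋ spread f ⊛ spread g
  spread-⊛ f g 0 = ≃-refl
  spread-⊛ f g 1 = ≃-sym (≃-trans (+-cong (zeroʳ _) (zeroˡ _)) (+-identityˡ 0#))
  spread-⊛ f g (suc (suc n)) = ≃-trans
    (spread-cong (⊛-front f g) n) (≃-trans (spread-⊕ _ _ n) (≃-trans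
    (+-cong (spread-scale (f 0) (g ∘ suc) n) (spread-⊛ (f ∘ suc) g n)) (≃-sym (≃-trans
    (⊛-front (spread f) (spread g) (suc n))
    (+-congˡ (⊛-shift (spread f ∘ suc) (spread g) n ≃-refl))))))

  spread-double : ∀ f n → spread f (double n) ≡ f n
  spread-double f 0 = refl
  spread-double f (suc n) = spread-double (f ∘ suc) n

module Spread₂ = Spread ℤ⟦q⟧
open Spread₂ using (spread; spread-cong; spread-⊕; spread-⊛; spread-double)

-- The substitution y ↦ y².
ι : PS → PS
ι f i = spread (f i)

ι-cong : ∀ {f g} → f ≈ g → ι f ≈ ι g
ι-cong eq i = spread-cong (eq i)

ι-injective : ∀ f g → ι f ≈ ι g → f ≈ g
ι-injective f g eq i j k = ≡.trans (≡.sym (≡.cong (λ a → a k) (spread-double (f i) j)))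
  (≡.trans (eq i (double j) k) (≡.cong (λ a → a k) (spread-double (g i) j)))

ι-+ : ∀ f g → ι (f +ₛ g) ≈ ι f +ₛ ι g
ι-+ f g i = spread-⊕ (f i) (g i)

ι-* : ∀ f g → ι (f *ₛ g) ≈ ι f *ₛ ι g
ι-* f g i j k = ≡.trans (spread-cong (*ₛ-⊛ f g i) j k)
  (≡.trans (spread-sum i (λ a → f a S₂.⊛ g (i ℕ.∸ a)) j k)
  (≡.trans (S₃.sumTo-cong i (λ a _ → spread-⊛ (f a) (g (i ℕ.∸ a))) j k)
  (≡.sym (*ₛ-⊛ (ι f) (ι g) i j k))))
  where
  spread-sum : ∀ n F j k → spread (S₃.sumTo n F) j k ≡ S₃.sumTo n (spread ∘ F) j k
  spread-sum zero F j k = refl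
  spread-sum (suc n) F j k = ≡.trans (spread-⊕ (S₃.sumTo n F) (F (suc n)) j k)
    (≡.cong (ℤ._+ spread (F (suc n)) j k) (spread-sum n F j k))

ι-neg : ∀ f → ι (-ₛ f) ≈ -ₛ ι f
ι-neg f i 0 k = refl
ι-neg f i 1 k = refl
ι-neg f i (suc (suc j)) k = ι-neg (λ i j → f i (suc j)) i j k

ι-0 : ∀ j k → spread (λ _ _ → 0ℤ) j k ≡ 0ℤ
ι-0 0 k = refl
ι-0 1 k = refl
ι-0 (suc (suc j)) k = ι-0 j k

ι-const : ∀ n → ι (const n) ≈ const n
ι-const n (suc i) j k = ι-0 j k
ι-const n zero 0 k = refl
ι-const n zero 1 k = refl
ι-const n zero (suc (suc j)) k = ι-0 j k

ι-X : ι X ≈ X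
ι-X zero j k = ι-0 j k
ι-X (suc zero) 0 k = refl
ι-X (suc zero) 1 k = refl
ι-X (suc zero) (suc (suc j)) k = ι-0 j k
ι-X (suc (suc i)) j k = ι-0 j k

ι-Q : ι Q ≈ Q
ι-Q (suc i) j k = ι-0 j k
ι-Q zero 0 k = refl
ι-Q zero 1 k = refl
ι-Q zero (suc (suc j)) k = ι-0 j k

ι-Y : ι Y ≈ Y *ₛ Y
ι-Y i 0 k = ≡.trans (lemma i) (≡.sym (Y-*-zero Y i k))
  where
  lemma : ∀ i → Y i 0 k ≡ 0ℤ
  lemma zero = refl
  lemma (suc i) = refl
ι-Y i 1 k = ≡.trans (lemma i) (≡.sym (Y-*-suc Y i 0 k))
  where
  lemma : ∀ i → 0ℤ ≡ Y i 0 k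
  lemma zero = refl
  lemma (suc i) = refl
ι-Y i (suc (suc j)) k = ≡.trans (ι-cong shifted i j k)
  (≡.trans (ι-const 1ℤ i j k) (≡.trans (≡.sym (shifted i j k)) (≡.sym (Y-*-suc Y i (suc j) k))))
  where
  shifted : (λ i j → Y i (suc j)) ≈ const 1ℤ
  shifted zero zero k = refl
  shifted zero (suc j) k = refl
  shifted (suc i) j k = refl

ι-⟦⟧ : ∀ {n} (e : Expr n) ρ ρ′ → (∀ i → ι (lookup ρ i) ≈ lookup ρ′ i) → ι (⟦ e ⟧ ρ) ≈ ⟦ e ⟧ ρ′
ι-⟦⟧ (con c) ρ ρ′ eq = ι-const c
ι-⟦⟧ (var i) ρ ρ′ eq = eq i
ι-⟦⟧ (e :+ f) ρ ρ′ eq = ≈.trans (ι-+ (⟦ e ⟧ ρ) (⟦ f ⟧ ρ)) (≈.+-cong (ι-⟦⟧ e ρ ρ′ eq) (ι-⟦⟧ f ρ ρ′ eq))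
ι-⟦⟧ (e :* f) ρ ρ′ eq = ≈.trans (ι-* (⟦ e ⟧ ρ) (⟦ f ⟧ ρ)) (≈.*-cong (ι-⟦⟧ e ρ ρ′ eq) (ι-⟦⟧ f ρ ρ′ eq))
ι-⟦⟧ (e :- f) ρ ρ′ eq = ≈.trans (ι-+ (⟦ e ⟧ ρ) (-ₛ ⟦ f ⟧ ρ)) (≈.+-cong (ι-⟦⟧ e ρ ρ′ eq)
  (≈.trans (ι-neg (⟦ f ⟧ ρ)) (≈.-‿cong (ι-⟦⟧ f ρ ρ′ eq))))
ι-⟦⟧ (:- e) ρ ρ′ eq = ≈.trans (ι-neg (⟦ e ⟧ ρ)) (≈.-‿cong (ι-⟦⟧ e ρ ρ′ eq))
ι-⟦⟧ (e :^ zero) ρ ρ′ eq = ι-const 1ℤ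
ι-⟦⟧ (e :^ suc m) ρ ρ′ eq = ≈.trans (ι-* (⟦ e ⟧ ρ) (⟦ e :^ m ⟧ ρ))
  (≈.*-cong (ι-⟦⟧ e ρ ρ′ eq) (ι-⟦⟧ (e :^ m) ρ ρ′ eq))

-- The equation is compared after y ↦ y², where `Δ²E′` applies with `ι S` as the root, and
-- injectivity of `ι` removes z.
Δ²-eq : ∀ F S → ι F ≈ E′ → S *ₛ S ≈ Δ → S 0 0 0 ≡ 1ℤ → Δ ^ₛ 2 *ₛ F ≈ N -ₛ N₀ *ₛ S
Δ²-eq F S ιF S² S≡1 = ι-injective (Δ ^ₛ 2 *ₛ F) (N -ₛ N₀ *ₛ S)
  (≈.trans (ι-⟦⟧ (Δᶠ :^ 2 :* ν 3) ρ ρ′ ιρ)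
  (≈.trans (Δ²E′ (ι S) ιS² S≡1) (≈.sym (ι-⟦⟧ (Nᶠ :- N₀ᶠ :* ν 4) ρ ρ′ ιρ))))
  where
  open Frozen {5} (ν 0) (ν 1) (ν 2)
  ρ ρ′ : Vec PS 5
  ρ = X ∷ Y ∷ Q ∷ F ∷ S ∷ []
  ρ′ = X ∷ Y *ₛ Y ∷ Q ∷ E′ ∷ ι S ∷ []
  ιρ : ∀ i → ι (lookup ρ i) ≈ lookup ρ′ i
  ιρ Fin.zero = ι-X
  ιρ (Fin.suc Fin.zero) = ι-Y
  ιρ (Fin.suc (Fin.suc Fin.zero)) = ι-Q
  ιρ (Fin.suc (Fin.suc (Fin.suc Fin.zero))) = ιF
  ιρ (Fin.suc (Fin.suc (Fin.suc (Fin.suc Fin.zero)))) = ≈.refl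
  ιS² : ι S *ₛ ι S ≈ Δ′
  ιS² = ≈.trans (≈.sym (ι-* S S)) (≈.trans (ι-cong S²) (ι-⟦⟧ Δᶠ ρ ρ′ ιρ))

-- From S·S³ = Δ² it follows that S·Δ⁻² is the inverse of S³.
closed-form : ∀ F S S⁻³ Δ⁻² → ι F ≈ E′ → S *ₛ S ≈ Δ → S 0 0 0 ≡ 1ℤ →
  (S ^ₛ 3) *ₛ S⁻³ ≈ # 1 → (Δ ^ₛ 2) *ₛ Δ⁻² ≈ # 1 → F ≈ -ₛ (N₀ *ₛ S⁻³) +ₛ N *ₛ Δ⁻²
closed-form F S S⁻³ Δ⁻² ιF S² S≡1 S³S⁻³ Δ²Δ⁻² = by-combination
  (F ∷ N ∷ N₀ ∷ S⁻³ ∷ Δ⁻² ∷ Δ ∷ S ∷ [])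
  ((ν 4 ×[ ν 5 :^ 2 :* ν 0 ≐ ν 1 :- ν 2 :* ν 6 ]) ∷
   (:- (ν 0 :+ ν 2 :* ν 3) ×[ ν 5 :^ 2 :* ν 4 ≐ one′ ]) ∷
   (ν 2 :* ν 4 :* ν 6 ×[ ν 6 :^ 3 :* ν 3 ≐ one′ ]) ∷
   (:- ν 2 :* ν 4 :* ν 3 :* (ν 6 :* ν 6 :+ ν 5) ×[ ν 6 :* ν 6 ≐ ν 5 ]) ∷ [])
  (ν 0) (:- (ν 2 :* ν 3) :+ ν 1 :* ν 4)
  (Δ²-eq F S ιF S² S≡1 , Δ²Δ⁻² , S³S⁻³ , S² , tt) refl

-- Sums over rows given the state of each column

-- Column states while the rows are read from bottom to top: not reached yet,
-- occupied by the current row, already left.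
data St : Set where
  s0 s1 s2 : St

on : St → Bool
on s0 = false
on s1 = true
on s2 = false

clr : St → St
clr s0 = s0
clr s1 = s2
clr s2 = s2

Kf : Set
Kf = ℕ → ℤ

infix 4 _≃_
_≃_ : Kf → Kf → Set
f ≃ g = ∀ k → f k ≡ g k

infixl 6 _⊞_
_⊞_ : Kf → Kf → Kf
(f ⊞ g) k = f k ℤ.+ g k

0k : Kf
0k _ = 0ℤ

≃-trans : ∀ {f g h} → f ≃ g → g ≃ h → f ≃ h
≃-trans p q k = ≡.trans (p k) (q k)

≃-sym : ∀ {f g} → f ≃ g → g ≃ f
≃-sym p k = ≡.sym (p k)

⊞-cong : ∀ {f f′ g g′} → f ≃ f′ → g ≃ g′ → f ⊞ g ≃ f′ ⊞ g′
⊞-cong p q k = cong₂ ℤ._+_ (p k) (q k)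

⊞-0 : ∀ {f g} → f ≃ 0k → g ≃ 0k → f ⊞ g ≃ 0k
⊞-0 p q k = cong₂ ℤ._+_ (p k) (q k)

⊞-0ʳ : ∀ {f g} → g ≃ 0k → f ⊞ g ≃ f
⊞-0ʳ {f} p k = ≡.trans (cong (ℤ._+_ (f k)) (p k)) (ℤP.+-identityʳ (f k))

⊞-0ˡ : ∀ {f g} → f ≃ 0k → f ⊞ g ≃ g
⊞-0ˡ {f} {g} p k = ≡.trans (cong (ℤ._+ g k) (p k)) (ℤP.+-identityˡ (g k))

⊞-swap : ∀ a b c d → (a ⊞ b) ⊞ (c ⊞ d) ≃ (a ⊞ c) ⊞ (b ⊞ d)
⊞-swap a b c d k = S₁.interchange (a k) (b k) (c k) (d k)

qs-0 : ∀ {f} → f ≃ 0k → qs f ≃ 0k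
qs-0 p zero = refl
qs-0 p (suc k) = p k

qs-⊞ : ∀ f g → qs (f ⊞ g) ≃ qs f ⊞ qs g
qs-⊞ f g zero = refl
qs-⊞ f g (suc k) = refl

exactlyOne : Bool → Bool → Bool → Bool → Bool
exactlyOne true b c d = not (b ∨ c ∨ d)
exactlyOne false true c d = not (c ∨ d)
exactlyOne false false true d = not d
exactlyOne false false false d = d

-- The factor q of the vertex between two neighbouring columns; o, b and o′, b′
-- tell which cells of the old and the new row these columns contain.
corner : Bool → Bool → Bool → Bool → Kf → Kf
corner o b o′ b′ f = if exactlyOne o b o′ b′ then qs f else f

corner-cong : ∀ o b o′ b′ {f g} → f ≃ g → corner o b o′ b′ f ≃ corner o b o′ b′ g
corner-cong o b o′ b′ p with exactlyOne o b o′ b′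
... | true = qs-cong p
... | false = p

corner-0 : ∀ o b o′ b′ {f} → f ≃ 0k → corner o b o′ b′ f ≃ 0k
corner-0 o b o′ b′ p with exactlyOne o b o′ b′
... | true = qs-0 p
... | false = p

-- Sums over the ways in which a new row can continue to the right.  ΣP: it has not
-- started; ΣI: it has started but not met the old row; ΣJ: it has met the old row;
-- ΣE: it has ended.  The Boolean is the cell of the old row in the previous column.

ΣE ΣJ ΣP : Bool → List St → (List St → Kf) → Kf
ΣI : List St → (List St → Kf) → Kf

ΣE o [] G = corner o false false false (G [])
ΣE o (s ∷ st) G = corner o false (on s) false (ΣE (on s) st (G ∘ (clr s ∷_)))

ΣJ o [] G = corner o true false false (G [])
ΣJ o (s0 ∷ st) G = corner o true false false (ΣE false st (G ∘ (s0 ∷_)))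
                   ⊞ corner o true false true (ΣJ false st (G ∘ (s1 ∷_)))
ΣJ o (s1 ∷ st) G = corner o true true false (ΣE true st (G ∘ (s2 ∷_)))
                   ⊞ corner o true true true (ΣJ true st (G ∘ (s1 ∷_)))
ΣJ o (s2 ∷ st) G = corner o true false false (ΣE false st (G ∘ (s2 ∷_)))

ΣI [] G = 0k
-- No corner factor arises in this phase: the new row fills both neighbouring columns, so each
-- vertex between them touches at least two cells.
ΣI (s0 ∷ st) G = ΣI st (G ∘ (s1 ∷_))
ΣI (s1 ∷ st) G = ΣJ true st (G ∘ (s1 ∷_))
ΣI (s2 ∷ st) G = 0k

ΣP o [] G = 0k
ΣP o (s0 ∷ st) G = corner o false false false (ΣP false st (G ∘ (s0 ∷_)))
                   ⊞ corner o false false true (ΣI st (G ∘ (s1 ∷_)))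
ΣP o (s1 ∷ st) G = corner o false true false (ΣP true st (G ∘ (s2 ∷_)))
                   ⊞ corner o false true true (ΣJ true st (G ∘ (s1 ∷_)))
ΣP o (s2 ∷ st) G = corner o false false false (ΣP false st (G ∘ (s2 ∷_)))

reached : List St → Bool
reached [] = true
reached (s0 ∷ st) = false
reached (s1 ∷ st) = reached st
reached (s2 ∷ st) = reached st

δ₀ : Kf
δ₀ zero = 1ℤ
δ₀ (suc k) = 0ℤ

-- Counts only the vertices between consecutive rows; those below the lowest and above the highest
-- row make up the factor q⁴. At the end every column must have been reached.
completions : ℕ → List St → Kf
completions zero st = if reached st then δ₀ else 0k
completions (suc h) st = ΣP false st (completions h)

ΣE-cong : ∀ {G H : List St → Kf} → (∀ st → G st ≃ H st) → ∀ o st → ΣE o st G ≃ ΣE o st H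
ΣJ-cong : ∀ {G H : List St → Kf} → (∀ st → G st ≃ H st) → ∀ o st → ΣJ o st G ≃ ΣJ o st H
ΣI-cong : ∀ {G H : List St → Kf} → (∀ st → G st ≃ H st) → ∀ st → ΣI st G ≃ ΣI st H
ΣP-cong : ∀ {G H : List St → Kf} → (∀ st → G st ≃ H st) → ∀ o st → ΣP o st G ≃ ΣP o st H

ΣE-cong eq o [] = corner-cong o false false false (eq [])
ΣE-cong eq o (s ∷ st) = corner-cong o false (on s) false (ΣE-cong (eq ∘ (clr s ∷_)) (on s) st)

ΣJ-cong eq o [] = corner-cong o true false false (eq [])
ΣJ-cong eq o (s0 ∷ st) = ⊞-cong (corner-cong o true false false (ΣE-cong (eq ∘ (s0 ∷_)) false st))
  (corner-cong o true false true (ΣJ-cong (eq ∘ (s1 ∷_)) false st))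
ΣJ-cong eq o (s1 ∷ st) = ⊞-cong (corner-cong o true true false (ΣE-cong (eq ∘ (s2 ∷_)) true st))
  (corner-cong o true true true (ΣJ-cong (eq ∘ (s1 ∷_)) true st))
ΣJ-cong eq o (s2 ∷ st) = corner-cong o true false false (ΣE-cong (eq ∘ (s2 ∷_)) false st)

ΣI-cong eq [] k = refl
ΣI-cong eq (s0 ∷ st) = ΣI-cong (eq ∘ (s1 ∷_)) st
ΣI-cong eq (s1 ∷ st) = ΣJ-cong (eq ∘ (s1 ∷_)) true st
ΣI-cong eq (s2 ∷ st) k = refl

ΣP-cong eq o [] k = refl
ΣP-cong eq o (s0 ∷ st) = ⊞-cong (corner-cong o false false false (ΣP-cong (eq ∘ (s0 ∷_)) false st))
  (corner-cong o false false true (ΣI-cong (eq ∘ (s1 ∷_)) st))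
ΣP-cong eq o (s1 ∷ st) = ⊞-cong (corner-cong o false true false (ΣP-cong (eq ∘ (s2 ∷_)) true st))
  (corner-cong o false true true (ΣJ-cong (eq ∘ (s1 ∷_)) true st))
ΣP-cong eq o (s2 ∷ st) = corner-cong o false false false (ΣP-cong (eq ∘ (s2 ∷_)) false st)

ΣE-0 : ∀ {G} → (∀ st → G st ≃ 0k) → ∀ o st → ΣE o st G ≃ 0k
ΣE-0 eq o [] = corner-0 o false false false (eq [])
ΣE-0 eq o (s ∷ st) = corner-0 o false (on s) false (ΣE-0 (eq ∘ (clr s ∷_)) (on s) st)

ΣJ-0 : ∀ {G} → (∀ st → G st ≃ 0k) → ∀ o st → ΣJ o st G ≃ 0k
ΣJ-0 eq o [] = corner-0 o true false false (eq [])
ΣJ-0 eq o (s0 ∷ st) = ⊞-0 (corner-0 o true false false (ΣE-0 (eq ∘ (s0 ∷_)) false st))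
  (corner-0 o true false true (ΣJ-0 (eq ∘ (s1 ∷_)) false st))
ΣJ-0 eq o (s1 ∷ st) = ⊞-0 (corner-0 o true true false (ΣE-0 (eq ∘ (s2 ∷_)) true st))
  (corner-0 o true true true (ΣJ-0 (eq ∘ (s1 ∷_)) true st))
ΣJ-0 eq o (s2 ∷ st) = corner-0 o true false false (ΣE-0 (eq ∘ (s2 ∷_)) false st)

ΣI-0 : ∀ {G} → (∀ st → G st ≃ 0k) → ∀ st → ΣI st G ≃ 0k
ΣI-0 eq [] k = refl
ΣI-0 eq (s0 ∷ st) = ΣI-0 (eq ∘ (s1 ∷_)) st
ΣI-0 eq (s1 ∷ st) = ΣJ-0 (eq ∘ (s1 ∷_)) true st
ΣI-0 eq (s2 ∷ st) k = refl

ΣP-0 : ∀ {G} → (∀ st → G st ≃ 0k) → ∀ o st → ΣP o st G ≃ 0k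
ΣP-0 eq o [] k = refl
ΣP-0 eq o (s0 ∷ st) = ⊞-0 (corner-0 o false false false (ΣP-0 (eq ∘ (s0 ∷_)) false st))
  (corner-0 o false false true (ΣI-0 (eq ∘ (s1 ∷_)) st))
ΣP-0 eq o (s1 ∷ st) = ⊞-0 (corner-0 o false true false (ΣP-0 (eq ∘ (s2 ∷_)) true st))
  (corner-0 o false true true (ΣJ-0 (eq ∘ (s1 ∷_)) true st))
ΣP-0 eq o (s2 ∷ st) = corner-0 o false false false (ΣP-0 (eq ∘ (s2 ∷_)) false st)

rep : {A : Set} → ℕ → A → List A → List A
rep zero x l = l
rep (suc n) x l = x ∷ rep n x l

rep-∷ : ∀ {A : Set} n (x : A) l → rep n x (x ∷ l) ≡ x ∷ rep n x l
rep-∷ zero x l = refl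
rep-∷ (suc n) x l = cong (x ∷_) (rep-∷ n x l)

rep-+ : ∀ {A : Set} m n (x : A) l → rep m x (rep n x l) ≡ rep (m ℕ.+ n) x l
rep-+ zero n x l = refl
rep-+ (suc m) n x l = cong (x ∷_) (rep-+ m n x l)

rep-++ : ∀ {A : Set} n (x : A) l l′ → rep n x l ++ l′ ≡ rep n x (l ++ l′)
rep-++ zero x l l′ = refl
rep-++ (suc n) x l l′ = cong (x ∷_) (rep-++ n x l l′)

0s : ℕ → List St
0s d = rep d s0 []

-- Abandoned columns at a margin stay empty and create no vertices. Trimming them on both sides,
-- together with the blocking lemmas, reduces the states to unreached, occupied, unreached blocks.
completions-2∷ : ∀ h st → completions h (s2 ∷ st) ≃ completions h st
completions-2∷ zero st k = refl
completions-2∷ (suc h) st = ΣP-cong (completions-2∷ h) false st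

module _ where
  private
    τ : List St
    τ = s2 ∷ []

  ΣE-∷ʳ2 : ∀ o st G → ΣE o (st ++ τ) G ≃ ΣE o st (λ st → G (st ++ τ))
  ΣE-∷ʳ2 o [] G k = refl
  ΣE-∷ʳ2 o (s ∷ st) G = corner-cong o false (on s) false (ΣE-∷ʳ2 (on s) st (G ∘ (clr s ∷_)))

  ΣJ-∷ʳ2 : ∀ o st G → ΣJ o (st ++ τ) G ≃ ΣJ o st (λ st → G (st ++ τ))
  ΣJ-∷ʳ2 o [] G k = refl
  ΣJ-∷ʳ2 o (s0 ∷ st) G = ⊞-cong (corner-cong o true false false (ΣE-∷ʳ2 false st (G ∘ (s0 ∷_))))
    (corner-cong o true false true (ΣJ-∷ʳ2 false st (G ∘ (s1 ∷_))))
  ΣJ-∷ʳ2 o (s1 ∷ st) G = ⊞-cong (corner-cong o true true false (ΣE-∷ʳ2 true st (G ∘ (s2 ∷_))))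
    (corner-cong o true true true (ΣJ-∷ʳ2 true st (G ∘ (s1 ∷_))))
  ΣJ-∷ʳ2 o (s2 ∷ st) G = corner-cong o true false false (ΣE-∷ʳ2 false st (G ∘ (s2 ∷_)))

  ΣI-∷ʳ2 : ∀ st G → ΣI (st ++ τ) G ≃ ΣI st (λ st → G (st ++ τ))
  ΣI-∷ʳ2 [] G k = refl
  ΣI-∷ʳ2 (s0 ∷ st) G = ΣI-∷ʳ2 st (G ∘ (s1 ∷_))
  ΣI-∷ʳ2 (s1 ∷ st) G = ΣJ-∷ʳ2 true st (G ∘ (s1 ∷_))
  ΣI-∷ʳ2 (s2 ∷ st) G k = refl

  ΣP-∷ʳ2 : ∀ o st G → ΣP o (st ++ τ) G ≃ ΣP o st (λ st → G (st ++ τ))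
  ΣP-∷ʳ2 o [] G = corner-0 o false false false (λ _ → refl)
  ΣP-∷ʳ2 o (s0 ∷ st) G = ⊞-cong (corner-cong o false false false (ΣP-∷ʳ2 false st (G ∘ (s0 ∷_))))
    (corner-cong o false false true (ΣI-∷ʳ2 st (G ∘ (s1 ∷_))))
  ΣP-∷ʳ2 o (s1 ∷ st) G = ⊞-cong (corner-cong o false true false (ΣP-∷ʳ2 true st (G ∘ (s2 ∷_))))
    (corner-cong o false true true (ΣJ-∷ʳ2 true st (G ∘ (s1 ∷_))))
  ΣP-∷ʳ2 o (s2 ∷ st) G = corner-cong o false false false (ΣP-∷ʳ2 false st (G ∘ (s2 ∷_)))

reached-∷ʳ2 : ∀ st → reached (st ++ s2 ∷ []) ≡ reached st
reached-∷ʳ2 [] = refl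
reached-∷ʳ2 (s0 ∷ st) = refl
reached-∷ʳ2 (s1 ∷ st) = reached-∷ʳ2 st
reached-∷ʳ2 (s2 ∷ st) = reached-∷ʳ2 st

completions-∷ʳ2 : ∀ h st → completions h (st ++ s2 ∷ []) ≃ completions h st
completions-∷ʳ2 zero st k rewrite reached-∷ʳ2 st = refl
completions-∷ʳ2 (suc h) st = ≃-trans (ΣP-∷ʳ2 false st (completions h)) (ΣP-cong (completions-∷ʳ2 h) false st)

-- Once a left column separates an unreached column from the current row, the
-- unreached column stays empty.

ΣI-blockedˡ : ∀ a st G → ΣI (rep a s0 (s2 ∷ st)) G ≃ 0k
ΣI-blockedˡ zero st G k = refl
ΣI-blockedˡ (suc a) st G = ΣI-blockedˡ a st (G ∘ (s1 ∷_))

ΣP-blockedˡ : ∀ a st G → (∀ st → G (rep a s0 (s2 ∷ st)) ≃ 0k) → ΣP false (rep a s0 (s2 ∷ st)) G ≃ 0k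
ΣP-blockedˡ zero st G eq = ΣP-0 eq false st
ΣP-blockedˡ (suc a) st G eq =
  ⊞-0 (ΣP-blockedˡ a st (G ∘ (s0 ∷_)) eq) (qs-0 (ΣI-blockedˡ a st (G ∘ (s1 ∷_))))

completions-blockedˡ : ∀ h a st → completions h (s0 ∷ rep a s0 (s2 ∷ st)) ≃ 0k
completions-blockedˡ zero a st k = refl
completions-blockedˡ (suc h) a st = ΣP-blockedˡ (suc a) st (completions h) (completions-blockedˡ h a)

ΣE-0s : ∀ d G → ΣE false (0s d) G ≃ G (0s d)
ΣE-0s zero G k = refl
ΣE-0s (suc d) G = ΣE-0s d (G ∘ (s0 ∷_))

ΣI-0s : ∀ d G → ΣI (0s d) G ≃ 0k
ΣI-0s zero G k = refl
ΣI-0s (suc d) G = ΣI-0s d (G ∘ (s1 ∷_))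

ΣP-0s : ∀ o d G → ΣP o (0s d) G ≃ 0k
ΣP-0s o zero G k = refl
ΣP-0s o (suc d) G = ⊞-0 (corner-0 o false false false (ΣP-0s false d (G ∘ (s0 ∷_))))
  (corner-0 o false false true (ΣI-0s d (G ∘ (s1 ∷_))))

module _ (d : ℕ) where
  private
    τ : List St
    τ = s2 ∷ 0s (suc d)

  ΣE-blockedʳ : ∀ {G} → (∀ st → G (st ++ τ) ≃ 0k) → ∀ o st → ΣE o (st ++ τ) G ≃ 0k
  ΣE-blockedʳ eq o [] = corner-0 o false false false (≃-trans (ΣE-0s d _) (eq []))
  ΣE-blockedʳ eq o (s ∷ st) =
    corner-0 o false (on s) false (ΣE-blockedʳ (eq ∘ (clr s ∷_)) (on s) st)

  ΣJ-blockedʳ : ∀ {G} → (∀ st → G (st ++ τ) ≃ 0k) → ∀ o st → ΣJ o (st ++ τ) G ≃ 0k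
  ΣJ-blockedʳ eq o [] = corner-0 o true false false (≃-trans (ΣE-0s d _) (eq []))
  ΣJ-blockedʳ eq o (s0 ∷ st) = ⊞-0 (corner-0 o true false false (ΣE-blockedʳ (eq ∘ (s0 ∷_)) false st))
    (corner-0 o true false true (ΣJ-blockedʳ (eq ∘ (s1 ∷_)) false st))
  ΣJ-blockedʳ eq o (s1 ∷ st) = ⊞-0 (corner-0 o true true false (ΣE-blockedʳ (eq ∘ (s2 ∷_)) true st))
    (corner-0 o true true true (ΣJ-blockedʳ (eq ∘ (s1 ∷_)) true st))
  ΣJ-blockedʳ eq o (s2 ∷ st) = corner-0 o true false false (ΣE-blockedʳ (eq ∘ (s2 ∷_)) false st)

  ΣI-blockedʳ : ∀ {G} → (∀ st → G (st ++ τ) ≃ 0k) → ∀ st → ΣI (st ++ τ) G ≃ 0k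
  ΣI-blockedʳ eq [] k = refl
  ΣI-blockedʳ eq (s0 ∷ st) = ΣI-blockedʳ (eq ∘ (s1 ∷_)) st
  ΣI-blockedʳ eq (s1 ∷ st) = ΣJ-blockedʳ (eq ∘ (s1 ∷_)) true st
  ΣI-blockedʳ eq (s2 ∷ st) k = refl

  ΣP-blockedʳ : ∀ {G} → (∀ st → G (st ++ τ) ≃ 0k) → ∀ o st → ΣP o (st ++ τ) G ≃ 0k
  ΣP-blockedʳ {G} eq o [] = corner-0 o false false false (ΣP-0s false (suc d) (G ∘ (s2 ∷_)))
  ΣP-blockedʳ eq o (s0 ∷ st) = ⊞-0 (corner-0 o false false false (ΣP-blockedʳ (eq ∘ (s0 ∷_)) false st))
    (corner-0 o false false true (ΣI-blockedʳ (eq ∘ (s1 ∷_)) st))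
  ΣP-blockedʳ eq o (s1 ∷ st) = ⊞-0 (corner-0 o false true false (ΣP-blockedʳ (eq ∘ (s2 ∷_)) true st))
    (corner-0 o false true true (ΣJ-blockedʳ (eq ∘ (s1 ∷_)) true st))
  ΣP-blockedʳ eq o (s2 ∷ st) = corner-0 o false false false (ΣP-blockedʳ (eq ∘ (s2 ∷_)) false st)

  reached-blockedʳ : ∀ st → reached (st ++ τ) ≡ false
  reached-blockedʳ [] = refl
  reached-blockedʳ (s0 ∷ st) = refl
  reached-blockedʳ (s1 ∷ st) = reached-blockedʳ st
  reached-blockedʳ (s2 ∷ st) = reached-blockedʳ st

  completions-blockedʳ : ∀ h st → completions h (st ++ τ) ≃ 0k
  completions-blockedʳ zero st k rewrite reached-blockedʳ st = refl
  completions-blockedʳ (suc h) st = ΣP-blockedʳ (completions-blockedʳ h) false st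

-- One further row as an operator

≡⇒≃ : ∀ {f g : Kf} → f ≡ g → f ≃ g
≡⇒≃ refl k = refl

msum-0 : ∀ {f} → (∀ n → f n ≃ 0k) → ∀ n → msum f n ≃ 0k
msum-0 eq zero k = refl
msum-0 eq (suc n) = ⊞-0 (msum-0 eq n) (qs-0 (eq n))

msum-⊞ : ∀ f g n → msum (λ n → f n ⊞ g n) n ≃ msum f n ⊞ msum g n
msum-⊞ f g zero k = refl
msum-⊞ f g (suc n) = ≃-trans (⊞-cong (msum-⊞ f g n) (qs-⊞ (f n) (g n)))
  (⊞-swap (msum f n) (msum g n) (qs (f n)) (qs (g n)))

msum-front : ∀ f n → msum f (suc n) ≃ qs (f 0) ⊞ msum (f ∘ suc) n
msum-front f zero k = ℤP.+-comm 0ℤ (qs (f 0) k)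
msum-front f (suc n) k = ≡.trans (cong (ℤ._+ qs (f (suc n)) k) (msum-front f n k))
  (ℤP.+-assoc (qs (f 0) k) (msum (f ∘ suc) n k) (qs (f (suc n)) k))

infixl 6 _⊞ˡ_
_⊞ˡ_ : Layer → Layer → Layer
(V ⊞ˡ W) n i = V n i ⊞ W n i

Nˡ-⊞ : ∀ V W → Nˡ (V ⊞ˡ W) ≗ Nˡ V ⊞ˡ Nˡ W
Nˡ-⊞ V W n zero k = refl
Nˡ-⊞ V W n (suc i) = ≃-trans (⊞-cong {(V ⊞ˡ W) n (suc i)} (λ _ → refl) (Nˡ-⊞ V W (suc n) i))
  (⊞-swap (V n (suc i)) (W n (suc i)) (Nˡ V (suc n) i) (Nˡ W (suc n) i))

Rˡ-⊞ : ∀ V W → Rˡ (V ⊞ˡ W) ≗ Rˡ V ⊞ˡ Rˡ W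
Rˡ-⊞ V W n zero k = refl
Rˡ-⊞ V W n (suc i) = ≃-trans
  (⊞-cong {(V ⊞ˡ W) n (suc i)} (λ _ → refl)
    (≃-trans (qs-cong (Nˡ-⊞ V W (suc n) i)) (qs-⊞ (Nˡ V (suc n) i) (Nˡ W (suc n) i))))
  (⊞-swap (V n (suc i)) (W n (suc i)) (qs (Nˡ V (suc n) i)) (qs (Nˡ W (suc n) i)))

Mˡ-⊞ : ∀ V W → Mˡ (V ⊞ˡ W) ≗ Mˡ V ⊞ˡ Mˡ W
Mˡ-⊞ V W n i = msum-⊞ (λ m → V m i) (λ m → W m i) n

Tˡ-⊞ : ∀ V W → Tˡ (V ⊞ˡ W) ≗ Tˡ V ⊞ˡ Tˡ W
Tˡ-⊞ V W n i = ≃-trans (⊞-cong {(V ⊞ˡ W) n i} (λ _ → refl) (Mˡ-⊞ V W n i))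
  (⊞-swap (V n i) (W n i) (Mˡ V n i) (Mˡ W n i))

0ˡ : Layer
0ˡ n i = 0k

Nˡ-0 : ∀ {V} → V ≗ 0ˡ → Nˡ V ≗ 0ˡ
Nˡ-0 eq n zero = eq n zero
Nˡ-0 eq n (suc i) = ⊞-0 (eq n (suc i)) (Nˡ-0 eq (suc n) i)

Rˡ-0 : ∀ {V} → V ≗ 0ˡ → Rˡ V ≗ 0ˡ
Rˡ-0 eq n zero = eq n zero
Rˡ-0 eq n (suc i) = ⊞-0 (eq n (suc i)) (qs-0 (Nˡ-0 eq (suc n) i))

Mˡ-0 : ∀ {V} → V ≗ 0ˡ → Mˡ V ≗ 0ˡ
Mˡ-0 eq n i = msum-0 (λ m → eq m i) n

Tˡ-0 : ∀ {V} → V ≗ 0ˡ → Tˡ V ≗ 0ˡ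
Tˡ-0 eq n i = ⊞-0 (eq n i) (Mˡ-0 eq n i)

Tˡ-column : ∀ V W i → (∀ n → V n i ≃ W n i) → ∀ n → Tˡ V n i ≃ Tˡ W n i
Tˡ-column V W i eq n = ⊞-cong (eq n) (msum-cong eq n)

Rˡ-shiftˡ : ∀ m V n i → Rˡ (λ u → V (m ℕ.+ u)) n i ≃ Rˡ V (m ℕ.+ n) i
Rˡ-shiftˡ zero V n i k = refl
Rˡ-shiftˡ (suc m) V n i = ≃-trans (Rˡ-shiftˡ m (V ∘ suc) n i) (Rˡ-shift V (m ℕ.+ n) i)

Nˡ-shiftʳ : ∀ m V n i → Nˡ (λ u → V (u ℕ.+ m)) n i ≃ Nˡ V (n ℕ.+ m) i
Nˡ-shiftʳ m V n zero k = refl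
Nˡ-shiftʳ m V n (suc i) = ⊞-cong {V (n ℕ.+ m) (suc i)} (λ _ → refl) (Nˡ-shiftʳ m V (suc n) i)

Rˡ-shiftʳ : ∀ m V n i → Rˡ (λ u → V (u ℕ.+ m)) n i ≃ Rˡ V (n ℕ.+ m) i
Rˡ-shiftʳ m V n zero k = refl
Rˡ-shiftʳ m V n (suc i) = ⊞-cong {V (n ℕ.+ m) (suc i)} (λ _ → refl) (qs-cong (Nˡ-shiftʳ m V (suc n) i))

Nˡ-back : ∀ V n i → Nˡ V n (suc i) ≃ Nˡ (λ n i → V n (suc i)) n i ⊞ V (n ℕ.+ suc i) 0
Nˡ-back V n zero k = cong (λ m → V n 1 k ℤ.+ V m 0 k) (≡.sym (ℕP.+-comm n 1))
Nˡ-back V n (suc i) k = ≡.trans (cong (ℤ._+_ (V n (suc (suc i)) k)) (Nˡ-back V (suc n) i k))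
  (≡.trans (≡.sym (ℤP.+-assoc (V n (suc (suc i)) k) (Nˡ (λ n i → V n (suc i)) (suc n) i k)
      (V (suc n ℕ.+ suc i) 0 k)))
    (cong (λ m → V n (suc (suc i)) k ℤ.+ Nˡ (λ n i → V n (suc i)) (suc n) i k ℤ.+ V m 0 k)
      (≡.sym (ℕP.+-suc n (suc i)))))

Nˡ-qs : ∀ V n i → Nˡ (λ n i → qs (V n i)) n i ≃ qs (Nˡ V n i)
Nˡ-qs V n zero k = refl
Nˡ-qs V n (suc i) = ≃-trans (⊞-cong {qs (V n (suc i))} (λ _ → refl) (Nˡ-qs V (suc n) i))
  (≃-sym (qs-⊞ (V n (suc i)) (Nˡ V (suc n) i)))

Rˡ-qs : ∀ V n i → Rˡ (λ n i → qs (V n i)) n i ≃ qs (Rˡ V n i)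
Rˡ-qs V n zero k = refl
Rˡ-qs V n (suc i) = ≃-trans (⊞-cong {qs (V n (suc i))} (λ _ → refl) (qs-cong (Nˡ-qs V (suc n) i)))
  (≃-sym (qs-⊞ (V n (suc i)) (qs (Nˡ V (suc n) i))))

Rˡ-msum : ∀ (f : Layer) n i → Rˡ (λ m i → msum (λ u → f (m ℕ.+ u) i) n) 0 i ≃ Mˡ (Rˡ f) n i
Rˡ-msum f zero i = Rˡ-0 (λ _ _ _ → refl) 0 i
Rˡ-msum f (suc n) i = ≃-trans
  (Rˡ-⊞ (λ m i → msum (λ u → f (m ℕ.+ u) i) n) (λ m i → qs (f (m ℕ.+ n) i)) 0 i)
  (⊞-cong (Rˡ-msum f n i) (≃-trans (Rˡ-qs (λ m i → f (m ℕ.+ n) i) 0 i) (qs-cong (Rˡ-shiftʳ n f 0 i))))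

at0 : ℕ → Kf → Kf
at0 zero f = f
at0 (suc _) f = 0k

-- The new right end: it may move inwards only when no column is unreached to the right.
Jˡ : Layer → Layer
Jˡ g n zero = Tˡ g n zero
Jˡ g n (suc d) = Rˡ g n (suc d)

Jˡ-split : ∀ g n d → Jˡ g n d ≃ Rˡ g n d ⊞ at0 d (Mˡ g n 0)
Jˡ-split g n zero k = refl
Jˡ-split g n (suc d) = ≃-sym (⊞-0ʳ (λ _ → refl))

-- The behaviour of `completions` at the right margin, isolated because it survives prefixing a
-- state: inductions along a row replace `G` by `G ∘ (s ∷_)`.
record Prunes (G : List St → Kf) : Set where
  field
    trim : ∀ st → G (st ++ s2 ∷ []) ≃ G st
    blocked : ∀ d st → G (st ++ s2 ∷ 0s (suc d)) ≃ 0k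

open Prunes

completions-prunes : ∀ h → Prunes (completions h)
completions-prunes h .trim = completions-∷ʳ2 h
completions-prunes h .blocked d = completions-blockedʳ d h

∷-prunes : ∀ {G} s → Prunes G → Prunes (G ∘ (s ∷_))
∷-prunes s p .trim st = p .trim (s ∷ st)
∷-prunes s p .blocked d st = p .blocked d (s ∷ st)

rep-prunes : ∀ {G} n s → Prunes G → Prunes (G ∘ rep n s)
rep-prunes {G} n s p .trim st =
  ≃-trans (≡⇒≃ (cong G (≡.sym (rep-++ n s st (s2 ∷ []))))) (p .trim (rep n s st))
rep-prunes {G} n s p .blocked d st =
  ≃-trans (≡⇒≃ (cong G (≡.sym (rep-++ n s st (s2 ∷ 0s (suc d)))))) (p .blocked d (rep n s st))

ones : (List St → Kf) → Layer
ones G m d = G (rep m s1 (0s d))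

-- Beyond the old right end the new row may stop after any number of columns, which is N; its own
-- end is the one vertex of degree 2.
ΣJ-false-0s : ∀ d G → ΣJ false (0s d) G ≃ qs (Nˡ (ones G) 0 d)
ΣJ-false-0s zero G k = refl
ΣJ-false-0s (suc d) G = ≃-trans
  (⊞-cong (qs-cong (ΣE-0s d (G ∘ (s0 ∷_))))
    (≃-trans (ΣJ-false-0s d (G ∘ (s1 ∷_))) (qs-cong (Nˡ-shift (ones G) 0 d))))
  (≃-sym (qs-⊞ (ones G 0 (suc d)) (Nˡ (ones G) 1 d)))

ΣJ-true-0s : ∀ d G → ΣJ true (0s d) G ≃ Rˡ (ones G) 0 d
ΣJ-true-0s zero G k = refl
ΣJ-true-0s (suc d) G = ⊞-cong (ΣE-0s d (G ∘ (s0 ∷_)))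
  (≃-trans (ΣJ-false-0s d (G ∘ (s1 ∷_))) (qs-cong (Nˡ-shift (ones G) 0 d)))

-- After a move inwards the single vertex of degree 2 lies at the end of the old row.
ΣE-true : ∀ n d G → ΣE true (rep n s1 (0s d)) G ≃ qs (G (rep n s2 (0s d)))
ΣE-true zero zero G k = refl
ΣE-true zero (suc d) G = qs-cong (ΣE-0s d (G ∘ (s0 ∷_)))
ΣE-true (suc n) d G = ΣE-true n d (G ∘ (s2 ∷_))

2s-snoc : ∀ n st → rep (suc n) s2 st ≡ rep n s2 [] ++ s2 ∷ st
2s-snoc n st = ≡.trans (≡.sym (rep-∷ n s2 st)) (≡.sym (rep-++ n s2 [] (s2 ∷ st)))

drop-2s : ∀ {G} → Prunes G → ∀ n → G (rep n s2 []) ≃ G []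
drop-2s p zero k = refl
drop-2s {G} p (suc n) = ≃-trans (≡⇒≃ (cong G (2s-snoc n [])))
  (≃-trans (p .trim (rep n s2 [])) (drop-2s p n))

-- At each occupied column the row either stops, which is one summand of M, or goes on. With an
-- unreached column on the right, stopping leaves an abandoned column in between and counts zero, so
-- only R remains.
ΣJ-1s : ∀ {G} → Prunes G → ∀ n d → ΣJ true (rep n s1 (0s d)) G ≃ Jˡ (ones G) n d
ΣJ-1s {G} p zero zero = ≃-trans (ΣJ-true-0s zero G) (≃-sym (⊞-0ʳ (λ _ → refl)))
ΣJ-1s {G} p zero (suc d) = ΣJ-true-0s (suc d) G
ΣJ-1s {G} p (suc n) zero k = begin
  ΣE true (rep n s1 []) (G ∘ (s2 ∷_)) k ℤ.+ ΣJ true (rep n s1 []) (G ∘ (s1 ∷_)) k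
    ≡⟨ cong₂ ℤ._+_ (≃-trans (ΣE-true n 0 (G ∘ (s2 ∷_))) (qs-cong (drop-2s p (suc n))) k)
         (ΣJ-1s (∷-prunes s1 p) n 0 k) ⟩
  qs (g 0 0) k ℤ.+ (g (suc n) 0 k ℤ.+ msum (λ m → g (suc m) 0) n k)
    ≡⟨ ℤP.+-assoc (qs (g 0 0) k) (g (suc n) 0 k) (msum (λ m → g (suc m) 0) n k) ⟨
  qs (g 0 0) k ℤ.+ g (suc n) 0 k ℤ.+ msum (λ m → g (suc m) 0) n k
    ≡⟨ cong (ℤ._+ msum (λ m → g (suc m) 0) n k) (ℤP.+-comm (qs (g 0 0) k) (g (suc n) 0 k)) ⟩
  g (suc n) 0 k ℤ.+ qs (g 0 0) k ℤ.+ msum (λ m → g (suc m) 0) n k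
    ≡⟨ ℤP.+-assoc (g (suc n) 0 k) (qs (g 0 0) k) (msum (λ m → g (suc m) 0) n k) ⟩
  g (suc n) 0 k ℤ.+ (qs (g 0 0) k ℤ.+ msum (λ m → g (suc m) 0) n k)
    ≡⟨ cong (ℤ._+_ (g (suc n) 0 k)) (msum-front (λ m → g m 0) n k) ⟨
  Tˡ g (suc n) 0 k ∎
  where
  open ≡.≡-Reasoning
  g : Layer
  g = ones G
ΣJ-1s {G} p (suc n) (suc d) = ≃-trans
  (⊞-0ˡ (≃-trans (ΣE-true n (suc d) (G ∘ (s2 ∷_))) (qs-0
    (≃-trans (≡⇒≃ (cong G (2s-snoc n (0s (suc d))))) (p .blocked d (rep n s2 []))))))
  (≃-trans (ΣJ-1s (∷-prunes s1 p) n (suc d)) (Rˡ-shift (ones G) n (suc d)))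

-- The left end moves inwards. The outer `qs` is the vertex at the old left end; the new left end
-- inside the old row touches three cells.
ΣP-true-1s : ∀ {G} → Prunes G → (∀ st → G (s2 ∷ st) ≃ G st) → ∀ n d →
             qs (ΣP true (rep n s1 (0s d)) G) ≃ Mˡ (Jˡ (ones (G ∘ (s1 ∷_)))) n d
ΣP-true-1s {G} p eq zero d = qs-0 (ΣP-0s true d G)
ΣP-true-1s {G} p eq (suc n) d = ≃-trans (qs-⊞ _ _) (⊞-cong
  (≃-trans (qs-cong (ΣP-cong eq true (rep n s1 (0s d)))) (ΣP-true-1s p eq n d))
  (qs-cong (ΣJ-1s (∷-prunes s1 p) n d)))

-- `a` columns unreached on the left, a row of n + 1 cells, `d` columns unreached on the right.
C : ℕ → ℕ → Layer
C h a n d = completions h (rep a s0 (rep (suc n) s1 (0s d)))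

C-reach : ∀ h n d → C (suc h) 0 n d ≃ Tˡ (Jˡ (C h 0)) n d
C-reach h n d k = ≡.trans
  (cong₂ ℤ._+_
    (≃-trans (qs-cong (ΣP-cong (completions-2∷ h) true (rep n s1 (0s d))))
      (ΣP-true-1s (completions-prunes h) (completions-2∷ h) n d) k)
    (ΣJ-1s (∷-prunes s1 (completions-prunes h)) n d k))
  (ℤP.+-comm (Mˡ (Jˡ (C h 0)) n d k) (Jˡ (C h 0) n d k))

module _ (h n d : ℕ) where
  private
    Z : List St
    Z = rep (suc n) s1 (0s d)

    -- The left end has just moved outwards by `m` columns, or stayed if `m` is 0, with `a` columns
    -- still unreached there; the right end is still to be chosen.
    X′ : ℕ → ℕ → Kf
    X′ a m = Jˡ (λ u → C h a (m ℕ.+ u)) n d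

    Jˡ-cong : ∀ {V W} → V ≗ W → Jˡ V ≗ Jˡ W
    Jˡ-cong eq n zero = Tˡ-cong eq n zero
    Jˡ-cong eq n (suc d) = Rˡ-cong eq n (suc d)

    ΣI-0s-1s : ∀ a G → ΣI (rep a s0 Z) G ≃ ΣJ true (rep n s1 (0s d)) (G ∘ rep (suc a) s1)
    ΣI-0s-1s zero G k = refl
    ΣI-0s-1s (suc a) G = ΣI-0s-1s a (G ∘ (s1 ∷_))

    expand : ∀ p a → ΣI (rep a s0 Z) (completions h ∘ rep p s0 ∘ (s1 ∷_)) ≃ X′ p (suc a)
    expand p a = ≃-trans (ΣI-0s-1s a (completions h ∘ rep p s0 ∘ (s1 ∷_)))
      (≃-trans (ΣJ-1s (rep-prunes (suc a) s1 (∷-prunes s1 (rep-prunes p s0 (completions-prunes h)))) n d)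
      (Jˡ-cong (λ u e → ≡⇒≃ (cong (completions h ∘ rep p s0 ∘ (s1 ∷_)) (rep-+ (suc a) u s1 (0s e)))) n d))

    -- `p` counts the unreached columns already passed over. Starting strictly inside the old row is
    -- blocked by them, so the left end stays or moves outwards, the latter with one factor q.
    ΣP-0s-1s : ∀ p a → ΣP false (rep (suc a) s0 Z) (completions h ∘ rep p s0) ≃
               X′ (suc a ℕ.+ p) 0 ⊞ qs (Nˡ (λ m b → X′ (b ℕ.+ p) m) 1 a)
    ΣP-0s-1s p zero = ⊞-cong (≃-trans
      (⊞-0ˡ (qs-0 (ΣP-0 (λ st →
        ≃-trans (≡⇒≃ (cong (completions h) (rep-∷ p s0 (s2 ∷ st)))) (completions-blockedˡ h p st))
        true (rep n s1 (0s d)))))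
      (≃-trans (ΣJ-1s (∷-prunes s1 (∷-prunes s0 (rep-prunes′ p))) n d)
        (Jˡ-cong (λ u e → ≡⇒≃ (cong (completions h) (rep-∷ p s0 (s1 ∷ rep u s1 (0s e))))) n d)))
      (qs-cong (expand p 0))
      where
      rep-prunes′ : ∀ p → Prunes (completions h ∘ rep p s0)
      rep-prunes′ p = rep-prunes p s0 (completions-prunes h)
    ΣP-0s-1s p (suc a) k = begin
      ΣP false (rep (suc a) s0 Z) (completions h ∘ rep p s0 ∘ (s0 ∷_)) k
        ℤ.+ qs (ΣI (rep (suc a) s0 Z) (completions h ∘ rep p s0 ∘ (s1 ∷_))) k
        ≡⟨ cong₂ ℤ._+_
             (≃-trans (ΣP-cong (λ st → ≡⇒≃ (cong (completions h) (rep-∷ p s0 st))) false (rep (suc a) s0 Z))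
               (ΣP-0s-1s (suc p) a) k)
             (qs-cong (expand p (suc a)) k) ⟩
      X′ (suc a ℕ.+ suc p) 0 k ℤ.+ qs (Nˡ (λ m b → X′ (b ℕ.+ suc p) m) 1 a) k ℤ.+ qs (X′ p (suc (suc a))) k
        ≡⟨ cong₂ (λ u v → u ℤ.+ v ℤ.+ qs (X′ p (suc (suc a))) k)
             (cong (λ b → X′ b 0 k) (ℕP.+-suc (suc a) p))
             (qs-cong (Nˡ-cong (λ m b k → cong (λ b → X′ b m k) (ℕP.+-suc b p)) 1 a) k) ⟩
      X′ (suc (suc a) ℕ.+ p) 0 k ℤ.+ qs (Nˡ (λ m b → X′ (suc b ℕ.+ p) m) 1 a) k ℤ.+ qs (X′ p (suc (suc a))) k
        ≡⟨ ℤP.+-assoc (X′ (suc (suc a) ℕ.+ p) 0 k) _ _ ⟩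
      X′ (suc (suc a) ℕ.+ p) 0 k ℤ.+ (qs (Nˡ (λ m b → X′ (suc b ℕ.+ p) m) 1 a) k ℤ.+ qs (X′ p (suc (suc a))) k)
        ≡⟨ cong (ℤ._+_ (X′ (suc (suc a) ℕ.+ p) 0 k))
             (≃-trans (qs-cong (Nˡ-back (λ m b → X′ (b ℕ.+ p) m) 1 a)) (qs-⊞ _ _) k) ⟨
      X′ (suc (suc a) ℕ.+ p) 0 k ℤ.+ qs (Nˡ (λ m b → X′ (b ℕ.+ p) m) 1 (suc a)) k ∎
      where open ≡.≡-Reasoning

    C-expand : ∀ a → C (suc h) a n d ≃ Rˡ (λ m b → X′ b m) 0 a ⊞ at0 a (Mˡ (Jˡ (C h 0)) n d)
    C-expand zero = C-reach h n d
    C-expand (suc a) = ≃-trans (ΣP-0s-1s 0 a) (≃-trans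
      (λ k → cong₂ ℤ._+_ (cong (λ b → X′ b 0 k) (ℕP.+-identityʳ (suc a)))
        (qs-cong (Nˡ-cong (λ m b k → cong (λ b → X′ b m k) (ℕP.+-identityʳ b)) 1 a) k))
      (≃-sym (⊞-0ʳ (λ _ → refl))))

  -- `a` and `d` act as exponents of separate variables for the two sides, so R is applied once in
  -- each. The `at0` terms are the inward moves, possible only on a side without unreached columns.
  C-suc : ∀ a → C (suc h) a n d ≃
    Rˡ (λ m b → Rˡ (C h b) m d) n a ⊞ at0 d (Mˡ (Rˡ (λ m b → C h b m 0)) n a)
      ⊞ at0 a (Mˡ (Jˡ (C h 0)) n d)
  C-suc a = ≃-trans (C-expand a) (⊞-cong (≃-trans
    (Rˡ-cong (λ m b → ≃-trans (Jˡ-split (λ u → C h b (m ℕ.+ u)) n d)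
      (⊞-cong (Rˡ-shiftˡ m (C h b) n d) (λ _ → refl))) 0 a)
    (≃-trans (Rˡ-⊞ (λ m b → Rˡ (C h b) (m ℕ.+ n) d)
        (λ m b → at0 d (Mˡ (λ u → C h b (m ℕ.+ u)) n 0)) 0 a)
      (⊞-cong (Rˡ-shiftʳ n (λ m b → Rˡ (C h b) m d) 0 a) (lemma d)))) (λ _ → refl))
    where
    lemma : ∀ d → Rˡ (λ m b → at0 d (Mˡ (λ u → C h b (m ℕ.+ u)) n 0)) 0 a ≃
                  at0 d (Mˡ (Rˡ (λ m b → C h b m 0)) n a)
    lemma zero = Rˡ-msum (λ m b → C h b m 0) n a
    lemma (suc d) = Rˡ-0 (λ _ _ _ → refl) 0 a

-- Merging the unreached columns of the two sides

⊞-congˡ : ∀ {f g h} → g ≃ h → f ⊞ g ≃ f ⊞ h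
⊞-congˡ {f} p k = cong (ℤ._+_ (f k)) (p k)

-- The sum over a + d = i: in terms of series, the variables of the two sides are both set to x.
diag : (ℕ → ℕ → Kf) → ℕ → Kf
diag f zero = f 0 0
diag f (suc i) = f 0 (suc i) ⊞ diag (f ∘ suc) i

diag-cong : ∀ {f g} → (∀ a d → f a d ≃ g a d) → ∀ i → diag f i ≃ diag g i
diag-cong eq zero = eq 0 0
diag-cong eq (suc i) = ⊞-cong (eq 0 (suc i)) (diag-cong (eq ∘ suc) i)

diag-⊞ : ∀ f g i → diag (λ a d → f a d ⊞ g a d) i ≃ diag f i ⊞ diag g i
diag-⊞ f g zero k = refl
diag-⊞ f g (suc i) = ≃-trans (⊞-congˡ {f 0 (suc i) ⊞ g 0 (suc i)} (diag-⊞ (f ∘ suc) (g ∘ suc) i))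
  (⊞-swap (f 0 (suc i)) (g 0 (suc i)) (diag (f ∘ suc) i) (diag (g ∘ suc) i))

diag-qs : ∀ f i → diag (λ a d → qs (f a d)) i ≃ qs (diag f i)
diag-qs f zero k = refl
diag-qs f (suc i) = ≃-trans (⊞-congˡ {qs (f 0 (suc i))} (diag-qs (f ∘ suc) i))
  (≃-sym (qs-⊞ (f 0 (suc i)) (diag (f ∘ suc) i)))

diag-0 : ∀ f → (∀ a d → f a d ≃ 0k) → ∀ i → diag f i ≃ 0k
diag-0 f eq zero = eq 0 0
diag-0 f eq (suc i) = ⊞-0 (eq 0 (suc i)) (diag-0 (f ∘ suc) (eq ∘ suc) i)

⊞-exchange : ∀ a b c → a ⊞ (b ⊞ c) ≃ b ⊞ (a ⊞ c)
⊞-exchange a b c k = ≡.trans (≡.sym (ℤP.+-assoc (a k) (b k) (c k)))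
  (≡.trans (cong (ℤ._+ c k) (ℤP.+-comm (a k) (b k))) (ℤP.+-assoc (b k) (a k) (c k)))

diag-back : ∀ f i → diag f (suc i) ≃ f (suc i) 0 ⊞ diag (λ a d → f a (suc d)) i
diag-back f zero k = ℤP.+-comm (f 0 1 k) (f 1 0 k)
diag-back f (suc i) = ≃-trans (⊞-congˡ {f 0 (suc (suc i))} (diag-back (f ∘ suc) i))
  (⊞-exchange (f 0 (suc (suc i))) (f (suc (suc i)) 0) (diag (λ a d → f (suc a) (suc d)) i))

diag-at0ᵈ : ∀ (f : ℕ → Kf) i → diag (λ a d → at0 d (f a)) i ≃ f i
diag-at0ᵈ f zero k = refl
diag-at0ᵈ f (suc i) = ≃-trans (⊞-0ˡ (λ _ → refl)) (diag-at0ᵈ (f ∘ suc) i)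

diag-at0ᵃ : ∀ (f : ℕ → Kf) i → diag (λ a d → at0 a (f d)) i ≃ f i
diag-at0ᵃ f zero k = refl
diag-at0ᵃ f (suc i) = ⊞-0ʳ (diag-0 (λ a d → 0k) (λ _ _ _ → refl) i)

-- N in one of the two exponents only multiplies by that side's variable, so it commutes with
-- identifying the two variables.
diag-Nᵈ : ∀ (V : ℕ → Layer) n i → diag (λ a d → Nˡ (V a) n d) i ≃ Nˡ (λ n i → diag (λ a → V a n) i) n i
diag-Nᵈ V n zero k = refl
diag-Nᵈ V n (suc i) k = begin
  diag (λ a d → Nˡ (V a) n d) (suc i) k
    ≡⟨ diag-back (λ a d → Nˡ (V a) n d) i k ⟩
  V (suc i) n 0 k ℤ.+ diag (λ a d → V a n (suc d) ⊞ Nˡ (V a) (suc n) d) i k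
    ≡⟨ cong (ℤ._+_ (V (suc i) n 0 k)) (diag-⊞ (λ a d → V a n (suc d)) (λ a d → Nˡ (V a) (suc n) d) i k) ⟩
  V (suc i) n 0 k ℤ.+ (diag (λ a d → V a n (suc d)) i k ℤ.+ diag (λ a d → Nˡ (V a) (suc n) d) i k)
    ≡⟨ ℤP.+-assoc (V (suc i) n 0 k) _ _ ⟨
  V (suc i) n 0 k ℤ.+ diag (λ a d → V a n (suc d)) i k ℤ.+ diag (λ a d → Nˡ (V a) (suc n) d) i k
    ≡⟨ cong₂ ℤ._+_ (≡.sym (diag-back (λ a → V a n) i k)) (diag-Nᵈ V (suc n) i k) ⟩
  Nˡ (λ n i → diag (λ a → V a n) i) n (suc i) k ∎
  where open ≡.≡-Reasoning

diag-Rᵈ : ∀ (V : ℕ → Layer) n i → diag (λ a d → Rˡ (V a) n d) i ≃ Rˡ (λ n i → diag (λ a → V a n) i) n i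
diag-Rᵈ V n zero k = refl
diag-Rᵈ V n (suc i) k = begin
  diag (λ a d → Rˡ (V a) n d) (suc i) k
    ≡⟨ diag-back (λ a d → Rˡ (V a) n d) i k ⟩
  V (suc i) n 0 k ℤ.+ diag (λ a d → V a n (suc d) ⊞ qs (Nˡ (V a) (suc n) d)) i k
    ≡⟨ cong (ℤ._+_ (V (suc i) n 0 k)) (diag-⊞ (λ a d → V a n (suc d)) (λ a d → qs (Nˡ (V a) (suc n) d)) i k) ⟩
  V (suc i) n 0 k ℤ.+ (diag (λ a d → V a n (suc d)) i k ℤ.+ diag (λ a d → qs (Nˡ (V a) (suc n) d)) i k)
    ≡⟨ ℤP.+-assoc (V (suc i) n 0 k) _ _ ⟨
  V (suc i) n 0 k ℤ.+ diag (λ a d → V a n (suc d)) i k ℤ.+ diag (λ a d → qs (Nˡ (V a) (suc n) d)) i k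
    ≡⟨ cong₂ ℤ._+_ (≡.sym (diag-back (λ a → V a n) i k))
         (≃-trans (diag-qs (λ a d → Nˡ (V a) (suc n) d) i) (qs-cong (diag-Nᵈ V (suc n) i)) k) ⟩
  Rˡ (λ n i → diag (λ a → V a n) i) n (suc i) k ∎
  where open ≡.≡-Reasoning

diag-Nᵃ : ∀ (F : ℕ → ℕ → ℕ → Kf) n i →
       diag (λ a d → Nˡ (λ n a → F n a d) n a) i ≃ Nˡ (λ n i → diag (F n) i) n i
diag-Nᵃ F n zero k = refl
diag-Nᵃ F n (suc i) k = begin
  F n 0 (suc i) k ℤ.+ diag (λ a d → F n (suc a) d ⊞ Nˡ (λ n a → F n a d) (suc n) a) i k
    ≡⟨ cong (ℤ._+_ (F n 0 (suc i) k)) (diag-⊞ (F n ∘ suc) (λ a d → Nˡ (λ n a → F n a d) (suc n) a) i k) ⟩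
  F n 0 (suc i) k ℤ.+ (diag (F n ∘ suc) i k ℤ.+ diag (λ a d → Nˡ (λ n a → F n a d) (suc n) a) i k)
    ≡⟨ ℤP.+-assoc (F n 0 (suc i) k) _ _ ⟨
  diag (F n) (suc i) k ℤ.+ diag (λ a d → Nˡ (λ n a → F n a d) (suc n) a) i k
    ≡⟨ cong (ℤ._+_ (diag (F n) (suc i) k)) (diag-Nᵃ F (suc n) i k) ⟩
  Nˡ (λ n i → diag (F n) i) n (suc i) k ∎
  where open ≡.≡-Reasoning

diag-Rᵃ : ∀ (F : ℕ → ℕ → ℕ → Kf) n i →
       diag (λ a d → Rˡ (λ n a → F n a d) n a) i ≃ Rˡ (λ n i → diag (F n) i) n i
diag-Rᵃ F n zero k = refl
diag-Rᵃ F n (suc i) k = begin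
  F n 0 (suc i) k ℤ.+ diag (λ a d → F n (suc a) d ⊞ qs (Nˡ (λ n a → F n a d) (suc n) a)) i k
    ≡⟨ cong (ℤ._+_ (F n 0 (suc i) k)) (diag-⊞ (F n ∘ suc) (λ a d → qs (Nˡ (λ n a → F n a d) (suc n) a)) i k) ⟩
  F n 0 (suc i) k ℤ.+ (diag (F n ∘ suc) i k ℤ.+ diag (λ a d → qs (Nˡ (λ n a → F n a d) (suc n) a)) i k)
    ≡⟨ ℤP.+-assoc (F n 0 (suc i) k) _ _ ⟨
  diag (F n) (suc i) k ℤ.+ diag (λ a d → qs (Nˡ (λ n a → F n a d) (suc n) a)) i k
    ≡⟨ cong (ℤ._+_ (diag (F n) (suc i) k))
         (≃-trans (diag-qs (λ a d → Nˡ (λ n a → F n a d) (suc n) a) i) (qs-cong (diag-Nᵃ F (suc n) i)) k) ⟩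
  Rˡ (λ n i → diag (F n) i) n (suc i) k ∎
  where open ≡.≡-Reasoning

-- An end is committed to moving inwards when nothing is unreached on its side: both sides in `L₂`,
-- the left one in `L₁`; in `L₀` neither is prescribed.
L₂ L₁ L₀ : ℕ → Layer
L₂ h n i = at0 i (C h 0 n 0)
L₁ h = C h 0
L₀ h n i = diag (λ a d → C h a n d) i

C-zero : ∀ a n d → C 0 a n d ≃ at0 a (at0 d δ₀)
C-zero (suc a) n d k = refl
C-zero zero (suc n) d = C-zero zero n d
C-zero zero zero zero k = refl
C-zero zero zero (suc d) k = refl

Mˡ-L₂ : ∀ h n i → Mˡ (L₂ h) n i ≃ at0 i (Mˡ (L₁ h) n 0)
Mˡ-L₂ h n zero k = refl
Mˡ-L₂ h n (suc i) = msum-0 (λ _ _ → refl) n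

Jˡ-L : ∀ h → Jˡ (L₁ h) ≗ Rˡ (L₁ h) ⊞ˡ Mˡ (L₂ h)
Jˡ-L h n i = ≃-trans (Jˡ-split (L₁ h) n i) (⊞-congˡ {Rˡ (L₁ h) n i} (≃-sym (Mˡ-L₂ h n i)))

L₁-suc : ∀ h → L₁ (suc h) ≗ Tˡ (Rˡ (L₁ h)) ⊞ˡ Tˡ (Mˡ (L₂ h))
L₁-suc h n i = ≃-trans (C-reach h n i)
  (≃-trans (Tˡ-cong (Jˡ-L h) n i) (Tˡ-⊞ (Rˡ (L₁ h)) (Mˡ (L₂ h)) n i))

L₂-suc : ∀ h → L₂ (suc h) ≗ Tˡ (Tˡ (L₂ h))
L₂-suc h n zero = ≃-trans (C-reach h n 0)
  (Tˡ-column (Jˡ (L₁ h)) (Tˡ (L₂ h)) 0 (λ n → Tˡ-column (L₁ h) (L₂ h) 0 (λ _ _ → refl) n) n)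
L₂-suc h n (suc i) k = ≡.sym (≡.trans
  (Tˡ-column (Tˡ (L₂ h)) 0ˡ (suc i)
    (λ n → ≃-trans (Tˡ-column (L₂ h) 0ˡ (suc i) (λ _ _ → refl) n) (Tˡ-0 (λ _ _ _ → refl) n (suc i))) n k)
  (Tˡ-0 (λ _ _ _ → refl) n (suc i) k))

-- Mirror symmetry, read off from the recursions without reversing rows. It lets the two terms with
-- one committed end be added, which is the 2 in 2MRV₁.
C-symmetric : ∀ h n i → C h i n 0 ≃ L₁ h n i
C-symmetric zero n i = ≃-trans (C-zero i n 0) (≃-sym (C-zero 0 n i))
C-symmetric (suc h) n i = ≃-trans (C-suc h n 0 i) (≃-trans
  (⊞-cong (⊞-cong (Rˡ-cong sym-layer n i) (Mˡ-cong (Rˡ-cong sym-layer) n i)) (λ _ → refl))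
  (≃-trans (lemma i) (≃-sym (C-reach h n i))))
  where
  sym-layer : (λ m b → C h b m 0) ≗ L₁ h
  sym-layer m b = C-symmetric h m b
  lemma : ∀ i → Tˡ (Rˡ (L₁ h)) n i ⊞ at0 i (Mˡ (Jˡ (L₁ h)) n 0) ≃ Tˡ (Jˡ (L₁ h)) n i
  lemma zero = ⊞-cong (Tˡ-column (Rˡ (L₁ h)) (L₁ h) 0 (λ _ _ → refl) n) (λ _ → refl)
  lemma (suc i) = ≃-trans (⊞-0ʳ (λ _ → refl))
    (Tˡ-column (Rˡ (L₁ h)) (Jˡ (L₁ h)) (suc i) (λ _ _ → refl) n)

L₀-suc : ∀ h → L₀ (suc h) ≗
  Rˡ (Rˡ (L₀ h)) ⊞ˡ (Mˡ (Rˡ (L₁ h)) ⊞ˡ Mˡ (Rˡ (L₁ h)) ⊞ˡ Mˡ (Mˡ (L₂ h)))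
L₀-suc h n i k = begin
  diag (λ a d → C (suc h) a n d) i k
    ≡⟨ diag-cong (λ a d → C-suc h n d a) i k ⟩
  diag (λ a d → f₁ a d ⊞ at0 d (f₂ a) ⊞ at0 a (f₃ d)) i k
    ≡⟨ ≃-trans (diag-⊞ (λ a d → f₁ a d ⊞ at0 d (f₂ a)) (λ a d → at0 a (f₃ d)) i)
         (⊞-cong (diag-⊞ f₁ (λ a d → at0 d (f₂ a)) i) (λ _ → refl)) k ⟩
  diag f₁ i k ℤ.+ diag (λ a d → at0 d (f₂ a)) i k ℤ.+ diag (λ a d → at0 a (f₃ d)) i k
    ≡⟨ cong₂ ℤ._+_ (cong₂ ℤ._+_ (f₁-sum k) (diag-at0ᵈ f₂ i k)) (diag-at0ᵃ f₃ i k) ⟩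
  Rˡ (Rˡ (L₀ h)) n i k ℤ.+ f₂ i k ℤ.+ f₃ i k
    ≡⟨ cong₂ (λ u v → Rˡ (Rˡ (L₀ h)) n i k ℤ.+ u ℤ.+ v)
         (Mˡ-cong (Rˡ-cong λ m b → C-symmetric h m b) n i k)
         (≃-trans (Mˡ-cong (Jˡ-L h) n i) (Mˡ-⊞ (Rˡ (L₁ h)) (Mˡ (L₂ h)) n i) k) ⟩
  Rˡ (Rˡ (L₀ h)) n i k ℤ.+ m k ℤ.+ (m k ℤ.+ Mˡ (Mˡ (L₂ h)) n i k)
    ≡⟨ ℤP.+-assoc (Rˡ (Rˡ (L₀ h)) n i k) (m k) _ ⟩
  Rˡ (Rˡ (L₀ h)) n i k ℤ.+ (m k ℤ.+ (m k ℤ.+ Mˡ (Mˡ (L₂ h)) n i k))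
    ≡⟨ cong (ℤ._+_ (Rˡ (Rˡ (L₀ h)) n i k)) (ℤP.+-assoc (m k) (m k) (Mˡ (Mˡ (L₂ h)) n i k)) ⟨
  Rˡ (Rˡ (L₀ h)) n i k ℤ.+ (m k ℤ.+ m k ℤ.+ Mˡ (Mˡ (L₂ h)) n i k) ∎
  where
  open ≡.≡-Reasoning
  m : Kf
  m = Mˡ (Rˡ (L₁ h)) n i
  f₁ : ℕ → ℕ → Kf
  f₁ a d = Rˡ (λ m b → Rˡ (C h b) m d) n a
  f₂ f₃ : ℕ → Kf
  f₂ a = Mˡ (Rˡ (λ m b → C h b m 0)) n a
  f₃ d = Mˡ (Jˡ (C h 0)) n d
  f₁-sum : diag f₁ i ≃ Rˡ (Rˡ (L₀ h)) n i
  f₁-sum = ≃-trans (diag-Rᵃ (λ m b d → Rˡ (C h b) m d) n i)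
    (Rˡ-cong (λ m j → diag-Rᵈ (C h) m j) n i)

-- Identification of the counts with V₂, V₁ and V₀

#1-suc : ∀ i j k → (# 1) i (suc j) k ≡ 0ℤ
#1-suc zero j k = refl
#1-suc (suc i) j k = refl

#1-layer : ∀ i k → (# 1) i 0 k ≡ at0 i δ₀ k
#1-layer zero zero = refl
#1-layer zero (suc k) = refl
#1-layer (suc i) k = refl

1+Y² : ∀ f i j k → (# 1 +ₛ Y *ₛ (Y *ₛ f)) i (suc (suc j)) k ≡ f i j k
1+Y² f i j k = ≡.trans (cong₂ ℤ._+_ (#1-suc i (suc j) k) (Y²-suc f i j k)) (ℤP.+-identityˡ _)

1+Y²-0 : ∀ f i k → (# 1 +ₛ Y *ₛ (Y *ₛ f)) i 0 k ≡ at0 i δ₀ k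
1+Y²-0 f i k = ≡.trans (cong₂ ℤ._+_ (#1-layer i k) (Y²-zero f i k)) (ℤP.+-identityʳ _)

1+Y²-1 : ∀ f i k → (# 1 +ₛ Y *ₛ (Y *ₛ f)) i 1 k ≡ 0ℤ
1+Y²-1 f i k = cong₂ ℤ._+_ (#1-suc i 0 k) (Y²-one f i k)

L₁-zero : ∀ n i → at0 i δ₀ ≃ L₁ 0 n i
L₁-zero n i = ≃-sym (C-zero 0 n i)

L₂-zero : ∀ n i → at0 i δ₀ ≃ L₂ 0 n i
L₂-zero n zero = L₁-zero n 0
L₂-zero n (suc i) k = refl

L₀-zero : ∀ n i → at0 i δ₀ ≃ L₀ 0 n i
L₀-zero n i = ≃-trans (≃-sym (diag-at0ᵃ (λ d → at0 d δ₀) i))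
  (diag-cong (λ a d → ≃-sym (C-zero a n d)) i)

-- With y = z², `h` further rows live in degree 2h, and the odd degrees vanish.
V₂-even : ∀ h → layer (double h) V₂ ≗ L₂ h
V₂-even zero n i k = ≡.trans (#1-layer i k) (L₂-zero n i k)
V₂-even (suc h) n i k = ≡.trans (cong (ℤ._+ Tˡ (Tˡ (layer (double h) V₂)) n i k) (#1-suc i (suc (double h)) k))
  (≡.trans (ℤP.+-identityˡ (Tˡ (Tˡ (layer (double h) V₂)) n i k))
  (≡.trans (Tˡ-cong (Tˡ-cong (V₂-even h)) n i k) (≡.sym (L₂-suc h n i k))))

V₂-odd : ∀ h → layer (suc (double h)) V₂ ≗ 0ˡ
V₂-odd zero n i k = #1-suc i 0 k
V₂-odd (suc h) n i k = cong₂ ℤ._+_ (#1-suc i (suc (suc (double h))) k) (Tˡ-0 (Tˡ-0 (V₂-odd h)) n i k)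

V₁-even : ∀ h → layer (double h) V₁ ≗ L₁ h
V₁-even zero n i k = ≡.trans (1+Y²-0 (Tᵒ (Mᵒ V₂) n) i k) (L₁-zero n i k)
V₁-even (suc h) n i k = begin
  D₁ n i (suc (suc (double h))) k ℤ.+ Tˡ (Rˡ (layer (double h) V₁)) n i k
    ≡⟨ cong₂ ℤ._+_ (≡.trans (1+Y² (Tᵒ (Mᵒ V₂) n) i (double h) k) (Tˡ-cong (Mˡ-cong (V₂-even h)) n i k))
         (Tˡ-cong (Rˡ-cong (V₁-even h)) n i k) ⟩
  Tˡ (Mˡ (L₂ h)) n i k ℤ.+ Tˡ (Rˡ (L₁ h)) n i k
    ≡⟨ ℤP.+-comm (Tˡ (Mˡ (L₂ h)) n i k) (Tˡ (Rˡ (L₁ h)) n i k) ⟩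
  Tˡ (Rˡ (L₁ h)) n i k ℤ.+ Tˡ (Mˡ (L₂ h)) n i k
    ≡⟨ L₁-suc h n i k ⟨
  L₁ (suc h) n i k ∎
  where open ≡.≡-Reasoning

V₁-odd : ∀ h → layer (suc (double h)) V₁ ≗ 0ˡ
V₁-odd zero n i k = 1+Y²-1 (Tᵒ (Mᵒ V₂) n) i k
V₁-odd (suc h) n i k = cong₂ ℤ._+_
  (≡.trans (1+Y² (Tᵒ (Mᵒ V₂) n) i (suc (double h)) k) (Tˡ-0 (Mˡ-0 (V₂-odd h)) n i k))
  (Tˡ-0 (Rˡ-0 (V₁-odd h)) n i k)

V₀-even : ∀ h → layer (double h) V₀ ≗ L₀ h
V₀-even zero n i k = ≡.trans (1+Y²-0 (Mᵒ (Rᵒ V₁) n +ₛ Mᵒ (Rᵒ V₁) n +ₛ Mᵒ (Mᵒ V₂) n) i k) (L₀-zero n i k)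
V₀-even (suc h) n i k = begin
  D₀ n i (suc (suc (double h))) k ℤ.+ Rˡ (Rˡ (layer (double h) V₀)) n i k
    ≡⟨ cong₂ ℤ._+_
         (≡.trans (1+Y² (Mᵒ (Rᵒ V₁) n +ₛ Mᵒ (Rᵒ V₁) n +ₛ Mᵒ (Mᵒ V₂) n) i (double h) k)
           (cong₂ ℤ._+_ (cong₂ ℤ._+_ MR-layer MR-layer) (Mˡ-cong (Mˡ-cong (V₂-even h)) n i k)))
         (Rˡ-cong (Rˡ-cong (V₀-even h)) n i k) ⟩
  _ ≡⟨ ℤP.+-comm _ (Rˡ (Rˡ (L₀ h)) n i k) ⟩
  _ ≡⟨ L₀-suc h n i k ⟨
  L₀ (suc h) n i k ∎
  where
  open ≡.≡-Reasoning
  MR-layer : Mˡ (Rˡ (layer (double h) V₁)) n i k ≡ Mˡ (Rˡ (L₁ h)) n i k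
  MR-layer = Mˡ-cong (Rˡ-cong (V₁-even h)) n i k

V₀-odd : ∀ h → layer (suc (double h)) V₀ ≗ 0ˡ
V₀-odd zero n i k = 1+Y²-1 (Mᵒ (Rᵒ V₁) n +ₛ Mᵒ (Rᵒ V₁) n +ₛ Mᵒ (Mᵒ V₂) n) i k
V₀-odd (suc h) n i k = cong₂ ℤ._+_
  (≡.trans (1+Y² (Mᵒ (Rᵒ V₁) n +ₛ Mᵒ (Rᵒ V₁) n +ₛ Mᵒ (Mᵒ V₂) n) i (suc (double h)) k)
    (cong₂ ℤ._+_ (cong₂ ℤ._+_ MR-layer MR-layer) (Mˡ-0 (Mˡ-0 (V₂-odd h)) n i k)))
  (Rˡ-0 (Rˡ-0 (V₀-odd h)) n i k)
  where
  MR-layer : Mˡ (Rˡ (layer (suc (double h)) V₁)) n i k ≡ 0ℤ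
  MR-layer = Mˡ-0 (Rˡ-0 (V₁-odd h)) n i k

-- Convex polyominoes as chains of overlapping intervals

∧-true : ∀ {a b} → a ∧ b ≡ true → a ≡ true × b ≡ true
∧-true {true} eq = refl , eq

∨-true : ∀ {a b} → a ∨ b ≡ true → a ≡ true ⊎ b ≡ true
∨-true {true} eq = inj₁ refl
∨-true {false} eq = inj₂ eq

∧-intro : ∀ {a b} → a ≡ true → b ≡ true → a ∧ b ≡ true
∧-intro refl refl = refl

∨-introˡ : ∀ {a} b → a ≡ true → a ∨ b ≡ true
∨-introˡ b refl = refl

∨-introʳ : ∀ a {b} → b ≡ true → a ∨ b ≡ true
∨-introʳ true refl = refl
∨-introʳ false refl = refl

bool-ext : ∀ {a b} → (a ≡ true → b ≡ true) → (b ≡ true → a ≡ true) → a ≡ b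
bool-ext {true} {b} f g = ≡.sym (f refl)
bool-ext {false} {true} f g = g refl
bool-ext {false} {false} f g = refl

allU : (ℕ → Bool) → ℕ → Bool
allU f zero = true
allU f (suc n) = f 0 ∧ allU (f ∘ suc) n

allU-elim : ∀ f n → allU f n ≡ true → ∀ i → i < n → f i ≡ true
allU-elim f (suc n) eq zero _ = proj₁ (∧-true eq)
allU-elim f (suc n) eq (suc i) (s≤s i<n) = allU-elim (f ∘ suc) n (proj₂ (∧-true {f 0} eq)) i i<n

allU-intro : ∀ f n → (∀ i → i < n → f i ≡ true) → allU f n ≡ true
allU-intro f zero eq = refl
allU-intro f (suc n) eq = ∧-intro (eq 0 (s≤s z≤n)) (allU-intro (f ∘ suc) n (λ i i<n → eq (suc i) (s≤s i<n)))

allU-cong : ∀ {f g} n → (∀ i → f i ≡ g i) → allU f n ≡ allU g n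
allU-cong zero eq = refl
allU-cong (suc n) eq = cong₂ _∧_ (eq 0) (allU-cong n (eq ∘ suc))

-- `upTo` unfolds with a changing index function, so the induction generalises `id` to an arbitrary
-- `f`. The later lemmas on ranges do the same.
allB-range1 : ∀ (p : ℕ → Bool) n → allB p (range1 n) ≡ allU (p ∘ suc) n
allB-range1 p n = go id n
  where
  go : ∀ f n → allB p (map suc (applyUpTo f n)) ≡ allU (p ∘ suc ∘ f) n
  go f zero = refl
  go f (suc n) = cong (p (suc (f 0)) ∧_) (go (f ∘ suc) n)

map-range1 : ∀ {A : Set} (f : ℕ → A) n → map f (range1 n) ≡ applyUpTo (f ∘ suc) n
map-range1 f n = go id n
  where
  go : ∀ g n → map f (map suc (applyUpTo g n)) ≡ applyUpTo (f ∘ suc ∘ g) n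
  go g zero = refl
  go g (suc n) = cong (f (suc (g 0)) ∷_) (go (g ∘ suc) n)

allB-++ : ∀ {A : Set} (p : A → Bool) xs ys → allB p (xs ++ ys) ≡ allB p xs ∧ allB p ys
allB-++ p [] ys = refl
allB-++ p (x ∷ xs) ys = ≡.trans (cong (p x ∧_) (allB-++ p xs ys)) (≡.sym (BoolP.∧-assoc (p x) _ _))

allB-concatMap : ∀ {A B : Set} (p : B → Bool) (f : A → List B) xs →
                 allB p (concatMap f xs) ≡ allB (allB p ∘ f) xs
allB-concatMap p f [] = refl
allB-concatMap p f (x ∷ xs) = ≡.trans (allB-++ p (f x) (concatMap f xs))
  (cong (allB p (f x) ∧_) (allB-concatMap p f xs))

allB-cells : ∀ (p : ℕ × ℕ → Bool) v h g → allB p (cells v h g) ≡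
  allU (λ y → allU (λ x → if mem g (suc x) (suc y) then p (suc x , suc y) else true) v) h
allB-cells p v h g = ≡.trans (allB-concatMap p _ (range1 h)) (≡.trans (allB-range1 _ h)
  (allU-cong h λ y → ≡.trans (allB-concatMap p _ (range1 v)) (≡.trans (allB-range1 _ v)
    (allU-cong v λ x → lemma (mem g (suc x) (suc y)) (suc x , suc y)))))
  where
  lemma : ∀ b c → allB p (if b then c ∷ [] else []) ≡ (if b then p c else true)
  lemma true c = BoolP.∧-identityʳ (p c)
  lemma false c = refl

data Shaped (v : ℕ) : ℕ → Grid → Set where
  [] : Shaped v 0 []
  _∷_ : ∀ {h r g} → length r ≡ v → Shaped v h g → Shaped v (suc h) (r ∷ g)

interval : List Bool → Bool
interval r = anyB id r ∧ contig₀ r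

meets : List Bool → List Bool → Bool
meets (x ∷ r) (y ∷ r′) = (x ∧ y) ∨ meets r r′
meets _ _ = false

linked : Grid → Bool
linked [] = true
linked (r ∷ []) = true
linked (r ∷ r′ ∷ g) = meets r r′ ∧ linked (r′ ∷ g)

meets-intro : ∀ r r′ x → nthB r x ≡ true → nthB r′ x ≡ true → meets r r′ ≡ true
meets-intro (a ∷ r) (b ∷ r′) zero p q = ∨-introˡ (meets r r′) (∧-intro p q)
meets-intro (a ∷ r) (b ∷ r′) (suc x) p q = ∨-introʳ (a ∧ b) (meets-intro r r′ x p q)

meets-elim : ∀ r r′ → meets r r′ ≡ true → ∃ λ x → nthB r x ≡ true × nthB r′ x ≡ true
meets-elim (a ∷ r) (b ∷ r′) eq with ∨-true {a ∧ b} eq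
... | inj₁ ab = 0 , ∧-true ab
... | inj₂ rest with meets-elim r r′ rest
...   | x , p , q = suc x , p , q

anyB-elim : ∀ r → anyB id r ≡ true → ∃ λ x → nthB r x ≡ true
anyB-elim (true ∷ r) eq = 0 , refl
anyB-elim (false ∷ r) eq with anyB-elim r eq
... | x , p = suc x , p

nthB-length : ∀ r x → nthB r x ≡ true → x < length r
nthB-length (b ∷ r) zero p = s≤s z≤n
nthB-length (b ∷ r) (suc x) p = s≤s (nthB-length r x p)

contig₂-nth : ∀ r → contig₂ r ≡ true → ∀ x → nthB r x ≢ true
contig₂-nth (false ∷ r) c (suc x) p = contig₂-nth r c x p

contig₁-nth : ∀ r → contig₁ r ≡ true → ∀ d e → e ≤ d → nthB r d ≡ true → nthB r e ≡ true
contig₁-nth (true ∷ r) c d zero e≤d p = refl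
contig₁-nth (true ∷ r) c (suc d) (suc e) (s≤s e≤d) p = contig₁-nth r c d e e≤d p
contig₁-nth (false ∷ r) c (suc d) e e≤d p = ⊥-elim (contig₂-nth r c d p)

contig₀-nth : ∀ r → contig₀ r ≡ true → ∀ x d e → e ≤ d →
              nthB r x ≡ true → nthB r (x ℕ.+ d) ≡ true → nthB r (x ℕ.+ e) ≡ true
contig₀-nth (false ∷ r) c (suc x) d e e≤d p q = contig₀-nth r c x d e e≤d p q
contig₀-nth (true ∷ r) c zero d e e≤d p q = contig₁-nth (true ∷ r) c d e e≤d q
contig₀-nth (true ∷ r) c (suc x) d e e≤d p q =
  contig₁-nth r c (x ℕ.+ d) (x ℕ.+ e) (ℕP.+-monoʳ-≤ x e≤d) q

≡ᵇ-true : ∀ m n → (m ≡ᵇ n) ≡ true → m ≡ n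
≡ᵇ-true m n eq = ℕP.≡ᵇ⇒≡ m n (≡.subst T (≡.sym eq) _)

≡ᵇ-refl : ∀ m → (m ≡ᵇ m) ≡ true
≡ᵇ-refl zero = refl
≡ᵇ-refl (suc m) = ≡ᵇ-refl m

module Reach (g : Grid) (x₀ : ℕ) (start : mem g x₀ 1 ≡ true) where

  Re : ℕ → ℕ → ℕ → Set
  Re n x y = reach g x₀ 1 n x y ≡ true

  Re-cases : ∀ n x y → Re (suc n) x y → Re n x y ⊎
    (mem g x y ≡ true × (Re n (x ∸ 1) y ⊎ Re n (suc x) y ⊎ Re n x (y ∸ 1) ⊎ Re n x (suc y)))
  Re-cases n x y eq with ∨-true {reach g x₀ 1 n x y} eq
  ... | inj₁ p = inj₁ p
  ... | inj₂ p with ∧-true {mem g x y} p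
  ...   | m , q with ∨-true {reach g x₀ 1 n (x ∸ 1) y} q
  ...     | inj₁ a = inj₂ (m , inj₁ a)
  ...     | inj₂ q₂ with ∨-true {reach g x₀ 1 n (suc x) y} q₂
  ...       | inj₁ a = inj₂ (m , inj₂ (inj₁ a))
  ...       | inj₂ q₃ with ∨-true {reach g x₀ 1 n x (y ∸ 1)} q₃
  ...         | inj₁ a = inj₂ (m , inj₂ (inj₂ (inj₁ a)))
  ...         | inj₂ a = inj₂ (m , inj₂ (inj₂ (inj₂ a)))

  Re-start : ∀ x y → Re 0 x y → x ≡ x₀ × y ≡ 1
  Re-start x y eq with ∧-true {x ≡ᵇ x₀} eq
  ... | p , q = ≡ᵇ-true x x₀ p , ≡ᵇ-true y 1 q

  Re-mem : ∀ n x y → Re n x y → mem g x y ≡ true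
  Re-mem zero x y eq with Re-start x y eq
  ... | refl , refl = start
  Re-mem (suc n) x y eq with Re-cases n x y eq
  ... | inj₁ p = Re-mem n x y p
  ... | inj₂ (m , _) = m

  Re-weaken : ∀ n x y → Re n x y → Re (suc n) x y
  Re-weaken n x y p = ∨-introˡ _ p

  Re-mono : ∀ {m n} x y → m ≤ n → Re m x y → Re n x y
  Re-mono {m} {n} x y m≤n p with ℕP.m≤n⇒∃[o]m+o≡n m≤n
  ... | o , refl = ≡.subst (λ k → Re k x y) (ℕP.+-comm o m) (go o)
    where
    go : ∀ o → Re (o ℕ.+ m) x y
    go zero = p
    go (suc o) = Re-weaken (o ℕ.+ m) x y (go o)

  Re-step : ∀ n x y → mem g x y ≡ true →
    Re n (x ∸ 1) y ⊎ Re n (suc x) y ⊎ Re n x (y ∸ 1) ⊎ Re n x (suc y) → Re (suc n) x y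
  Re-step n x y m p = ∨-introʳ (reach g x₀ 1 n x y) (∧-intro m (lemma p))
    where
    a = reach g x₀ 1 n (x ∸ 1) y
    b = reach g x₀ 1 n (suc x) y
    c = reach g x₀ 1 n x (y ∸ 1)
    lemma : Re n (x ∸ 1) y ⊎ Re n (suc x) y ⊎ Re n x (y ∸ 1) ⊎ Re n x (suc y) →
            a ∨ b ∨ c ∨ reach g x₀ 1 n x (suc y) ≡ true
    lemma (inj₁ p) = ∨-introˡ _ p
    lemma (inj₂ (inj₁ p)) = ∨-introʳ a (∨-introˡ _ p)
    lemma (inj₂ (inj₂ (inj₁ p))) = ∨-introʳ a (∨-introʳ b (∨-introˡ _ p))
    lemma (inj₂ (inj₂ (inj₂ p))) = ∨-introʳ a (∨-introʳ b (∨-introʳ c p))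

  -- The only way from one row up to the next is through a column common to both, so a pair of
  -- disjoint rows stops every path from the lowest row.
  Re-cut : ∀ y → meets (nthRow g y) (nthRow g (suc y)) ≢ true → ∀ n x y′ → Re n x y′ → y′ ≤ suc y
  Re-cut y cut zero x y′ p with Re-start x y′ p
  ... | refl , refl = s≤s z≤n
  Re-cut y cut (suc n) x y′ p with Re-cases n x y′ p
  ... | inj₁ q = Re-cut y cut n x y′ q
  ... | inj₂ (m , inj₁ q) = Re-cut y cut n (x ∸ 1) y′ q
  ... | inj₂ (m , inj₂ (inj₁ q)) = Re-cut y cut n (suc x) y′ q
  ... | inj₂ (m , inj₂ (inj₂ (inj₂ q))) = ℕP.≤-trans (ℕP.n≤1+n y′) (Re-cut y cut n x (suc y′) q)
  Re-cut y cut (suc n) x zero p | inj₂ (m , inj₂ (inj₂ (inj₁ q))) = z≤n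
  Re-cut y cut (suc n) (suc x) (suc y′) p | inj₂ (m , inj₂ (inj₂ (inj₁ q)))
    with Re-cut y cut n (suc x) y′ q
  ... | y′≤ with ℕP.m≤n⇒m<n∨m≡n y′≤
  ...   | inj₁ y′< = y′<
  ...   | inj₂ refl = ⊥-elim (cut (meets-intro (nthRow g y) (nthRow g (suc y)) x
            (Re-mem n (suc x) (suc y) q) m))

  module _ (y : ℕ) (c : contig₀ (nthRow g y) ≡ true) where

    walkʳ : ∀ n x d → nthB (nthRow g y) x ≡ true → nthB (nthRow g y) (x ℕ.+ d) ≡ true →
            Re n (suc x) (suc y) → Re (d ℕ.+ n) (suc (x ℕ.+ d)) (suc y)
    walkʳ n x zero p q re = ≡.subst (λ x → Re n (suc x) (suc y)) (≡.sym (ℕP.+-identityʳ x)) re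
    walkʳ n x (suc d) p q re = Re-step (d ℕ.+ n) (suc (x ℕ.+ suc d)) (suc y) q
      (inj₁ (≡.subst (λ x → Re (d ℕ.+ n) x (suc y)) (≡.sym (ℕP.+-suc x d))
        (walkʳ n x d p (contig₀-nth (nthRow g y) c x (suc d) d (ℕP.n≤1+n d) p q) re)))

    walkˡ : ∀ n x d → nthB (nthRow g y) x ≡ true → nthB (nthRow g y) (x ℕ.+ d) ≡ true →
            Re n (suc (x ℕ.+ d)) (suc y) → Re (d ℕ.+ n) (suc x) (suc y)
    walkˡ n x zero p q re = ≡.subst (λ x → Re n (suc x) (suc y)) (ℕP.+-identityʳ x) re
    walkˡ n x (suc d) p q re = Re-step (d ℕ.+ n) (suc x) (suc y) p (inj₂ (inj₁
      (walkˡ n (suc x) d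
        (≡.subst (λ k → nthB (nthRow g y) k ≡ true) (ℕP.+-comm x 1)
          (contig₀-nth (nthRow g y) c x (suc d) 1 (s≤s z≤n) p q))
        (≡.subst (λ k → nthB (nthRow g y) k ≡ true) (ℕP.+-suc x d) q)
        (≡.subst (λ k → Re n (suc k) (suc y)) (ℕP.+-suc x d) re))))

    walk : ∀ n x x′ → nthB (nthRow g y) x ≡ true → nthB (nthRow g y) x′ ≡ true →
           Re n (suc x) (suc y) → Re (length (nthRow g y) ∸ 1 ℕ.+ n) (suc x′) (suc y)
    walk n x x′ p q re with ℕP.≤-total x x′
    ... | inj₁ x≤x′ with ℕP.m≤n⇒∃[o]m+o≡n x≤x′
    ...   | d , refl = Re-mono (suc (x ℕ.+ d)) (suc y)
              (ℕP.+-monoˡ-≤ n (ℕP.≤-trans (ℕP.m≤n+m d x) (bound (x ℕ.+ d) q))) (walkʳ n x d p q re)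
      where
      bound : ∀ x → nthB (nthRow g y) x ≡ true → x ≤ length (nthRow g y) ∸ 1
      bound x p = ℕP.<⇒≤pred (nthB-length (nthRow g y) x p)
    walk n x x′ p q re | inj₂ x′≤x with ℕP.m≤n⇒∃[o]m+o≡n x′≤x
    ...   | d , refl = Re-mono (suc x′) (suc y)
              (ℕP.+-monoˡ-≤ n (ℕP.≤-trans (ℕP.m≤n+m d x′)
                (ℕP.<⇒≤pred (nthB-length (nthRow g y) (x′ ℕ.+ d) p)))) (walkˡ n x′ d q p re)

linked-intro : ∀ g → (∀ y → suc y < length g → meets (nthRow g y) (nthRow g (suc y)) ≡ true) → linked g ≡ true
linked-intro [] p = refl
linked-intro (r ∷ []) p = refl
linked-intro (r ∷ r′ ∷ g) p = ∧-intro (p 0 (s≤s (s≤s z≤n))) (linked-intro (r′ ∷ g) λ y q → p (suc y) (s≤s q))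

linked-elim : ∀ g → linked g ≡ true → ∀ y → suc y < length g → meets (nthRow g y) (nthRow g (suc y)) ≡ true
linked-elim (r ∷ r′ ∷ g) l zero p = proj₁ (∧-true l)
linked-elim (r ∷ r′ ∷ g) l (suc y) (s≤s p) = linked-elim (r′ ∷ g) (proj₂ (∧-true {meets r r′} l)) y p
linked-elim (r ∷ []) l y (s≤s ())

shaped-length : ∀ {v h g} → Shaped v h g → length g ≡ h
shaped-length [] = refl
shaped-length (_ ∷ sh) = cong suc (shaped-length sh)

shaped-row : ∀ {v h g} → Shaped v h g → ∀ y → y < h → length (nthRow g y) ≡ v
shaped-row (l ∷ sh) zero p = l
shaped-row (l ∷ sh) (suc y) (s≤s p) = shaped-row sh y p

connected-eq : ∀ v h g {x₀ y₀ cs} → cells v h g ≡ (x₀ , y₀) ∷ cs →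
  nonemptyConnected v h g ≡ allB (λ c → reach g x₀ y₀ (v ℕ.* h) (proj₁ c) (proj₂ c)) (cells v h g)
connected-eq v h g eq with cells v h g | eq
... | _ | refl = refl

cells-start : ∀ v h r g → length r ≡ v → interval r ≡ true →
  ∃₂ λ x₀ cs → cells v (suc h) (r ∷ g) ≡ (x₀ , 1) ∷ cs × mem (r ∷ g) x₀ 1 ≡ true
cells-start v h r g len ivl = x₀ , cs ++ rest , cong (_++ rest) eq , m
  where
  f : ℕ → List (ℕ × ℕ)
  f x = if mem (r ∷ g) x 1 then (x , 1) ∷ [] else []
  go : ∀ e n i → i < n → mem (r ∷ g) (suc (e i)) 1 ≡ true →
       ∃₂ λ x₀ cs → concatMap f (map suc (applyUpTo e n)) ≡ (x₀ , 1) ∷ cs × mem (r ∷ g) x₀ 1 ≡ true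
  go e (suc n) i i<n m with mem (r ∷ g) (suc (e 0)) 1 in eq
  ... | true = suc (e 0) , _ , refl , eq
  go e (suc n) zero i<n m | false = ⊥-elim (BoolP.not-¬ eq m)
  go e (suc n) (suc i) (s≤s i<n) m | false = go (e ∘ suc) n i i<n m
  first = anyB-elim r (proj₁ (∧-true ivl))
  found = go id v (proj₁ first)
    (≡.subst (proj₁ first <_) len (nthB-length r (proj₁ first) (proj₂ first))) (proj₂ first)
  x₀ = proj₁ found
  cs = proj₁ (proj₂ found)
  eq = proj₁ (proj₂ (proj₂ found))
  m = proj₂ (proj₂ (proj₂ found))
  rest : List (ℕ × ℕ)
  rest = concatMap (λ y → concatMap (λ x → if mem (r ∷ g) x y then (x , y) ∷ [] else []) (range1 v))
                   (map suc (applyUpTo suc h))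

if-true : ∀ {b c} → b ≡ true → (if b then c else true) ≡ true → c ≡ true
if-true refl eq = eq

module _ (v h : ℕ) (r : List Bool) (g : Grid) (sh : Shaped v (suc h) (r ∷ g))
         (ivl : ∀ y → y < suc h → interval (nthRow (r ∷ g) y) ≡ true)
         (x₀ : ℕ) (cs : List (ℕ × ℕ)) (cells-eq : cells v (suc h) (r ∷ g) ≡ (x₀ , 1) ∷ cs)
         (start : mem (r ∷ g) x₀ 1 ≡ true) where
  private
    G : Grid
    G = r ∷ g

    open Reach G x₀ start

    cellReached : ℕ → ℕ → Bool
    cellReached y x = if mem G (suc x) (suc y) then reach G x₀ 1 (v ℕ.* suc h) (suc x) (suc y) else true

    rowReached : ℕ → Bool
    rowReached y = allU (cellReached y) v

    Reached : Bool
    Reached = allU rowReached (suc h)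

    connected-reached : nonemptyConnected v (suc h) G ≡ Reached
    connected-reached = ≡.trans (connected-eq v (suc h) G cells-eq)
      (allB-cells (λ c → reach G x₀ 1 (v ℕ.* suc h) (proj₁ c) (proj₂ c)) v (suc h) G)

    cell-bound : ∀ y x → y < suc h → nthB (nthRow G y) x ≡ true → x < v
    cell-bound y x y< p = ≡.subst (x <_) (shaped-row sh y y<) (nthB-length (nthRow G y) x p)

    reached⇒linked : Reached ≡ true → linked G ≡ true
    reached⇒linked all = linked-intro G λ y y< → meets-row y (≡.subst (suc y <_) (shaped-length sh) y<)
      where
      meets-row : ∀ y → suc y < suc h → meets (nthRow G y) (nthRow G (suc y)) ≡ true
      meets-row y y< with meets (nthRow G y) (nthRow G (suc y)) in eq
      ... | true = refl
      ... | false with anyB-elim (nthRow G (suc y)) (proj₁ (∧-true (ivl (suc y) y<)))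
      ...   | x , p = ⊥-elim (ℕP.1+n≰n (Re-cut y (BoolP.not-¬ eq) (v ℕ.* suc h) (suc x) (suc (suc y)) reached-x))
        where
        reached-x : Re (v ℕ.* suc h) (suc x) (suc (suc y))
        reached-x = if-true p
          (allU-elim (cellReached (suc y)) v (allU-elim rowReached (suc h) all (suc y) y<) x (cell-bound (suc y) x y< p))

    linked⇒reached : linked G ≡ true → Reached ≡ true
    linked⇒reached lk = allU-intro rowReached (suc h) λ y y< → allU-intro (cellReached y) v λ x x< → cell y y< x
      where
      contig : ∀ y → y < suc h → contig₀ (nthRow G y) ≡ true
      contig y y< = proj₂ (∧-true {anyB id (nthRow G y)} (ivl y y<))
      step : ∀ y n → length (nthRow G y) ≡ v → ∀ x → nthB (nthRow G y) x ≡ true →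
             length (nthRow G y) ∸ 1 ℕ.+ suc n ≡ v ℕ.+ n
      step y n refl x p with length (nthRow G y) | nthB-length (nthRow G y) x p
      ... | suc l | _ = ℕP.+-suc l n
      -- Each row costs at most v - 1 steps sideways and each change of row one step up, which stays
      -- within the v·h steps allowed by `nonemptyConnected`.
      row : ∀ y → y < suc h → ∀ x → nthB (nthRow G y) x ≡ true → Re (v ℕ.* suc y) (suc x) (suc y)
      row zero y< x p = first x₀ start (∧-intro (≡ᵇ-refl x₀) refl)
        where
        first : ∀ x₀′ → mem G x₀′ 1 ≡ true → Re 0 x₀′ 1 → Re (v ℕ.* 1) (suc x) 1
        first (suc x′) m re = Re-mono (suc x) 1
          (ℕP.≤-trans (ℕP.≤-reflexive (ℕP.+-identityʳ _))
            (ℕP.≤-trans (ℕP.m∸n≤m (length r) 1)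
              (ℕP.≤-reflexive (≡.trans (shaped-row sh 0 y<) (≡.sym (ℕP.*-identityʳ v))))))
          (walk 0 (contig 0 y<) 0 x′ x m p re)
      row (suc y) y< x p with meets-elim (nthRow G y) (nthRow G (suc y))
          (linked-elim G lk y (≡.subst (suc y <_) (≡.sym (shaped-length sh)) y<))
      ... | x′ , a , b = ≡.subst (λ n → Re n (suc x) (suc (suc y)))
          (≡.trans (step (suc y) (v ℕ.* suc y) (shaped-row sh (suc y) y<) x p) (≡.sym (ℕP.*-suc v (suc y))))
          (walk (suc y) (contig (suc y) y<) (suc (v ℕ.* suc y)) x′ x b p
            (Re-step (v ℕ.* suc y) (suc x′) (suc (suc y)) b
              (inj₂ (inj₂ (inj₁ (row y (ℕP.≤-trans (ℕP.n≤1+n (suc y)) y<) x′ a))))))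
      cell : ∀ y → y < suc h → ∀ x →
        cellReached y x ≡ true
      cell y y< x with nthB (nthRow G y) x in eq
      ... | false = refl
      ... | true = Re-mono (suc x) (suc y) (ℕP.*-monoʳ-≤ v y<) (row y y< x eq)

  connected-linked-from : nonemptyConnected v (suc h) (r ∷ g) ≡ linked (r ∷ g)
  connected-linked-from = ≡.trans connected-reached (bool-ext reached⇒linked linked⇒reached)

connected-linked : ∀ v h r g → Shaped v (suc h) (r ∷ g) →
  (∀ y → y < suc h → interval (nthRow (r ∷ g) y) ≡ true) →
  nonemptyConnected v (suc h) (r ∷ g) ≡ linked (r ∷ g)
connected-linked v h r g sh ivl with cells-start v h r g (shaped-row sh 0 (s≤s z≤n)) (ivl 0 (s≤s z≤n))
... | x₀ , cs , cells-eq , start = connected-linked-from v h r g sh ivl x₀ cs cells-eq start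

nthB-applyUpTo : ∀ r → applyUpTo (nthB r) (length r) ≡ r
nthB-applyUpTo [] = refl
nthB-applyUpTo (b ∷ r) = cong (b ∷_) (nthB-applyUpTo r)

rows-interval : ∀ v h g → Shaped v h g →
  allB (λ y → interval (rowOf v g y)) (range1 h) ≡ allB interval g
rows-interval v h g sh = ≡.trans (allB-range1 (λ y → interval (rowOf v g y)) h) (≡.trans
  (allU-cong h (λ y → cong interval (map-range1 (λ x → mem g x (suc y)) v))) (go sh))
  where
  go : ∀ {h g} → Shaped v h g → allU (λ y → interval (applyUpTo (nthB (nthRow g y)) v)) h ≡ allB interval g
  go [] = refl
  go {g = r ∷ g} (refl ∷ sh) = cong₂ (λ a b → interval a ∧ b) (nthB-applyUpTo r) (go sh)

-- The convexity test read row by row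

nx : St → Bool → St
nx s true = s1
nx s false = clr s

nxt : List St → List Bool → List St
nxt (s ∷ st) (b ∷ r) = nx s b ∷ nxt st r
nxt (s ∷ st) [] = s ∷ st
nxt [] r = []

ok : St → Bool → Bool
ok s2 true = false
ok _ _ = true

allowed : List St → List Bool → Bool
allowed (s ∷ st) (b ∷ r) = ok s b ∧ allowed st r
allowed _ _ = true

-- A nonempty contiguous column is recognised by a three-state automaton; `acc s` is the condition
-- on the unread cells in state `s`.
acc : St → List Bool → Bool
acc s0 l = interval l
acc s1 l = contig₁ l
acc s2 l = contig₂ l

acc-∷ : ∀ s b l → acc s (b ∷ l) ≡ ok s b ∧ acc (nx s b) l
acc-∷ s0 true l = refl
acc-∷ s0 false l = refl
acc-∷ s1 true l = refl
acc-∷ s1 false l = refl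
acc-∷ s2 true l = refl
acc-∷ s2 false l = refl

columns : List St → Grid → Bool
columns [] g = true
columns (s ∷ st) g = acc s (map (λ r → nthB r 0) g) ∧ columns st (map (drop 1) g)

∧-interchange : ∀ a b c d → (a ∧ b) ∧ (c ∧ d) ≡ (a ∧ c) ∧ (b ∧ d)
∧-interchange true b true d = refl
∧-interchange true true false d = refl
∧-interchange true false false d = refl
∧-interchange false b c d = refl

columns-∷ : ∀ st r g → length r ≡ length st →
            columns st (r ∷ g) ≡ allowed st r ∧ columns (nxt st r) g
columns-∷ [] [] g len = refl
columns-∷ (s ∷ st) (b ∷ r) g len = ≡.trans
  (cong₂ _∧_ (acc-∷ s b (map (λ r → nthB r 0) g))
    (columns-∷ st r (map (drop 1) g) (ℕP.suc-injective len)))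
  (∧-interchange (ok s b) (acc (nx s b) (map (λ r → nthB r 0) g)) (allowed st r) _)

columns-[] : ∀ st → columns st [] ≡ reached st
columns-[] [] = refl
columns-[] (s0 ∷ st) = refl
columns-[] (s1 ∷ st) = columns-[] st
columns-[] (s2 ∷ st) = columns-[] st

columns-interval : ∀ v h g → Shaped v h g →
  allB (λ x → interval (colOf h g x)) (range1 v) ≡ columns (0s v) g
columns-interval v h g sh = ≡.trans (allB-range1 (λ x → interval (colOf h g x)) v) (≡.trans
  (allU-cong v (λ x → cong interval
    (≡.trans (map-range1 (λ y → mem g (suc x) y) h) (col x sh)))) (go v g))
  where
  col : ∀ x {h g} → Shaped v h g → applyUpTo (λ y → nthB (nthRow g y) x) h ≡ map (λ r → nthB r x) g
  col x [] = refl
  col x {g = r ∷ g} (_ ∷ sh) = cong (nthB r x ∷_) (col x sh)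
  tail-nth : ∀ x g → map (λ r → nthB r (suc x)) g ≡ map (λ r → nthB r x) (map (drop 1) g)
  tail-nth x [] = refl
  tail-nth x ([] ∷ g) = cong (false ∷_) (tail-nth x g)
  tail-nth x ((b ∷ r) ∷ g) = cong (nthB r x ∷_) (tail-nth x g)
  go : ∀ v g → allU (λ x → interval (map (λ r → nthB r x) g)) v ≡ columns (0s v) g
  go zero g = refl
  go (suc v) g = cong (interval (map (λ r → nthB r 0) g) ∧_)
    (≡.trans (allU-cong v (λ x → cong interval (tail-nth x g))) (go v (map (drop 1) g)))

-- The phases of `ΣE`, `ΣJ`, `ΣI` and `ΣP` as Boolean scans: each accepts exactly the rows over
-- which its sum runs.
okE okJ okI okP : List St → List Bool → Bool
okE (s ∷ st) (false ∷ r) = okE st r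
okE (s ∷ st) (true ∷ r) = false
okE _ _ = true
okJ (s ∷ st) (false ∷ r) = okE st r
okJ (s2 ∷ st) (true ∷ r) = false
okJ (s ∷ st) (true ∷ r) = okJ st r
okJ _ _ = true
okI (s ∷ st) (false ∷ r) = false
okI (s0 ∷ st) (true ∷ r) = okI st r
okI (s1 ∷ st) (true ∷ r) = okJ st r
okI (s2 ∷ st) (true ∷ r) = false
okI _ _ = false
okP (s ∷ st) (false ∷ r) = okP st r
okP (s0 ∷ st) (true ∷ r) = okI st r
okP (s1 ∷ st) (true ∷ r) = okJ st r
okP (s2 ∷ st) (true ∷ r) = false
okP _ _ = false

good : List St → Grid → Bool
good st [] = reached st
good st (r ∷ g) = okP st r ∧ good (nxt st r) g

occupied : List St → List Bool
occupied = map on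

okE-eq : ∀ st r → length r ≡ length st → okE st r ≡ contig₂ r ∧ allowed st r
okE-eq [] [] len = refl
okE-eq (s0 ∷ st) (false ∷ r) len = okE-eq st r (ℕP.suc-injective len)
okE-eq (s1 ∷ st) (false ∷ r) len = okE-eq st r (ℕP.suc-injective len)
okE-eq (s2 ∷ st) (false ∷ r) len = okE-eq st r (ℕP.suc-injective len)
okE-eq (s ∷ st) (true ∷ r) len = refl

okJ-eq : ∀ st r → length r ≡ length st → okJ st r ≡ contig₁ r ∧ allowed st r
okJ-eq [] [] len = refl
okJ-eq (s0 ∷ st) (false ∷ r) len = okE-eq st r (ℕP.suc-injective len)
okJ-eq (s1 ∷ st) (false ∷ r) len = okE-eq st r (ℕP.suc-injective len)
okJ-eq (s2 ∷ st) (false ∷ r) len = okE-eq st r (ℕP.suc-injective len)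
okJ-eq (s0 ∷ st) (true ∷ r) len = okJ-eq st r (ℕP.suc-injective len)
okJ-eq (s1 ∷ st) (true ∷ r) len = okJ-eq st r (ℕP.suc-injective len)
okJ-eq (s2 ∷ st) (true ∷ r) len = ≡.sym (BoolP.∧-zeroʳ (contig₁ r))

meets-ended : ∀ p r → contig₂ r ≡ true → meets p r ≡ false
meets-ended (a ∷ p) (false ∷ r) c = ≡.trans (cong (_∨ meets p r) (BoolP.∧-zeroʳ a)) (meets-ended p r c)
meets-ended [] r c = refl
meets-ended (a ∷ p) [] c = refl

okI-eq : ∀ st r → length r ≡ length st →
         okI st r ≡ contig₁ r ∧ (meets (occupied st) r ∧ allowed st r)
okI-eq [] [] len = refl
okI-eq (s ∷ st) (false ∷ r) len with contig₂ r in c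
... | false = refl
... | true rewrite BoolP.∧-zeroʳ (on s) | meets-ended (occupied st) r c = refl
okI-eq (s0 ∷ st) (true ∷ r) len = okI-eq st r (ℕP.suc-injective len)
okI-eq (s1 ∷ st) (true ∷ r) len = okJ-eq st r (ℕP.suc-injective len)
okI-eq (s2 ∷ st) (true ∷ r) len = ≡.sym (≡.trans (cong (contig₁ r ∧_) (BoolP.∧-zeroʳ _)) (BoolP.∧-zeroʳ (contig₁ r)))

okP-eq : ∀ st r → length r ≡ length st →
         okP st r ≡ contig₀ r ∧ (meets (occupied st) r ∧ allowed st r)
okP-eq [] [] len = refl
okP-eq (s0 ∷ st) (false ∷ r) len = okP-eq st r (ℕP.suc-injective len)
okP-eq (s1 ∷ st) (false ∷ r) len = okP-eq st r (ℕP.suc-injective len)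
okP-eq (s2 ∷ st) (false ∷ r) len = okP-eq st r (ℕP.suc-injective len)
okP-eq (s0 ∷ st) (true ∷ r) len = okI-eq st r (ℕP.suc-injective len)
okP-eq (s1 ∷ st) (true ∷ r) len = okJ-eq st r (ℕP.suc-injective len)
okP-eq (s2 ∷ st) (true ∷ r) len = ≡.sym (≡.trans (cong (contig₁ r ∧_) (BoolP.∧-zeroʳ _)) (BoolP.∧-zeroʳ (contig₁ r)))

meets-any : ∀ p r → meets p r ≡ true → anyB id r ≡ true
meets-any (true ∷ p) (true ∷ r) m = refl
meets-any (false ∷ p) (true ∷ r) m = refl
meets-any (true ∷ p) (false ∷ r) m = meets-any p r m
meets-any (false ∷ p) (false ∷ r) m = meets-any p r m

occupied-nxt : ∀ st r → length r ≡ length st → allowed st r ≡ true → occupied (nxt st r) ≡ r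
occupied-nxt [] [] len a = refl
occupied-nxt (s0 ∷ st) (false ∷ r) len a = cong (false ∷_) (occupied-nxt st r (ℕP.suc-injective len) a)
occupied-nxt (s1 ∷ st) (false ∷ r) len a = cong (false ∷_) (occupied-nxt st r (ℕP.suc-injective len) a)
occupied-nxt (s2 ∷ st) (false ∷ r) len a = cong (false ∷_) (occupied-nxt st r (ℕP.suc-injective len) a)
occupied-nxt (s0 ∷ st) (true ∷ r) len a = cong (true ∷_) (occupied-nxt st r (ℕP.suc-injective len) a)
occupied-nxt (s1 ∷ st) (true ∷ r) len a = cong (true ∷_) (occupied-nxt st r (ℕP.suc-injective len) a)

length-nxt : ∀ st r → length (nxt st r) ≡ length st
length-nxt [] r = refl
length-nxt (s ∷ st) [] = refl
length-nxt (s ∷ st) (b ∷ r) = cong suc (length-nxt st r)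

-- For an allowed row the new state shows which cells it occupies (`occupied-nxt`), so states alone
-- carry the overlap with the preceding row as well as the column conditions.
good-eq : ∀ st g {h} → Shaped (length st) h g →
  (linked (occupied st ∷ g) ∧ allB interval g) ∧ columns st g ≡ good st g
good-eq st [] sh = columns-[] st
good-eq st (r ∷ g) (len ∷ sh) rewrite columns-∷ st r g len | okP-eq st r len
  with meets (occupied st) r in m | allowed st r in a
... | false | _ = ≡.sym (cong (_∧ good (nxt st r) g) (BoolP.∧-zeroʳ (contig₀ r)))
... | true | false = ≡.trans (BoolP.∧-zeroʳ _) (≡.sym (cong (_∧ good (nxt st r) g) (BoolP.∧-zeroʳ (contig₀ r))))
... | true | true rewrite meets-any (occupied st) r m
    with contig₀ r
...   | false = cong (_∧ columns (nxt st r) g) (BoolP.∧-zeroʳ (linked (r ∷ g)))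
...   | true = ≡.trans
        (cong (λ p → (linked (p ∷ g) ∧ allB interval g) ∧ columns (nxt st r) g) (≡.sym (occupied-nxt st r len a)))
        (good-eq (nxt st r) g (≡.subst (λ v → Shaped v _ g) (≡.sym (length-nxt st r)) sh))

allowed-0s : ∀ v r → allowed (0s v) r ≡ true
allowed-0s zero [] = refl
allowed-0s zero (b ∷ r) = refl
allowed-0s (suc v) [] = refl
allowed-0s (suc v) (true ∷ r) = allowed-0s v r
allowed-0s (suc v) (false ∷ r) = allowed-0s v r

length-0s : ∀ v → length (0s v) ≡ v
length-0s zero = refl
length-0s (suc v) = cong suc (length-0s v)

allB-nth : ∀ g → allB interval g ≡ true → ∀ y → y < length g → interval (nthRow g y) ≡ true
allB-nth (r ∷ g) eq zero _ = proj₁ (∧-true eq)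
allB-nth (r ∷ g) eq (suc y) (s≤s y<) = allB-nth g (proj₂ (∧-true {interval r} eq)) y y<

isCP-good : ∀ v h r g → Shaped v (suc h) (r ∷ g) →
            isCP v (suc h) (r ∷ g) ≡ interval r ∧ good (nxt (0s v) r) g
isCP-good v h r g sh@(len ∷ sh′) = begin
  isCP v (suc h) (r ∷ g)
    ≡⟨ cong (nonemptyConnected v (suc h) (r ∷ g) ∧_)
         (cong₂ _∧_ (rows-interval v (suc h) (r ∷ g) sh) (columns-interval v (suc h) (r ∷ g) sh)) ⟩
  nonemptyConnected v (suc h) (r ∷ g) ∧ (allB interval (r ∷ g) ∧ columns (0s v) (r ∷ g))
    ≡⟨ connected ⟩
  linked (r ∷ g) ∧ (allB interval (r ∷ g) ∧ columns (0s v) (r ∷ g))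
    ≡⟨ cong (λ b → linked (r ∷ g) ∧ (allB interval (r ∷ g) ∧ b))
         (≡.trans (columns-∷ (0s v) r g len′) (cong (_∧ columns st g) (allowed-0s v r))) ⟩
  linked (r ∷ g) ∧ ((interval r ∧ allB interval g) ∧ columns st g)
    ≡⟨ rearrange (linked (r ∷ g)) (interval r) (allB interval g) (columns st g) ⟩
  interval r ∧ ((linked (r ∷ g) ∧ allB interval g) ∧ columns st g)
    ≡⟨ cong (λ p → interval r ∧ ((linked (p ∷ g) ∧ allB interval g) ∧ columns st g))
         (occupied-nxt (0s v) r len′ (allowed-0s v r)) ⟨
  interval r ∧ ((linked (occupied st ∷ g) ∧ allB interval g) ∧ columns st g)
    ≡⟨ cong (interval r ∧_) (good-eq st g
         (≡.subst (λ v → Shaped v h g) (≡.sym (≡.trans (length-nxt (0s v) r) (length-0s v))) sh′)) ⟩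
  interval r ∧ good st g ∎
  where
  open ≡.≡-Reasoning
  st : List St
  st = nxt (0s v) r
  len′ : length r ≡ length (0s v)
  len′ = ≡.trans len (≡.sym (length-0s v))
  rearrange : ∀ a b c d → a ∧ ((b ∧ c) ∧ d) ≡ b ∧ ((a ∧ c) ∧ d)
  rearrange true b c d = BoolP.∧-assoc b c d
  rearrange false true c d = refl
  rearrange false false c d = refl
  connected : nonemptyConnected v (suc h) (r ∷ g) ∧ (allB interval (r ∷ g) ∧ columns (0s v) (r ∷ g)) ≡
              linked (r ∷ g) ∧ (allB interval (r ∷ g) ∧ columns (0s v) (r ∷ g))
  -- Linking replaces connectedness only when all rows are intervals; otherwise both sides are
  -- false.
  connected with allB interval (r ∷ g) in eq
  ... | false = ≡.trans (BoolP.∧-zeroʳ _) (≡.sym (BoolP.∧-zeroʳ _))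
  ... | true = cong (_∧ columns (0s v) (r ∷ g)) (connected-linked v h r g sh
    (λ y y< → allB-nth (r ∷ g) eq y (≡.subst (y <_) (≡.sym (shaped-length sh)) y<)))

-- Corners between consecutive rows

ΣU : (ℕ → ℕ) → ℕ → ℕ
ΣU f zero = 0
ΣU f (suc n) = f 0 ℕ.+ ΣU (f ∘ suc) n

ΣU-cong : ∀ {f g} n → (∀ i → f i ≡ g i) → ΣU f n ≡ ΣU g n
ΣU-cong zero eq = refl
ΣU-cong (suc n) eq = cong₂ ℕ._+_ (eq 0) (ΣU-cong n (eq ∘ suc))

ΣU-0 : ∀ n → ΣU (λ _ → 0) n ≡ 0
ΣU-0 zero = refl
ΣU-0 (suc n) = ΣU-0 n

ΣU-+ : ∀ f g n → ΣU (λ i → f i ℕ.+ g i) n ≡ ΣU f n ℕ.+ ΣU g n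
ΣU-+ f g zero = refl
ΣU-+ f g (suc n) = ≡.trans (cong (f 0 ℕ.+ g 0 ℕ.+_) (ΣU-+ (f ∘ suc) (g ∘ suc) n))
  (lemma (f 0) (g 0) (ΣU (f ∘ suc) n) (ΣU (g ∘ suc) n))
  where
  lemma : ∀ a b c d → a ℕ.+ b ℕ.+ (c ℕ.+ d) ≡ a ℕ.+ c ℕ.+ (b ℕ.+ d)
  lemma a b c d = ≡.trans (ℕP.+-assoc a b (c ℕ.+ d)) (≡.trans (cong (a ℕ.+_)
    (≡.trans (≡.sym (ℕP.+-assoc b c d)) (≡.trans (cong (ℕ._+ d) (ℕP.+-comm b c)) (ℕP.+-assoc c b d))))
    (≡.sym (ℕP.+-assoc a c (b ℕ.+ d))))

ΣU-swap : ∀ (F : ℕ → ℕ → ℕ) m n → ΣU (λ i → ΣU (F i) n) m ≡ ΣU (λ j → ΣU (λ i → F i j) m) n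
ΣU-swap F zero n = ≡.sym (ΣU-0 n)
ΣU-swap F (suc m) n = ≡.trans (cong (ΣU (F 0) n ℕ.+_) (ΣU-swap (F ∘ suc) m n))
  (≡.sym (ΣU-+ (F 0) (λ j → ΣU (λ i → F (suc i) j) m) n))

countB-upTo : ∀ p n → countB p (upTo n) ≡ ΣU (bcount ∘ p) n
countB-upTo p n = go id n
  where
  lemma : ∀ b → (if b then 1 else 0) ≡ bcount b
  lemma true = refl
  lemma false = refl
  go : ∀ f n → countB p (applyUpTo f n) ≡ ΣU (bcount ∘ p ∘ f) n
  go f zero = refl
  go f (suc n) = cong₂ ℕ._+_ (lemma (p (f 0))) (go (f ∘ suc) n)

sumN-upTo : ∀ F n → sumN (map F (upTo n)) ≡ ΣU F n
sumN-upTo F n = go id n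
  where
  go : ∀ f n → sumN (map F (applyUpTo f n)) ≡ ΣU (F ∘ f) n
  go f zero = refl
  go f (suc n) = cong (F (f 0) ℕ.+_) (go (f ∘ suc) n)

-- Missing cells are empty, so that [] is the row below and above the polyomino.
corners : Bool → Bool → List Bool → List Bool → ℕ
corners o b [] [] = bcount (exactlyOne o b false false)
corners o b (x ∷ p) [] = bcount (exactlyOne o b x false) ℕ.+ corners x false p []
corners o b [] (y ∷ r) = bcount (exactlyOne o b false y) ℕ.+ corners false y [] r
corners o b (x ∷ p) (y ∷ r) = bcount (exactlyOne o b x y) ℕ.+ corners x y p r

private
  -- The row beneath `nthRow g j`, with `p` beneath the lowest row.
  at : List Bool → Grid → ℕ → List Bool
  at p g zero = p
  at p g (suc y) = nthRow g y

-- One cell gives degree 2, two adjacent cells degree 3, and two opposite cells or more than two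
-- give degree 4.
isD2Vertex-one : ∀ g i j → isD2Vertex g i j ≡
  exactlyOne (nthB (false ∷ at [] g j) i) (nthB (false ∷ nthRow g j) i) (nthB (at [] g j) i) (nthB (nthRow g j) i)
isD2Vertex-one g i j = ≡.trans
  (cong₄ (left i j) (right i j) (left i (suc j)) (right i (suc j)))
  (lemma (nthB (false ∷ at [] g j) i) (nthB (at [] g j) i) (nthB (false ∷ nthRow g j) i) (nthB (nthRow g j) i))
  where
  D : Bool → Bool → Bool → Bool → Bool
  D c₁ c₂ c₃ c₄ = (c₁ ∨ c₂ ∨ c₃ ∨ c₄) ∧ not (c₁ ∧ c₂ ∧ c₃ ∧ c₄) ∧
    (bcount (c₁ ∨ c₃) ℕ.+ bcount (c₂ ∨ c₄) ℕ.+ bcount (c₁ ∨ c₂) ℕ.+ bcount (c₃ ∨ c₄) ≡ᵇ 2)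
  cong₄ : ∀ {a b c d a′ b′ c′ d′} → a ≡ a′ → b ≡ b′ → c ≡ c′ → d ≡ d′ → D a b c d ≡ D a′ b′ c′ d′
  cong₄ refl refl refl refl = refl
  left : ∀ i j → mem g i j ≡ nthB (false ∷ at [] g j) i
  left zero j = refl
  left (suc x) zero = refl
  left (suc x) (suc y) = refl
  right : ∀ i j → mem g (suc i) j ≡ nthB (at [] g j) i
  right i zero = refl
  right i (suc j) = refl
  lemma : ∀ a b c d → D a b c d ≡ exactlyOne a c b d
  lemma true true true true = refl
  lemma true true true false = refl
  lemma true true false true = refl
  lemma true true false false = refl
  lemma true false true true = refl
  lemma true false true false = refl
  lemma true false false true = refl
  lemma true false false false = refl
  lemma false true true true = refl
  lemma false true true false = refl
  lemma false true false true = refl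
  lemma false true false false = refl
  lemma false false true true = refl
  lemma false false true false = refl
  lemma false false false true = refl
  lemma false false false false = refl

private
  vertex : Bool → Bool → List Bool → List Bool → ℕ → ℕ
  vertex o b p r i = bcount (exactlyOne (nthB (o ∷ p) i) (nthB (b ∷ r) i) (nthB p i) (nthB r i))

  nthB-false : ∀ i → nthB (false ∷ []) i ≡ false
  nthB-false zero = refl
  nthB-false (suc i) = refl

corners-bothEmpty : ∀ o b → ΣU (vertex o b [] []) 1 ≡ corners o b [] []
corners-bothEmpty o b = ℕP.+-identityʳ _

corners-sum : ∀ o b p r → length p ≡ length r → ΣU (vertex o b p r) (suc (length r)) ≡ corners o b p r
corners-sum o b [] [] len = corners-bothEmpty o b
corners-sum o b (x ∷ p) (y ∷ r) len =
  cong (bcount (exactlyOne o b x y) ℕ.+_) (corners-sum x y p r (ℕP.suc-injective len))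

corners-sumˡ : ∀ o b r → ΣU (vertex o b [] r) (suc (length r)) ≡ corners o b [] r
corners-sumˡ o b [] = corners-bothEmpty o b
corners-sumˡ o b (y ∷ r) = cong (bcount (exactlyOne o b false y) ℕ.+_) (≡.trans
  (ΣU-cong (suc (length r)) (λ i →
    cong (λ c → bcount (exactlyOne c (nthB (y ∷ r) i) false (nthB r i))) (≡.sym (nthB-false i))))
  (corners-sumˡ false y r))

corners-sumʳ : ∀ o b p → ΣU (vertex o b p []) (suc (length p)) ≡ corners o b p []
corners-sumʳ o b [] = corners-bothEmpty o b
corners-sumʳ o b (x ∷ p) = cong (bcount (exactlyOne o b x false) ℕ.+_) (≡.trans
  (ΣU-cong (suc (length p)) (λ i →
    cong (λ c → bcount (exactlyOne (nthB (x ∷ p) i) c (nthB p i) false)) (≡.sym (nthB-false i))))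
  (corners-sumʳ x false p))

chain : List Bool → Grid → ℕ
chain p [] = corners false false p []
chain p (r ∷ g) = corners false false p r ℕ.+ chain r g

-- `d₂` adds the vertices along vertical lines; exchanging the sums groups them by the horizontal
-- lines between consecutive rows.
d₂-chain : ∀ v h r g → Shaped v (suc h) (r ∷ g) →
           d₂ v (suc h) (r ∷ g) ≡ corners false false [] r ℕ.+ chain r g
d₂-chain v h r g (refl ∷ sh) = begin
  d₂ v (suc h) (r ∷ g)
    ≡⟨ sumN-upTo (λ i → countB (isD2Vertex (r ∷ g) i) (range0 (suc h))) (suc v) ⟩
  ΣU (λ i → countB (isD2Vertex (r ∷ g) i) (range0 (suc h))) (suc v)
    ≡⟨ ΣU-cong (suc v) (λ i → countB-upTo (isD2Vertex (r ∷ g) i) (suc (suc h))) ⟩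
  ΣU (λ i → ΣU (λ j → bcount (isD2Vertex (r ∷ g) i j)) (suc (suc h))) (suc v)
    ≡⟨ ΣU-swap (λ i j → bcount (isD2Vertex (r ∷ g) i j)) (suc v) (suc (suc h)) ⟩
  ΣU (λ j → ΣU (λ i → bcount (isD2Vertex (r ∷ g) i j)) (suc v)) (suc (suc h))
    ≡⟨ ΣU-cong (suc (suc h)) (λ j → ΣU-cong (suc v) (λ i → cong bcount (isD2Vertex-one (r ∷ g) i j))) ⟩
  ΣU (λ j → ΣU (vertex false false (at [] (r ∷ g) j) (nthRow (r ∷ g) j)) (suc v)) (suc (suc h))
    ≡⟨ cong₂ ℕ._+_ (corners-sumˡ false false r) (≡.trans (tail-sum v (suc h) [] r g) (go r refl sh)) ⟩
  corners false false [] r ℕ.+ chain r g ∎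
  where
  open ≡.≡-Reasoning
  at-∷ : ∀ p r g j → at p (r ∷ g) (suc j) ≡ at r g j
  at-∷ p r g zero = refl
  at-∷ p r g (suc j) = refl
  tail-sum : ∀ v h p r g →
    ΣU (λ j → ΣU (vertex false false (at p (r ∷ g) (suc j)) (nthRow g j)) (suc v)) h ≡
    ΣU (λ j → ΣU (vertex false false (at r g j) (nthRow g j)) (suc v)) h
  tail-sum v h p r g =
    ΣU-cong h (λ j → cong (λ q → ΣU (vertex false false q (nthRow g j)) (suc v)) (at-∷ p r g j))
  go : ∀ {v h g} p → length p ≡ v → Shaped v h g →
       ΣU (λ j → ΣU (vertex false false (at p g j) (nthRow g j)) (suc v)) (suc h) ≡ chain p g
  go p refl [] = ≡.trans (ℕP.+-identityʳ _) (corners-sumʳ false false p)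
  go {h = suc h} {g = r ∷ g} p refl (len ∷ sh) = cong₂ ℕ._+_
    (≡.trans (cong (λ n → ΣU (vertex false false p r) (suc n)) (≡.sym len))
      (corners-sum false false p r (≡.sym len)))
    (≡.trans (tail-sum (length p) (suc h) p r g) (go r len sh))

corners-bottom₂ : ∀ r → contig₂ r ≡ true → corners false false [] r ≡ 0
corners-bottom₂ [] c = refl
corners-bottom₂ (false ∷ r) c = corners-bottom₂ r c

corners-bottom₁ : ∀ r → contig₁ r ≡ true → corners false true [] r ≡ 1
corners-bottom₁ [] c = refl
corners-bottom₁ (true ∷ r) c = corners-bottom₁ r c
corners-bottom₁ (false ∷ r) c = cong suc (corners-bottom₂ r c)

corners-bottom : ∀ r → interval r ≡ true → corners false false [] r ≡ 2
corners-bottom (false ∷ r) c = corners-bottom r c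
corners-bottom (true ∷ r) c = cong suc (corners-bottom₁ r c)

corners-top₂ : ∀ p → contig₂ p ≡ true → corners false false p [] ≡ 0
corners-top₂ [] c = refl
corners-top₂ (false ∷ p) c = corners-top₂ p c

corners-top₁ : ∀ p → contig₁ p ≡ true → corners true false p [] ≡ 1
corners-top₁ [] c = refl
corners-top₁ (true ∷ p) c = corners-top₁ p c
corners-top₁ (false ∷ p) c = cong suc (corners-top₂ p c)

corners-top : ∀ p → interval p ≡ true → corners false false p [] ≡ 2
corners-top (false ∷ p) c = corners-top p c
corners-top (true ∷ p) c = cong suc (corners-top₁ p c)

sideCorners : List St → Grid → ℕ
sideCorners st [] = 0
sideCorners st (r ∷ g) = corners false false (occupied st) r ℕ.+ sideCorners (nxt st r) g

chain-sideCorners : ∀ st g {h} → Shaped (length st) h g → interval (occupied st) ≡ true →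
                    good st g ≡ true → chain (occupied st) g ≡ sideCorners st g ℕ.+ 2
chain-sideCorners st [] sh ivl ok = corners-top (occupied st) ivl
chain-sideCorners st (r ∷ g) (len ∷ sh) ivl ok = ≡.trans
  (cong (n ℕ.+_) (≡.trans (cong (λ p → chain p g) (≡.sym occ))
    (chain-sideCorners (nxt st r) g (≡.subst (λ v → Shaped v _ g) (≡.sym (length-nxt st r)) sh)
      (≡.subst (λ p → interval p ≡ true) (≡.sym occ) (∧-intro (meets-any (occupied st) r (proj₁ m×a)) (proj₁ ok′)))
      (proj₂ (∧-true {okP st r} ok)))))
  (≡.sym (ℕP.+-assoc n (sideCorners (nxt st r) g) 2))
  where
  n = corners false false (occupied st) r
  ok′ = ∧-true {contig₀ r} (≡.trans (≡.sym (okP-eq st r len)) (proj₁ (∧-true {okP st r} ok)))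
  m×a = ∧-true {meets (occupied st) r} (proj₂ ok′)
  occ : occupied (nxt st r) ≡ r
  occ = occupied-nxt st r len (proj₂ m×a)

d₂-good : ∀ v h r g → Shaped v (suc h) (r ∷ g) → interval r ≡ true → good (nxt (0s v) r) g ≡ true →
          d₂ v (suc h) (r ∷ g) ≡ 4 ℕ.+ sideCorners (nxt (0s v) r) g
d₂-good v h r g sh@(len ∷ sh′) ivl ok = begin
  d₂ v (suc h) (r ∷ g)                        ≡⟨ d₂-chain v h r g sh ⟩
  corners false false [] r ℕ.+ chain r g      ≡⟨ cong (ℕ._+ chain r g) (corners-bottom r ivl) ⟩
  2 ℕ.+ chain r g                             ≡⟨ cong (λ p → 2 ℕ.+ chain p g) occ ⟨
  2 ℕ.+ chain (occupied st) g                 ≡⟨ cong (2 ℕ.+_) (chain-sideCorners st g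
                                                   (≡.subst (λ v → Shaped v h g) len-st sh′)
                                                   (≡.subst (λ p → interval p ≡ true) (≡.sym occ) ivl) ok) ⟩
  2 ℕ.+ (sideCorners st g ℕ.+ 2)              ≡⟨ cong (2 ℕ.+_) (ℕP.+-comm (sideCorners st g) 2) ⟩
  4 ℕ.+ sideCorners st g                      ∎
  where
  open ≡.≡-Reasoning
  st = nxt (0s v) r
  len-st : v ≡ length st
  len-st = ≡.sym (≡.trans (length-nxt (0s v) r) (length-0s v))
  occ : occupied st ≡ r
  occ = occupied-nxt (0s v) r (≡.trans len (≡.sym (length-0s v))) (allowed-0s v r)

-- Summing over all grids

𝟙 : Bool → ℤ
𝟙 true = 1ℤ
𝟙 false = 0ℤ

sumL : {A : Set} → (A → ℤ) → List A → ℤ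
sumL F [] = 0ℤ
sumL F (x ∷ xs) = F x ℤ.+ sumL F xs

sumL-cong : ∀ {A : Set} {F H : A → ℤ} → (∀ x → F x ≡ H x) → ∀ xs → sumL F xs ≡ sumL H xs
sumL-cong eq [] = refl
sumL-cong eq (x ∷ xs) = cong₂ ℤ._+_ (eq x) (sumL-cong eq xs)

countB-sumL : ∀ {A : Set} (p : A → Bool) xs → + countB p xs ≡ sumL (𝟙 ∘ p) xs
countB-sumL p [] = refl
countB-sumL p (x ∷ xs) with p x
... | true = cong (ℤ._+_ 1ℤ) (countB-sumL p xs)
... | false = ≡.trans (countB-sumL p xs) (≡.sym (ℤP.+-identityˡ _))

sumL-++ : ∀ {A : Set} (F : A → ℤ) xs ys → sumL F (xs ++ ys) ≡ sumL F xs ℤ.+ sumL F ys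
sumL-++ F [] ys = ≡.sym (ℤP.+-identityˡ _)
sumL-++ F (x ∷ xs) ys = ≡.trans (cong (ℤ._+_ (F x)) (sumL-++ F xs ys)) (≡.sym (ℤP.+-assoc (F x) _ _))

sumL-concatMap : ∀ {A B : Set} (F : B → ℤ) (f : A → List B) xs →
                 sumL F (concatMap f xs) ≡ sumL (λ x → sumL F (f x)) xs
sumL-concatMap F f [] = refl
sumL-concatMap F f (x ∷ xs) = ≡.trans (sumL-++ F (f x) (concatMap f xs))
  (cong (ℤ._+_ (sumL F (f x))) (sumL-concatMap F f xs))

sumL-map : ∀ {A B : Set} (F : B → ℤ) (f : A → B) xs → sumL F (map f xs) ≡ sumL (F ∘ f) xs
sumL-map F f [] = refl
sumL-map F f (x ∷ xs) = cong (ℤ._+_ (F (f x))) (sumL-map F f xs)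

sumL-+ : ∀ {A : Set} (F H : A → ℤ) xs → sumL (λ x → F x ℤ.+ H x) xs ≡ sumL F xs ℤ.+ sumL H xs
sumL-+ F H [] = refl
sumL-+ F H (x ∷ xs) = ≡.trans (cong (ℤ._+_ (F x ℤ.+ H x)) (sumL-+ F H xs))
  (S₁.interchange (F x) (H x) (sumL F xs) (sumL H xs))

sumR : ℕ → (List Bool → ℤ) → ℤ
sumR zero F = F []
sumR (suc v) F = sumR v (F ∘ (false ∷_)) ℤ.+ sumR v (F ∘ (true ∷_))

sumG : ℕ → ℕ → (Grid → ℤ) → ℤ
sumG v zero F = F []
sumG v (suc h) F = sumR v (λ r → sumG v h (F ∘ (r ∷_)))

sumR-cong : ∀ v {F H} → (∀ r → length r ≡ v → F r ≡ H r) → sumR v F ≡ sumR v H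
sumR-cong zero eq = eq [] refl
sumR-cong (suc v) eq = cong₂ ℤ._+_ (sumR-cong v (λ r len → eq (false ∷ r) (cong suc len)))
  (sumR-cong v (λ r len → eq (true ∷ r) (cong suc len)))

sumG-cong : ∀ v h {F H} → (∀ g → Shaped v h g → F g ≡ H g) → sumG v h F ≡ sumG v h H
sumG-cong v zero eq = eq [] []
sumG-cong v (suc h) eq = sumR-cong v (λ r len → sumG-cong v h (λ g sh → eq (r ∷ g) (len ∷ sh)))

sumR-+ : ∀ v F H → sumR v (λ r → F r ℤ.+ H r) ≡ sumR v F ℤ.+ sumR v H
sumR-+ zero F H = refl
sumR-+ (suc v) F H = ≡.trans
  (cong₂ ℤ._+_ (sumR-+ v (F ∘ (false ∷_)) (H ∘ (false ∷_))) (sumR-+ v (F ∘ (true ∷_)) (H ∘ (true ∷_))))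
  (S₁.interchange (sumR v (F ∘ (false ∷_))) (sumR v (H ∘ (false ∷_))) _ _)

sumR-0 : ∀ v {F} → (∀ r → F r ≡ 0ℤ) → sumR v F ≡ 0ℤ
sumR-0 zero eq = eq []
sumR-0 (suc v) eq = cong₂ ℤ._+_ (sumR-0 v (eq ∘ (false ∷_))) (sumR-0 v (eq ∘ (true ∷_)))

sumG-0 : ∀ v h {F} → (∀ g → F g ≡ 0ℤ) → sumG v h F ≡ 0ℤ
sumG-0 v zero eq = eq []
sumG-0 v (suc h) eq = sumR-0 v (λ r → sumG-0 v h (eq ∘ (r ∷_)))

sumG-+ : ∀ v h F H → sumG v h (λ g → F g ℤ.+ H g) ≡ sumG v h F ℤ.+ sumG v h H
sumG-+ v zero F H = refl
sumG-+ v (suc h) F H = ≡.trans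
  (sumR-cong v (λ r _ → sumG-+ v h (F ∘ (r ∷_)) (H ∘ (r ∷_)))) (sumR-+ v _ _)

sumL-allRows : ∀ v F → sumL F (allRows v) ≡ sumR v F
sumL-allRows zero F = ℤP.+-identityʳ (F [])
sumL-allRows (suc v) F = ≡.trans (sumL-concatMap F _ (allRows v)) (≡.trans
  (sumL-cong (λ r → cong (ℤ._+_ (F (false ∷ r))) (ℤP.+-identityʳ (F (true ∷ r)))) (allRows v))
  (≡.trans (sumL-+ (F ∘ (false ∷_)) (F ∘ (true ∷_)) (allRows v))
  (cong₂ ℤ._+_ (sumL-allRows v (F ∘ (false ∷_))) (sumL-allRows v (F ∘ (true ∷_))))))

sumG-sumR-swap : ∀ v w h (F : List Bool → Grid → ℤ) →
  sumG v h (λ g → sumR w (λ r → F r g)) ≡ sumR w (λ r → sumG v h (F r))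
sumG-sumR-swap v zero h F = refl
sumG-sumR-swap v (suc w) h F = ≡.trans
  (sumG-+ v h (λ g → sumR w (λ r → F (false ∷ r) g)) (λ g → sumR w (λ r → F (true ∷ r) g)))
  (cong₂ ℤ._+_ (sumG-sumR-swap v w h (F ∘ (false ∷_))) (sumG-sumR-swap v w h (F ∘ (true ∷_))))

-- `allGrids` puts the lowest row in front of grids already chosen, whereas the transfer from row to
-- row fixes the lowest row first; hence the exchange of sums.
sumL-allGrids : ∀ v h F → sumL F (allGrids v h) ≡ sumG v h F
sumL-allGrids v zero F = ℤP.+-identityʳ (F [])
sumL-allGrids v (suc h) F = ≡.trans (sumL-concatMap F _ (allGrids v h)) (≡.trans
  (sumL-cong (λ g → ≡.trans (sumL-map F (_∷ g) (allRows v)) (sumL-allRows v (λ r → F (r ∷ g)))) (allGrids v h))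
  (≡.trans (sumL-allGrids v h (λ g → sumR v (λ r → F (r ∷ g))))
  (sumG-sumR-swap v v h (λ r g → F (r ∷ g)))))

shift : ℕ → Kf → Kf
shift zero f = f
shift (suc n) f = qs (shift n f)

shift-cong : ∀ n {f g} → f ≃ g → shift n f ≃ shift n g
shift-cong zero p = p
shift-cong (suc n) p = qs-cong (shift-cong n p)

term : Bool → ℕ → Kf → Kf
term b n f = if b then shift n f else 0k

sumR-qs : ∀ v (F : List Bool → Kf) k → sumR v (λ r → qs (F r) k) ≡ qs (λ k → sumR v (λ r → F r k)) k
sumR-qs v F zero = sumR-0 v (λ _ → refl)
sumR-qs v F (suc k) = refl

sumR-corner : ∀ v o c o′ c′ (b : List Bool → Bool) (n : List Bool → ℕ) (F : List Bool → Kf) k →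
  sumR v (λ r → term (b r) (bcount (exactlyOne o c o′ c′) ℕ.+ n r) (F r) k) ≡
  corner o c o′ c′ (λ k → sumR v (λ r → term (b r) (n r) (F r) k)) k
sumR-corner v o c o′ c′ b n F k with exactlyOne o c o′ c′
... | false = refl
... | true = ≡.trans (sumR-cong v (λ r _ → term-suc (b r) (n r) (F r) k)) (sumR-qs v (λ r → term (b r) (n r) (F r)) k)
  where
  term-suc : ∀ b n f k → term b (suc n) f k ≡ qs (term b n f) k
  term-suc true n f k = refl
  term-suc false n f zero = refl
  term-suc false n f (suc k) = refl

rowSum : (List St → List Bool → Bool) → Bool → Bool → List St → (List St → Kf) → Kf
rowSum ok o c st G k =
  sumR (length st) (λ r → term (ok st r) (corners o c (occupied st) r) (G (nxt st r)) k)

corner-bcount : ∀ o c f k → shift (bcount (exactlyOne o c false false)) f k ≡ corner o c false false f k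
corner-bcount o c f k with exactlyOne o c false false
... | true = refl
... | false = refl

module _ where
  private
    step : ∀ st o c o′ c′ (b : List St → List Bool → Bool) (G : List St → Kf) {f} →
      rowSum b o′ c′ st G ≃ f → ∀ k →
      sumR (length st) (λ r → term (b st r) (bcount (exactlyOne o c o′ c′) ℕ.+ corners o′ c′ (occupied st) r)
        (G (nxt st r)) k) ≡ corner o c o′ c′ f k
    step st o c o′ c′ b G eq k = ≡.trans
      (sumR-corner (length st) o c o′ c′ (b st) (corners o′ c′ (occupied st)) (G ∘ nxt st) k)
      (corner-cong o c o′ c′ eq k)

    none : ∀ (st : List St) x → x ℤ.+ sumR (length st) (λ _ → 0ℤ) ≡ x
    none st x = ≡.trans (cong (ℤ._+_ x) (sumR-0 (length st) (λ _ → refl))) (ℤP.+-identityʳ x)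

    only : ∀ (st : List St) x → sumR (length st) (λ _ → 0ℤ) ℤ.+ x ≡ x
    only st x = ≡.trans (cong (ℤ._+ x) (sumR-0 (length st) (λ _ → refl))) (ℤP.+-identityˡ x)

  -- Splitting all rows by their first cell reproduces the clauses of `ΣE`; branches rejected by the
  -- scan sum to zero. The other three phases follow the same pattern.
  rowSum-E : ∀ o st G → rowSum okE o false st G ≃ ΣE o st G
  rowSum-E o [] G k = corner-bcount o false (G []) k
  rowSum-E o (s ∷ st) G k = ≡.trans (none st _)
    (step st o false (on s) false okE (G ∘ (clr s ∷_)) (rowSum-E (on s) st (G ∘ (clr s ∷_))) k)

  rowSum-J : ∀ o st G → rowSum okJ o true st G ≃ ΣJ o st G
  rowSum-J o [] G k = corner-bcount o true (G []) k
  rowSum-J o (s0 ∷ st) G k = cong₂ ℤ._+_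
    (step st o true false false okE (G ∘ (s0 ∷_)) (rowSum-E false st (G ∘ (s0 ∷_))) k)
    (step st o true false true okJ (G ∘ (s1 ∷_)) (rowSum-J false st (G ∘ (s1 ∷_))) k)
  rowSum-J o (s1 ∷ st) G k = cong₂ ℤ._+_
    (step st o true true false okE (G ∘ (s2 ∷_)) (rowSum-E true st (G ∘ (s2 ∷_))) k)
    (step st o true true true okJ (G ∘ (s1 ∷_)) (rowSum-J true st (G ∘ (s1 ∷_))) k)
  rowSum-J o (s2 ∷ st) G k = ≡.trans (none st _)
    (step st o true false false okE (G ∘ (s2 ∷_)) (rowSum-E false st (G ∘ (s2 ∷_))) k)

  rowSum-I : ∀ st G → rowSum okI false true st G ≃ ΣI st G
  rowSum-I [] G k = refl
  rowSum-I (s0 ∷ st) G k = ≡.trans (only st _)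
    (step st false true false true okI (G ∘ (s1 ∷_)) (rowSum-I st (G ∘ (s1 ∷_))) k)
  rowSum-I (s1 ∷ st) G k = ≡.trans (only st _)
    (step st false true true true okJ (G ∘ (s1 ∷_)) (rowSum-J true st (G ∘ (s1 ∷_))) k)
  rowSum-I (s2 ∷ st) G k = ≡.trans (only st _) (sumR-0 (length st) (λ _ → refl))

  rowSum-P : ∀ o st G → rowSum okP o false st G ≃ ΣP o st G
  rowSum-P o [] G k = refl
  rowSum-P o (s0 ∷ st) G k = cong₂ ℤ._+_
    (step st o false false false okP (G ∘ (s0 ∷_)) (rowSum-P false st (G ∘ (s0 ∷_))) k)
    (step st o false false true okI (G ∘ (s1 ∷_)) (rowSum-I st (G ∘ (s1 ∷_))) k)
  rowSum-P o (s1 ∷ st) G k = cong₂ ℤ._+_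
    (step st o false true false okP (G ∘ (s2 ∷_)) (rowSum-P true st (G ∘ (s2 ∷_))) k)
    (step st o false true true okJ (G ∘ (s1 ∷_)) (rowSum-J true st (G ∘ (s1 ∷_))) k)
  rowSum-P o (s2 ∷ st) G k = ≡.trans (none st _)
    (step st o false false false okP (G ∘ (s2 ∷_)) (rowSum-P false st (G ∘ (s2 ∷_))) k)

sumG-shift : ∀ v h (p : Grid → Bool) (c : Grid → ℕ) n →
  (λ k → sumG v h (λ g → 𝟙 (p g ∧ (n ℕ.+ c g ≡ᵇ k)))) ≃ shift n (λ k → sumG v h (λ g → 𝟙 (p g ∧ (c g ≡ᵇ k))))
sumG-shift v h p c zero k = refl
sumG-shift v h p c (suc n) zero = sumG-0 v h (λ g → cong 𝟙 (BoolP.∧-zeroʳ (p g)))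
sumG-shift v h p c (suc n) (suc k) = sumG-shift v h p c n k

sumG-completions : ∀ h v st → length st ≡ v →
  (λ k → sumG v h (λ g → 𝟙 (good st g ∧ (sideCorners st g ≡ᵇ k)))) ≃ completions h st
sumG-completions zero v st len k with reached st
sumG-completions zero v st len zero | true = refl
sumG-completions zero v st len (suc k) | true = refl
... | false = refl
sumG-completions (suc h) v st refl k = ≡.trans (sumR-cong v (λ r len → first-row r))
  (rowSum-P false st (completions h) k)
  where
  first-row : ∀ r → sumG v h (λ g → 𝟙 (good st (r ∷ g) ∧ (sideCorners st (r ∷ g) ≡ᵇ k))) ≡
    term (okP st r) (corners false false (occupied st) r) (completions h (nxt st r)) k
  first-row r with okP st r
  ... | false = sumG-0 v h (λ _ → refl)
  ... | true = ≡.trans (sumG-shift v h (good (nxt st r)) (sideCorners (nxt st r)) (corners false false (occupied st) r) k)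
    (shift-cong (corners false false (occupied st) r) (sumG-completions h v (nxt st r) (length-nxt st r)) k)

-- The lowest row and the full generating function

FJ FP : ℕ → (List St → Kf) → Kf
FJ zero G = G []
FJ (suc v) G = G (0s (suc v)) ⊞ FJ v (G ∘ (s1 ∷_))
FP zero G = 0k
FP (suc v) G = FP v (G ∘ (s0 ∷_)) ⊞ FJ v (G ∘ (s1 ∷_))

firstSum : (List Bool → Bool) → ℕ → (List St → Kf) → Kf
firstSum ok v G k = sumR v (λ r → term (ok r) 0 (G (nxt (0s v) r)) k)

firstSum-E : ∀ v G → firstSum contig₂ v G ≃ G (0s v)
firstSum-E zero G k = refl
firstSum-E (suc v) G k = ≡.trans (cong₂ ℤ._+_ (firstSum-E v (G ∘ (s0 ∷_)) k) (sumR-0 v (λ _ → refl)))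
  (ℤP.+-identityʳ _)

firstSum-J : ∀ v G → firstSum contig₁ v G ≃ FJ v G
firstSum-J zero G k = refl
firstSum-J (suc v) G k = cong₂ ℤ._+_ (firstSum-E v (G ∘ (s0 ∷_)) k) (firstSum-J v (G ∘ (s1 ∷_)) k)

firstSum-P : ∀ v G → firstSum interval v G ≃ FP v G
firstSum-P zero G k = refl
firstSum-P (suc v) G k = cong₂ ℤ._+_ (firstSum-P v (G ∘ (s0 ∷_)) k) (firstSum-J v (G ∘ (s1 ∷_)) k)

FP-cong : ∀ v {G H : List St → Kf} → (∀ st → G st ≃ H st) → FP v G ≃ FP v H
FP-cong v {G} {H} eq = ≃-trans (≃-sym (firstSum-P v G)) (≃-trans
  (λ k → sumR-cong v (λ r _ → term-cong (interval r) (eq (nxt (0s v) r)) k)) (firstSum-P v H))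
  where
  term-cong : ∀ b {f g} → f ≃ g → term b 0 f ≃ term b 0 g
  term-cong true p = p
  term-cong false p k = refl

FJ-N : ∀ v G → FJ v G ≃ Nˡ (ones G) 0 v
FJ-N zero G k = refl
FJ-N (suc v) G = ⊞-congˡ {G (0s (suc v))} (≃-trans (FJ-N v (G ∘ (s1 ∷_))) (Nˡ-shift (ones G) 0 v))

-- `p` columns have been passed already. The lowest row starts after `a` more, N sums over its
-- length, and the first cell of the row is the offset between `suc v` and `v`.
FP-diag : ∀ h v p → FP (suc v) (completions h ∘ rep p s0) ≃ diag (λ a d → Nˡ (C h (a ℕ.+ p)) 0 d) v
FP-diag h v p = ≃-trans (⊞-congˡ {FP v (completions h ∘ rep p s0 ∘ (s0 ∷_))}
  (≃-trans (FJ-N v (completions h ∘ rep p s0 ∘ (s1 ∷_))) (λ _ → refl))) (go v)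
  where
  go : ∀ v → FP v (completions h ∘ rep p s0 ∘ (s0 ∷_)) ⊞ Nˡ (C h p) 0 v ≃ diag (λ a d → Nˡ (C h (a ℕ.+ p)) 0 d) v
  go zero = ⊞-0ˡ (λ _ → refl)
  go (suc v) k = ≡.trans
    (cong (ℤ._+ Nˡ (C h p) 0 (suc v) k) (≃-trans
      (FP-cong (suc v) (λ st → ≡⇒≃ (cong (completions h) (rep-∷ p s0 st))))
      (≃-trans (FP-diag h v (suc p))
        (diag-cong (λ a d → ≡⇒≃ (cong (λ b → Nˡ (C h b) 0 d) (ℕP.+-suc a p))) v)) k))
    (ℤP.+-comm _ (Nˡ (C h p) 0 (suc v) k))

FP-L₀ : ∀ h v → FP (suc v) (completions h) ≃ Nˡ (L₀ h) 0 v
FP-L₀ h v = ≃-trans (FP-diag h v 0) (≃-trans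
  (diag-cong (λ a d → ≡⇒≃ (cong (λ b → Nˡ (C h b) 0 d) (ℕP.+-identityʳ a))) v)
  (diag-Nᵈ (C h) 0 v))

E-suc : ∀ v h k → E v (suc h) k ≡ shift 4 (FP v (completions h)) k
E-suc v h k = begin
  + cpCount v (suc h) k
    ≡⟨ countB-sumL _ (allGrids v (suc h)) ⟩
  sumL (λ g → 𝟙 (isCP v (suc h) g ∧ (d₂ v (suc h) g ≡ᵇ k))) (allGrids v (suc h))
    ≡⟨ sumL-allGrids v (suc h) _ ⟩
  sumR v (λ r → sumG v h (λ g → 𝟙 (isCP v (suc h) (r ∷ g) ∧ (d₂ v (suc h) (r ∷ g) ≡ᵇ k))))
    ≡⟨ sumR-cong v row ⟩
  sumR v (λ r → shift 4 (term (interval r) 0 (completions h (nxt (0s v) r))) k)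
    ≡⟨ sumR-shift 4 (λ r → term (interval r) 0 (completions h (nxt (0s v) r))) k ⟩
  shift 4 (firstSum interval v (completions h)) k
    ≡⟨ shift-cong 4 (firstSum-P v (completions h)) k ⟩
  shift 4 (FP v (completions h)) k ∎
  where
  open ≡.≡-Reasoning
  sumR-shift : ∀ n (F : List Bool → Kf) k → sumR v (λ r → shift n (F r) k) ≡ shift n (λ k → sumR v (λ r → F r k)) k
  sumR-shift zero F k = refl
  sumR-shift (suc n) F k = ≡.trans (sumR-qs v (λ r → shift n (F r)) k) (qs-cong (sumR-shift n F) k)
  grid : ∀ r g → Shaped v (suc h) (r ∷ g) →
    isCP v (suc h) (r ∷ g) ∧ (d₂ v (suc h) (r ∷ g) ≡ᵇ k) ≡
    (interval r ∧ good (nxt (0s v) r) g) ∧ (4 ℕ.+ sideCorners (nxt (0s v) r) g ≡ᵇ k)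
  grid r g sh rewrite isCP-good v h r g sh with interval r in i | good (nxt (0s v) r) g in ok
  ... | false | _ = refl
  ... | true | false = refl
  ... | true | true = cong (_≡ᵇ k) (d₂-good v h r g sh i ok)
  row : ∀ r → length r ≡ v →
    sumG v h (λ g → 𝟙 (isCP v (suc h) (r ∷ g) ∧ (d₂ v (suc h) (r ∷ g) ≡ᵇ k))) ≡
    shift 4 (term (interval r) 0 (completions h (nxt (0s v) r))) k
  row r len = ≡.trans (sumG-cong v h (λ g sh → cong 𝟙 (grid r g (len ∷ sh)))) (≡.trans
    (sumG-shift v h (λ g → interval r ∧ good (nxt (0s v) r) g) (sideCorners (nxt (0s v) r)) 4 k)
    (shift-cong 4 (lemma (interval r)) k))
    where
    lemma : ∀ b → (λ k → sumG v h (λ g → 𝟙 ((b ∧ good (nxt (0s v) r) g) ∧ (sideCorners (nxt (0s v) r) g ≡ᵇ k)))) ≃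
                  term b 0 (completions h (nxt (0s v) r))
    lemma true = sumG-completions h v (nxt (0s v) r) (≡.trans (length-nxt (0s v) r) (length-0s v))
    lemma false k = sumG-0 v h (λ _ → refl)

E′-coefficient : ∀ i j k → E′ i j k ≡ shift 4 ((X *ₛ (Y *ₛ (Y *ₛ Nᵒ V₀ 0))) i j) k
E′-coefficient i j k = ≡.trans
  (identity (f ∷ Q ∷ []) (ν 1 :^ 4 :* ν 0) (ν 1 :* (ν 1 :* (ν 1 :* (ν 1 :* ν 0)))) refl i j k)
  (≡.trans (Q-*-qs (Q *ₛ (Q *ₛ (Q *ₛ f))) i j k) (qs-cong (≃-trans (Q-*-qs (Q *ₛ (Q *ₛ f)) i j)
  (qs-cong (≃-trans (Q-*-qs (Q *ₛ f) i j) (qs-cong (Q-*-qs f i j))))) k))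
  where
  f : PS
  f = X *ₛ (Y *ₛ (Y *ₛ Nᵒ V₀ 0))

parity : ∀ j → (∃ λ h → j ≡ double h) ⊎ (∃ λ h → j ≡ suc (double h))
parity zero = inj₁ (0 , refl)
parity (suc j) with parity j
... | inj₁ (h , refl) = inj₂ (h , refl)
... | inj₂ (h , refl) = inj₁ (suc h , refl)

ι-E : ι E ≈ E′
ι-E i j k = ≡.trans (lemma i j k) (≡.sym (E′-coefficient i j k))
  where
  f : PS
  f = Y *ₛ (Y *ₛ Nᵒ V₀ 0)
  shift-0 : ∀ n {g : Kf} → g ≃ 0k → shift n g ≃ 0k
  shift-0 zero p = p
  shift-0 (suc n) p = qs-0 (shift-0 n p)
  X-0 : ∀ i j → (∀ i → f i j ≃ 0k) → (X *ₛ f) i j ≃ 0k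
  X-0 zero j p = X-*-zero f j
  X-0 (suc i) j p k = ≡.trans (X-*-suc f i j k) (p i k)
  spread-odd : ∀ (g : ℕ → Kf) h → Spread.spread ℤ⟦q⟧ g (suc (double h)) ≡ 0k
  spread-odd g zero = refl
  spread-odd g (suc h) = spread-odd (g ∘ suc) h
  lemma : ∀ i j k → ι E i j k ≡ shift 4 ((X *ₛ f) i j) k
  -- With no rows there are no cells, so the coefficient of E computes to zero.
  lemma i 0 k = ≡.sym (shift-0 4 (X-0 i 0 (Y²-zero (Nᵒ V₀ 0))) k)
  lemma i 1 k = ≡.sym (shift-0 4 (X-0 i 1 (Y²-one (Nᵒ V₀ 0))) k)
  lemma i (suc (suc j)) k with parity j
  ... | inj₁ (h , refl) = ≡.trans (cong (λ g → g k) (Spread.spread-double ℤ⟦q⟧ (E i ∘ suc) h))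
    (≡.trans (E-suc i h k) (shift-cong 4 (≃-sym (X-even i)) k))
    where
    X-even : ∀ i → (X *ₛ f) i (suc (suc (double h))) ≃ FP i (completions h)
    X-even zero = X-*-zero f (suc (suc (double h)))
    X-even (suc v) k = ≡.trans (X-*-suc f v (suc (suc (double h))) k)
      (≡.trans (Y²-suc (Nᵒ V₀ 0) v (double h) k)
      (≡.trans (Nˡ-cong (V₀-even h) 0 v k) (≡.sym (FP-L₀ h v k))))
  ... | inj₂ (h , refl) = ≡.trans (cong (λ g → g k) (spread-odd (E i ∘ suc) h))
    (≡.sym (shift-0 4 (X-0 i (suc (suc (suc (double h)))) (λ i k →
      ≡.trans (Y²-suc (Nᵒ V₀ 0) i (suc (double h)) k) (Nˡ-0 (V₀-odd h) 0 i k))) k))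

theorem5p1 : (S S⁻³ Δ⁻² : PS) →
    S *ₛ S ≈ Δ → S 0 0 0 ≡ 1ℤ →
    (S ^ₛ 3) *ₛ S⁻³ ≈ # 1 → (Δ ^ₛ 2) *ₛ Δ⁻² ≈ # 1 →
    E ≈ -ₛ (N₀ *ₛ S⁻³) +ₛ N *ₛ Δ⁻²
theorem5p1 S S⁻³ Δ⁻² = closed-form E S S⁻³ Δ⁻² ι-E
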